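{- Let $\gamma>0$ and let $r\geq 3$ be an integer. If \textsc{$k$-HyperPath} in undirected $r$-uniform hypergraphs can be solved in time $O^*(2^{(1-1/(r-1)-\gamma)k})$, then there exists $\delta=\delta(\gamma)>0$ such that \textsc{Set Cover} on $n$ elements can be solved in time $O^*(2^{(1-\delta)n})$.
   Context: An $r$-uniform (undirected) hypergraph $H=(V,E)$ has hyperedges that are $r$-element subsets of $V$. A tight path of length $k$ in $H$ is a sequence $v_1,\dots,v_k$ of $k$ distinct nodes such that every $r$ consecutive nodes $\{v_i,\dots,v_{i+r-1}\}$ ($1\le i\le k-r+1$) form a hyperedge of $H$. \textsc{$k$-HyperPath}: given an $r$-uniform hypergraph $H$ and an integer $k$, decide whether $H$ contains a tight path of length $k$. \textsc{Set Cover}: given a ground set $U$ of $n$ elements and a family $\mathcal{S}\subseteq 2^U$ of $m$ subsets, find a minimum-size subfamily of $\mathcal{S}$ whose union is $U$. The notation $O^*(f)$ hides factors polynomial in the input size (e.g. in $n$ and $m$, or in the number of nodes and hyperedges). -}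

module Defs where

open import Data.Bool using (Bool; true; false)
open import Data.Fin using (Fin)
open import Data.Fin.Subset using (Subset; ⁅_⁆; ⋃; ∣_∣; ⊤)
open import Data.Integer using (+_; -[1+_])
open import Data.List using (List; []; _∷_; length; map; take; drop)
open import Data.List.Membership.Propositional using (_∈_)
open import Data.List.Relation.Binary.Subset.Propositional using (_⊆_)
open import Data.List.Relation.Unary.All using (All)
open import Data.List.Relation.Unary.Unique.Propositional using (Unique)
open import Data.Nat using (ℕ; zero; suc; _+_; _*_; _^_; _≤_; s≤s; _≟_)
open import Data.Product using (Σ; ∃; ∃-syntax; _×_; _,_)
open import Data.Rational using (ℚ; 1ℚ; _/_; _-_; ↥_; ↧ₙ_)
open import Data.Sum using (_⊎_)
open import Data.Vec using (toList)
open import Relation.Binary.PropositionalEquality using (_≡_)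
open import Relation.Nullary using (¬_; yes; no)

-- Model of computation: the WHILE language of N. D. Jones ("Computability and
-- Complexity from a Programming Perspective", 1997): imperative programs over
-- binary trees. Time counts elementary operations (cons, hd, tl, variable
-- access, assignment, test), trees being pointers to immutable shared cells.
-- A unit-cost tree operation is O(1) pointer operations on a RAM, and a RAM
-- step with O(log T)-bit words costs polylog(T) here (memory kept as a balanced
-- tree). So running times T = 2^poly(input size) agree with RAM times up to a
-- factor polynomial in the input size, which is what O* requires; mere
-- polynomial equivalence (as for Turing machines) could square 2^(α k).

infixr 5 _∙_

data Tree : Set where
  nil : Tree
  _∙_ : Tree → Tree → Tree

data Expr : Set where
  var   : ℕ → Expr
  nil   : Expr
  cons  : Expr → Expr → Expr
  hd tl : Expr → Expr

infix  6 _:=_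
infixr 5 _⨟_

data Cmd : Set where
  skip          : Cmd
  _:=_          : ℕ → Expr → Cmd
  _⨟_           : Cmd → Cmd → Cmd
  if_then_else_ : Expr → Cmd → Cmd → Cmd
  while_loop_   : Expr → Cmd → Cmd

Store : Set
Store = ℕ → Tree

_[_↦_] : Store → ℕ → Tree → Store
(σ [ x ↦ t ]) y with x ≟ y
... | yes _ = t
... | no  _ = σ y

left right : Tree → Tree
left nil      = nil
left (l ∙ _)  = l
right nil     = nil
right (_ ∙ r) = r

eval : Expr → Store → Tree
eval (var x)    σ = σ x
eval nil        σ = nil
eval (cons e f) σ = eval e σ ∙ eval f σ
eval (hd e)     σ = left (eval e σ)
eval (tl e)     σ = right (eval e σ)

cost : Expr → ℕ
cost (var _)    = 1
cost nil        = 1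
cost (cons e f) = 1 + cost e + cost f
cost (hd e)     = 1 + cost e
cost (tl e)     = 1 + cost e

-- ⟨ c , σ ⟩⇓[ t ] σ′ : started in store σ, c halts after time t in store σ′.
-- In tests, nil is false and every other tree is true.
data ⟨_,_⟩⇓[_]_ : Cmd → Store → ℕ → Store → Set where
  ⇓-skip  : ∀ {σ} → ⟨ skip , σ ⟩⇓[ 1 ] σ
  ⇓-:=    : ∀ {σ x e} → ⟨ x := e , σ ⟩⇓[ 1 + cost e ] (σ [ x ↦ eval e σ ])
  ⇓-⨟     : ∀ {σ σ′ σ″ c d s t} →
            ⟨ c , σ ⟩⇓[ s ] σ′ → ⟨ d , σ′ ⟩⇓[ t ] σ″ →
            ⟨ c ⨟ d , σ ⟩⇓[ s + t ] σ″
  ⇓-then  : ∀ {σ σ′ e c d l r t} → eval e σ ≡ l ∙ r →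
            ⟨ c , σ ⟩⇓[ t ] σ′ →
            ⟨ if e then c else d , σ ⟩⇓[ 1 + cost e + t ] σ′
  ⇓-else  : ∀ {σ σ′ e c d t} → eval e σ ≡ nil →
            ⟨ d , σ ⟩⇓[ t ] σ′ →
            ⟨ if e then c else d , σ ⟩⇓[ 1 + cost e + t ] σ′
  ⇓-stop  : ∀ {σ e c} → eval e σ ≡ nil →
            ⟨ while e loop c , σ ⟩⇓[ 1 + cost e ] σ
  ⇓-loop  : ∀ {σ σ′ σ″ e c l r s t} → eval e σ ≡ l ∙ r →
            ⟨ c , σ ⟩⇓[ s ] σ′ → ⟨ while e loop c , σ′ ⟩⇓[ t ] σ″ →
            ⟨ while e loop c , σ ⟩⇓[ 1 + cost e + s + t ] σ″

-- The input is placed in variable 0, where the output is also left; all other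
-- variables are initially nil.
initial : Tree → Store
initial t zero    = t
initial t (suc _) = nil

_on_outputs_inTime_ : Cmd → Tree → Tree → ℕ → Set
c on input outputs output inTime t =
  ∃[ σ ] ⟨ c , initial input ⟩⇓[ t ] σ × σ 0 ≡ output

encodeℕ : ℕ → Tree
encodeℕ zero    = nil
encodeℕ (suc n) = nil ∙ encodeℕ n

encodeBool : Bool → Tree
encodeBool false = nil
encodeBool true  = nil ∙ nil

encodeList : {A : Set} → (A → Tree) → List A → Tree
encodeList f []       = nil
encodeList f (x ∷ xs) = f x ∙ encodeList f xs

encodeSubset : ∀ {n} → Subset n → Tree
encodeSubset p = encodeList encodeBool (toList p)

record Problem : Set₁ where
  field
    Instance  : Set
    encode    : Instance → Tree
    Answer    : Instance → Tree → Set
    size      : Instance → ℕ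
    parameter : Instance → ℕ

-- T ≤ P · 2^(α x), raised to the power of the denominator of α and cleared of
-- negative exponents.
_≤_·2^[_·_] : ℕ → ℕ → ℚ → ℕ → Set
T ≤ P ·2^[ α · x ] with ↥ α
... | + a      = T ^ ↧ₙ α ≤ P ^ ↧ₙ α * 2 ^ (a * x)
... | -[1+ a ] = T ^ ↧ₙ α * 2 ^ (suc a * x) ≤ P ^ ↧ₙ α

-- Solvable in time O*(2^(α · parameter)); the factor hidden by O* is
-- C (1 + size)^d.
_SolvableInTimeO*2^[_] : Problem → ℚ → Set
Π SolvableInTimeO*2^[ α ] =
  ∃[ prog ] ∃[ C ] ∃[ d ] ((I : Instance) →
    ∃[ output ] ∃[ T ]
      prog on encode I outputs output inTime T
      × Answer I output
      × T ≤ C * suc (size I) ^ d ·2^[ α · parameter I ])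
  where open Problem Π

record UniformHypergraph (r : ℕ) : Set where
  field
    nodes    : ℕ
    edges    : List (Subset nodes)
    distinct : Unique edges
    uniform  : All (λ e → ∣ e ∣ ≡ r) edges

setOf : ∀ {n} → List (Fin n) → Subset n
setOf vs = ⋃ (map ⁅_⁆ vs)

-- The length of a path is its number of nodes; windows are indexed from 0.
record TightPath {r : ℕ} (H : UniformHypergraph r) (k : ℕ) : Set where
  open UniformHypergraph H
  field
    path     : List (Fin nodes)
    length≡k : length path ≡ k
    distinctNodes : Unique path
    tight    : ∀ i → i + r ≤ k → setOf (take r (drop i path)) ∈ edges

HyperPath : ℕ → Problem
HyperPath r = record
  { Instance  = UniformHypergraph r × ℕ
  ; encode    = λ (H , k) →
      encodeℕ (nodes H) ∙ encodeList encodeSubset (edges H) ∙ encodeℕ k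
  ; Answer    = λ (H , k) output →
      (TightPath H k × output ≡ encodeBool true)
      ⊎ (¬ TightPath H k × output ≡ encodeBool false)
  ; size      = λ (H , _) → nodes H + length (edges H)
  ; parameter = λ (_ , k) → k
  }
  where open UniformHypergraph

record SetSystem : Set where
  field
    elements : ℕ
    family   : List (Subset elements)
    distinct : Unique family

record Cover (S : SetSystem) : Set where
  open SetSystem S
  field
    subfamily    : List (Subset elements)
    distinctSets : Unique subfamily
    included     : subfamily ⊆ family
    covers       : ⋃ subfamily ≡ ⊤

open Cover using (subfamily)

IsMinimum : ∀ {S} → Cover S → Set
IsMinimum {S} 𝒞 = (𝒟 : Cover S) → length (subfamily 𝒞) ≤ length (subfamily 𝒟)

-- The output is a minimum cover (tagged to differ from nil), or nil if the
-- family does not cover the ground set at all.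
SetCover : Problem
SetCover = record
  { Instance  = SetSystem
  ; encode    = λ S →
      encodeℕ (elements S) ∙ encodeList encodeSubset (family S)
  ; Answer    = λ S output →
      (Σ (Cover S) λ 𝒞 → IsMinimum 𝒞
         × output ≡ nil ∙ encodeList encodeSubset (subfamily 𝒞))
      ⊎ (¬ Cover S × output ≡ nil)
  ; size      = λ S → elements S + length (family S)
  ; parameter = elements
  }
  where open SetSystem

-- 1 - 1/(r-1) - γ, with r = suc (suc s)
hyperPathExponent : (r : ℕ) → 3 ≤ r → ℚ → ℚ
hyperPathExponent (suc zero)    (s≤s ())
hyperPathExponent (suc (suc s)) _ γ = 1ℚ - + 1 / suc s - γ

{-# OPTIONS --safe #-}
module Submission where

-- The theorem holds with δ = γ. Let s = r − 2 and pad the ground set to s B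
-- elements, where B = ⌈n/s⌉ + 3. Assign each element to one of at most t covering
-- sets, order the elements by the index of their set and cut them into B blocks of
-- size s. A path alternates between blocks and connectors, where a connector
-- carries the assignments in the blocks before and after it. A hyperedge with two
-- connectors contains the block between them, so it can check that the assignments
-- of adjacent blocks are ordered and agree; this way t indices mean at most t sets.
-- All other hyperedges consist of one connector and s + 1 elements of its two
-- blocks.
--
-- Conversely, away from the ends of a tight path there are exactly s elements on
-- either side of a connector p and then another connector: two connectors closer
-- than that would lie in two windows, although they determine the hyperedge
-- containing both, and a larger gap does not fit into the 2s elements of p. One of
-- the two neighbours succeeds p and the other precedes it, since the 2s elements do
-- not fit into one block. So a path with k = (s + 1)(B + 1) nodes is monotone and
-- visits B blocks, hence all elements, and yields a cover by t sets.
--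
-- Since s B ≤ n + 4s, the exponent (s/(s + 1) − γ) k is at most (1 − γ) n + 5s. A
-- minimum cover is found by trying all budgets t, and then deleting sets from the
-- family as long as t sets still suffice.

-- The exponent 1 - 1/(r-1) is the price of the connectors: one node in s + 1 is a connector and
-- consumes path length without consuming an element, so a path of length k handles about k s/(s+1)
-- elements. A connector carries 2s slots; since s is fixed, there are only polynomially many of
-- them. Hyperedges are undirected, so a tight path might run against the intended direction or turn
-- around. Running backwards is harmless, as the blocks are then merely met in reverse order;
-- turning around is what must be excluded, and the levels and the counting of elements near a
-- connector serve this. In the time analysis the oracle time 2^(α k) may only enter linearly, since
-- squaring it would ruin the exponent. All bounds on the search therefore have the form polynomial
-- times (oracle time + 1). Time bounds with rational exponents are inequalities between powers. To
-- bound all oracle calls of a run by one number, an integer root is taken, and the denominators of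
-- the two exponents are exchanged by comparing powers. A large γ makes the exponent of the oracle
-- negative. Such an oracle cannot exist, because every program takes at least one step.

open import Defs
open import Data.Bool using (Bool; true; false; _∧_; _∨_; not; T; T?) renaming (if_then_else_ to when_then_else_)
open import Data.Bool.ListAction using (any; all)
open import Data.Bool.Properties using (T-∧; T-∨; T-≡)
open import Data.Empty using (⊥; ⊥-elim)
open import Data.Fin using (Fin; zero; suc; toℕ; fromℕ<)
open import Data.Fin.Properties using (toℕ<n; toℕ-injective; toℕ-fromℕ<)
open import Data.Fin.Subset using (Subset; ∣_∣; ⁅_⁆; ⋃)
import Data.Fin.Subset as Sub
open import Data.Fin.Subset.Properties using (x∈p∪q⁺; x∈p∪q⁻; x∈⁅x⁆; x∈⁅y⁆⇒x≡y; ∉⊥; ∈⊤; ⊆-antisym; ⊆⊤)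
open import Data.Integer as ℤ using (-[1+_])
import Data.Integer.Properties as ℤₚ
open import Data.Integer.Solver using () renaming (module +-*-Solver to ℤS)
open import Data.List using (List; []; _∷_; length; map; _++_; foldl; foldr; reverse; replicate; concatMap; filterᵇ; drop; take; null; downFrom; upTo; applyUpTo; lookup; tabulate)
open import Data.List.Membership.Propositional using (_∈_; _∉_; find; lose)
open import Data.List.Membership.Propositional.Properties
open import Data.List.Properties using (++-assoc; ++-identityʳ; reverse-foldl; length-map; length-++; length-replicate; length-tabulate; length-take; length-drop; length-applyUpTo; length-upTo; length-downFrom; map-upTo; map-++; map-∘; map-id; ∷-injectiveˡ; ∷-injectiveʳ)
open import Data.List.Relation.Binary.Subset.Propositional using (_⊆_)
open import Data.List.Relation.Unary.All as All using (All; []; _∷_)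
open import Data.List.Relation.Unary.All.Properties using (All¬⇒¬Any; ¬Any⇒All¬; all⁺; all⁻)
open import Data.List.Relation.Unary.AllPairs using (AllPairs; []; _∷_)
import Data.List.Relation.Unary.AllPairs.Properties as AllPairs
open import Data.List.Relation.Unary.Any as Any using (here; there)
open import Data.List.Relation.Unary.Any.Properties using (any⁺; any⁻; lookup-index)
open import Data.List.Relation.Unary.Unique.Propositional using (Unique)
import Data.List.Relation.Unary.Unique.Propositional.Properties as Unique
open import Data.Nat using (ℕ; zero; suc; _+_; _*_; _^_; _∸_; _⊓_; _⊔_; _≤_; _<_; z≤n; s≤s; _≟_; _<?_; _≤?_; pred; NonZero; >-nonZero)
open import Data.Nat.Coprimality using (Coprime)
open import Data.Nat.Divisibility using (divides-refl)
open import Data.Nat.DivMod using (_/_; _%_; m≡m%n+[m/n]*n; [m+kn]%n≡m%n; m%n<n; m<n⇒m%n≡m; m<n⇒m/n≡0; +-distrib-/-∣ʳ; m*n/n≡m; m<n*o⇒m/o<n; m/n*n≤m)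
open import Data.Nat.Properties
open import Data.Nat.Solver using (module +-*-Solver)
open import Data.Product using (Σ; ∃-syntax; _×_; _,_; proj₁; proj₂)
open import Data.Rational as ℚ using (ℚ; mkℚ; 0ℚ; 1ℚ; ↥_; ↧_; ↧ₙ_)
import Data.Rational.Properties as ℚₚ
import Data.Rational.Unnormalised as ℚᵘ
import Data.Rational.Unnormalised.Properties as ℚᵘₚ
open import Data.Sum using (_⊎_; inj₁; inj₂; [_,_]; [_,_]′; swap)
open import Data.Sum.Properties using (inj₂-injective)
open import Data.Vec as Vec using (Vec; []; _∷_; toList)
open import Data.Vec.Properties using ([]=⇒lookup; lookup⇒[]=; toList∘fromList; length-toList)
open import Function using (_∘_; id)
open import Function.Bundles using (Equivalence)
open import Relation.Binary using (DecidableEquality; tri<; tri≈; tri>)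
open import Relation.Binary.PropositionalEquality using (_≡_; _≢_; refl; sym; trans; cong; cong₂; subst; module ≡-Reasoning)
open import Relation.Nullary using (¬_; Dec; yes; no; contradiction)
open +-*-Solver using (solve; _:+_; _:*_; con) renaming (_:=_ to _⊜_)

-- Execution of WHILE programs

-- Hides the final store and the exact time behind an upper bound `T`, so that branches of different
-- cost can share one bound and sequencing merely adds bounds.
record Exec (c : Cmd) (σ : Store) (T : ℕ) (Post : Store → Set) : Set where
  constructor mkExec
  field
    {final} : Store
    {time}  : ℕ
    run     : ⟨ c , σ ⟩⇓[ time ] final
    post    : Post final
    bound   : time ≤ T

get-same : ∀ σ x t → (σ [ x ↦ t ]) x ≡ t
get-same σ x t with x ≟ x
... | yes _  = refl
... | no x≢x = contradiction refl x≢x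

get-other : ∀ σ {x y} t → x ≢ y → (σ [ x ↦ t ]) y ≡ σ y
get-other σ {x} {y} t x≢y with x ≟ y
... | yes x≡y = contradiction x≡y x≢y
... | no _    = refl

Assigned : ℕ → Tree → Store → Store → Set
Assigned x t σ σ′ = σ′ x ≡ t × (∀ {y} → x ≢ y → σ′ y ≡ σ y)

assign : ∀ {σ} x e → Exec (x := e) σ (1 + cost e) (Assigned x (eval e σ) σ)
assign {σ} x e = mkExec ⇓-:= (get-same σ x _ , λ x≢y → get-other σ _ x≢y) ≤-refl

infixl 4 _>>>_

_>>>_ : ∀ {c d σ S T P Q} → Exec c σ S P → (∀ {σ′} → P σ′ → Exec d σ′ T Q) →
        Exec (c ⨟ d) σ (S + T) Q
mkExec r p b >>> f with f p
... | mkExec r′ p′ b′ = mkExec (⇓-⨟ r r′) p′ (+-mono-≤ b b′)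

weaken : ∀ {c σ S T P Q} → S ≤ T → (∀ {σ′} → P σ′ → Q σ′) → Exec c σ S P → Exec c σ T Q
weaken S≤T f (mkExec r p b) = mkExec r (f p) (≤-trans b S≤T)

exec-then : ∀ {e c d σ T P l r} → eval e σ ≡ l ∙ r → Exec c σ T P →
            Exec (if e then c else d) σ (1 + cost e + T) P
exec-then {e} eq (mkExec r p b) = mkExec (⇓-then eq r) p (+-monoʳ-≤ (1 + cost e) b)

exec-else : ∀ {e c d σ T P} → eval e σ ≡ nil → Exec d σ T P →
            Exec (if e then c else d) σ (1 + cost e + T) P
exec-else {e} eq (mkExec r p b) = mkExec (⇓-else eq r) p (+-monoʳ-≤ (1 + cost e) b)

exec-stop : ∀ {e c σ} (P : Store → Set) → eval e σ ≡ nil → P σ →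
            Exec (while e loop c) σ (1 + cost e) P
exec-stop P eq p = mkExec (⇓-stop eq) p ≤-refl

exec-loop : ∀ {e c σ S T P Q l r} → eval e σ ≡ l ∙ r → Exec c σ S P →
            (∀ {σ′} → P σ′ → Exec (while e loop c) σ′ T Q) →
            Exec (while e loop c) σ (1 + cost e + S + T) Q
exec-loop {e} eq (mkExec r p b) f with f p
... | mkExec r′ p′ b′ =
  mkExec (⇓-loop eq r r′) p′ (+-mono-≤ (+-monoʳ-≤ (1 + cost e) b) b′)

-- A program fragment is a family of commands indexed by a base variable, which
-- holds the input and then the output; no variable below the base is changed
-- and nothing is assumed about the variables above it.
Fragment : Set
Fragment = ℕ → Cmd

Unchanged< : ℕ → Store → Store → Set
Unchanged< b σ σ′ = ∀ {z} → z < b → σ′ z ≡ σ z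

Computes : Fragment → Tree → Tree → ℕ → Set
Computes code x y T = ∀ b σ → σ b ≡ x →
  Exec (code b) σ T (λ σ′ → σ′ b ≡ y × Unchanged< b σ σ′)


<1 : ∀ {b} → b < suc b
<1 = ≤-refl

<2 : ∀ {b} → b < suc (suc b)
<2 = m≤n⇒m≤1+n ≤-refl

<3 : ∀ {b} → b < suc (suc (suc b))
<3 = m≤n⇒m≤1+n <2

-- A fragment overwrites its input, so it is run on a copy; the original survives when `x` lies
-- above `b`.
copy-then : Fragment → ℕ → ℕ → Cmd
copy-then f x b = (x := var b) ⨟ f x

exec-copy : ∀ {f u v T} → Computes f u v T → ∀ {σ} x b → σ b ≡ u →
  Exec (copy-then f x b) σ (2 + T) (λ σ′ → σ′ x ≡ v × Unchanged< x σ σ′)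
exec-copy {f} F {σ} x b σb = assign x (var b) >>> λ (eq , oth) →
  weaken ≤-refl (λ (eq′ , fr) → eq′ , λ z<x → trans (fr z<x) (oth (>⇒≢ z<x)))
    (F x _ (trans eq σb))

idF : Fragment
idF b = skip

exprF : (Expr → Expr) → Fragment
exprF e b = b := e (var b)

compF : Fragment → Fragment → Fragment
compF f g b = f b ⨟ g b

computes-comp : ∀ {f g x y z S T} → Computes f x y S → Computes g y z T →
                Computes (compF f g) x z (S + T)
computes-comp F G b σ σb = F b σ σb >>> λ (eq , fr) →
  weaken ≤-refl (λ (eq′ , fr′) → eq′ , λ z<b → trans (fr′ z<b) (fr z<b)) (G b _ eq)

computes-expr : ∀ (e : Expr → Expr) {x y c} → (∀ b σ → σ b ≡ x → eval (e (var b)) σ ≡ y) →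
                (∀ b → cost (e (var b)) ≤ c) → Computes (exprF e) x y (1 + c)
computes-expr e ok ok′ b σ σb =
  weaken (s≤s (ok′ b)) (λ (eq , oth) → trans eq (ok b σ σb) , λ z<b → oth (>⇒≢ z<b))
    (assign b (e (var b)))

pairF : Fragment → Fragment → Fragment
pairF f g b = copy-then f (1 + b) b ⨟ copy-then g (2 + b) b
            ⨟ (b := cons (var (1 + b)) (var (2 + b)))

computes-pair : ∀ {f g x y z S T} → Computes f x y S → Computes g x z T →
                Computes (pairF f g) x (y ∙ z) ((2 + S) + ((2 + T) + 4))
computes-pair F G b σ σb =
  exec-copy F (1 + b) b σb >>> λ {σ₁} (eq₁ , fr₁) →
  exec-copy G (2 + b) b (trans (fr₁ <1) σb) >>> λ {σ₂} (eq₂ , fr₂) →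
  weaken ≤-refl
    (λ (eq , oth) → trans eq (cong₂ _∙_ (trans (fr₂ <1) eq₁) eq₂) ,
       λ z<b → trans (oth (>⇒≢ z<b))
               (trans (fr₂ (<-trans z<b <2)) (fr₁ (<-trans z<b <1))))
    (assign b _)

ifF : Fragment → Fragment → Fragment → Fragment
ifF c f g b = copy-then c (1 + b) b ⨟ (if var (1 + b) then f b else g b)

computes-if-true : ∀ {c f g x l r y S T} → Computes c x (l ∙ r) S → Computes f x y T →
                   Computes (ifF c f g) x y ((2 + S) + (2 + T))
computes-if-true C F b σ σb =
  exec-copy C (1 + b) b σb >>> λ {σ₁} (eq₁ , fr₁) →
  exec-then eq₁ (weaken ≤-refl
    (λ (eq , fr) → eq , λ z<b → trans (fr z<b) (fr₁ (<-trans z<b <1)))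
    (F b _ (trans (fr₁ <1) σb)))

computes-if-false : ∀ {c f g x y S T} → Computes c x nil S → Computes g x y T →
                    Computes (ifF c f g) x y ((2 + S) + (2 + T))
computes-if-false C F b σ σb =
  exec-copy C (1 + b) b σb >>> λ {σ₁} (eq₁ , fr₁) →
  exec-else eq₁ (weaken ≤-refl
    (λ (eq , fr) → eq , λ z<b → trans (fr z<b) (fr₁ (<-trans z<b <1)))
    (F b _ (trans (fr₁ <1) σb)))

-- The common form of case distinction on lists and on sums: a nonempty list is head ∙ tail and a
-- sum is tag ∙ value, so both components are appended to the environment kept in `b`.
splitF : Fragment → Fragment → Fragment → Fragment
splitF c f g b = copy-then c (1 + b) b ⨟ (if var (1 + b)
  then (b := cons (cons (var b) (hd (var (1 + b)))) (tl (var (1 + b)))) ⨟ f b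
  else g b)

computes-split-cons : ∀ {c f g x l r y S T} → Computes c x (l ∙ r) S →
  Computes f ((x ∙ l) ∙ r) y T → Computes (splitF c f g) x y ((2 + S) + (2 + (8 + T)))
computes-split-cons C F b σ σb =
  exec-copy C (1 + b) b σb >>> λ {σ₁} (eq₁ , fr₁) →
  exec-then eq₁ (assign b _ >>> λ (eq₂ , oth) → weaken ≤-refl
    (λ (eq , fr) → eq , λ z<b → trans (fr z<b)
       (trans (oth (>⇒≢ z<b)) (fr₁ (<-trans z<b <1))))
    (F b _ (trans eq₂ (cong₂ _∙_ (cong₂ _∙_ (trans (fr₁ <1) σb) (cong left eq₁))
                                 (cong right eq₁)))))

computes-split-nil : ∀ {c f g x y S T} → Computes c x nil S → Computes g x y T →
                     Computes (splitF c f g) x y ((2 + S) + (2 + T))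
computes-split-nil C F b σ σb =
  exec-copy C (1 + b) b σb >>> λ {σ₁} (eq₁ , fr₁) →
  exec-else eq₁ (weaken ≤-refl
    (λ (eq , fr) → eq , λ z<b → trans (fr z<b) (fr₁ (<-trans z<b <1)))
    (F b _ (trans (fr₁ <1) σb)))

-- Layout: `b` holds the environment, `1 + b` the rest of the list and `2 + b` the accumulator; the
-- step runs at `3 + b` and disturbs none of them.
foldBody : Fragment → ℕ → Cmd
foldBody h b = ((3 + b) := cons (cons (var b) (hd (var (1 + b)))) (var (2 + b)))
             ⨟ h (3 + b) ⨟ ((2 + b) := var (3 + b)) ⨟ ((1 + b) := tl (var (1 + b)))

foldF : Fragment → Fragment → Fragment → Fragment
foldF l z h b = copy-then l (1 + b) b ⨟ copy-then z (2 + b) b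
              ⨟ (while var (1 + b) loop foldBody h b) ⨟ (b := var (2 + b))

FoldState : ℕ → Store → Tree → Tree → Tree → Store → Set
FoldState b σ u l v σ′ = σ′ b ≡ u × σ′ (1 + b) ≡ l × σ′ (2 + b) ≡ v × Unchanged< b σ σ′

exec-foldBody : ∀ {h u x l v w T b σ σ′} → Computes h ((u ∙ x) ∙ v) w T →
  FoldState b σ u (x ∙ l) v σ′ →
  Exec (foldBody h b) σ′ (7 + (T + (2 + 3))) (FoldState b σ u l w)
exec-foldBody {b = b} H (eu , el , ev , fr) =
  assign (3 + b) _ >>> λ {σ₁} (e₁ , o₁) →
  H (3 + b) _ (trans e₁ (cong₂ _∙_ (cong₂ _∙_ eu (cong left el)) ev)) >>> λ {σ₂} (e₂ , f₂) →
  assign (2 + b) _ >>> λ {σ₃} (e₃ , o₃) →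
  weaken ≤-refl
    (λ (e₄ , o₄) →
       trans (o₄ (>⇒≢ <1)) (trans (o₃ (>⇒≢ <2)) (trans (f₂ <3) (trans (o₁ (>⇒≢ <3)) eu))) ,
       trans e₄ (cong right (trans (o₃ (>⇒≢ <1)) (trans (f₂ <2) (trans (o₁ (>⇒≢ <2)) el)))) ,
       trans (o₄ (λ ())) (trans e₃ e₂) ,
       λ z<b → trans (o₄ (>⇒≢ (<-trans z<b <1))) (trans (o₃ (>⇒≢ (<-trans z<b <2)))
         (trans (f₂ (<-trans z<b <3)) (trans (o₁ (>⇒≢ (<-trans z<b <3))) (fr z<b)))))
    (assign (1 + b) _)

-- Typed programs

infixr 6 _⊗_ _⊕_

data Ty : Set where
  nat bool : Ty
  list     : Ty → Ty
  _⊗_ _⊕_  : Ty → Ty → Ty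

El : Ty → Set
El nat      = ℕ
El bool     = Bool
El (list τ) = List (El τ)
El (σ ⊗ τ)  = El σ × El τ
El (σ ⊕ τ)  = El σ ⊎ El τ

enc : ∀ τ → El τ → Tree
enc nat      n        = encodeℕ n
enc bool     b        = encodeBool b
enc (list τ) xs       = encodeList (enc τ) xs
enc (σ ⊗ τ)  (x , y)  = enc σ x ∙ enc τ y
enc (σ ⊕ τ)  (inj₁ x) = nil ∙ enc σ x
enc (σ ⊕ τ)  (inj₂ y) = (nil ∙ nil) ∙ enc τ y

-- `T` is a function of the argument rather than of its size, because the time of an oracle call is
-- only known per instance.
record Comp (σ τ : Ty) (f : El σ → El τ) (T : El σ → ℕ) : Set where
  constructor mkComp
  field
    code    : Fragment
    correct : ∀ a → Computes code (enc σ a) (enc τ (f a)) (T a)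

open Comp

private variable
  Γ ξ σ τ υ : Ty

compC : ∀ {f : El σ → El τ} {g : El τ → El υ} {S T} →
        Comp σ τ f S → Comp τ υ g T → Comp σ υ (g ∘ f) (λ a → S a + T (f a))
compC F G .code = compF (F .code) (G .code)
compC {f = f} F G .correct a =
  computes-comp {f = F .code} {g = G .code} (F .correct a) (G .correct (f a))

pairC : ∀ {f : El Γ → El σ} {g : El Γ → El τ} {S T} → Comp Γ σ f S → Comp Γ τ g T →
        Comp Γ (σ ⊗ τ) (λ γ → f γ , g γ) (λ γ → (2 + S γ) + ((2 + T γ) + 4))
pairC F G .code = pairF (F .code) (G .code)
pairC F G .correct a = computes-pair {f = F .code} {g = G .code} (F .correct a) (G .correct a)

ifC : ∀ {c : El Γ → Bool} {f g : El Γ → El τ} {R S T} →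
      Comp Γ bool c R → Comp Γ τ f S → Comp Γ τ g T →
      Comp Γ τ (λ γ → when c γ then f γ else g γ)
        (λ γ → (2 + R γ) + (2 + (when c γ then S γ else T γ)))
ifC C F G .code = ifF (C .code) (F .code) (G .code)
ifC {c = c} C F G .correct a with c a | C .correct a
... | true  | D = computes-if-true  {c = C .code} {g = G .code} D (F .correct a)
... | false | D = computes-if-false {c = C .code} {f = F .code} D (G .correct a)

listCase : {A C : Set} → C → (A → List A → C) → List A → C
listCase z f []       = z
listCase z f (x ∷ xs) = f x xs

listCaseC : ∀ {l : El Γ → List (El σ)} {z : El Γ → El τ} {h : El ((Γ ⊗ σ) ⊗ list σ) → El τ} {R S T} →
  Comp Γ (list σ) l R → Comp Γ τ z S → Comp ((Γ ⊗ σ) ⊗ list σ) τ h T →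
  Comp Γ τ (λ γ → listCase (z γ) (λ x xs → h ((γ , x) , xs)) (l γ))
    (λ γ → (2 + R γ) + (2 + (8 + listCase (S γ) (λ x xs → T ((γ , x) , xs)) (l γ))))
listCaseC L Z H .code = splitF (L .code) (H .code) (Z .code)
listCaseC {l = l} {R = R} {S = S} L Z H .correct a b s sb with l a | L .correct a
... | x ∷ xs | D = computes-split-cons {c = L .code} {g = Z .code} D (H .correct ((a , x) , xs)) b s sb
-- The repacking cost 8 is charged in the empty case too, which gives both cases one time formula.
... | []     | D = weaken (+-monoʳ-≤ (2 + R a) (+-monoʳ-≤ 2 (m≤n+m (S a) 8))) id
  (computes-split-nil {c = L .code} {f = H .code} D (Z .correct a) b s sb)

exprC : ∀ (e : Expr → Expr) {f : El σ → El τ} →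
  (∀ b s a → s b ≡ enc σ a → eval (e (var b)) s ≡ enc τ (f a)) → (c : ℕ) →
  (∀ b → cost (e (var b)) ≤ c) → Comp σ τ f (λ _ → 1 + c)
exprC e ok c ok′ .code = exprF e
exprC e ok c ok′ .correct a = computes-expr e (λ b s → ok b s a) ok′

tagF projF : Fragment
tagF  = exprF (λ v → tl (hd v))
projF = exprF (λ v → cons (hd (hd v)) (tl v))

computes-tag : ∀ {u l r} → Computes tagF ((u ∙ l) ∙ r) l 4
computes-tag = computes-expr (λ v → tl (hd v)) (λ b s eq → cong (right ∘ left) eq) (λ _ → ≤-refl)

computes-proj : ∀ {u l r} → Computes projF ((u ∙ l) ∙ r) (u ∙ r) 7
computes-proj = computes-expr (λ v → cons (hd (hd v)) (tl v))
  (λ b s eq → cong₂ _∙_ (cong (left ∘ left) eq) (cong right eq)) (λ _ → ≤-refl)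

sumCaseC : ∀ {e : El Γ → El (ξ ⊕ σ)} {f : El (Γ ⊗ ξ) → El τ} {g : El (Γ ⊗ σ) → El τ} {R S T} →
  Comp Γ (ξ ⊕ σ) e R → Comp (Γ ⊗ ξ) τ f S → Comp (Γ ⊗ σ) τ g T →
  Comp Γ τ (λ γ → [ (λ x → f (γ , x)) , (λ y → g (γ , y)) ] (e γ))
    (λ γ → (2 + R γ) + (2 + (8 + ((2 + 4) + (2 + (7 +
              [ (λ x → S (γ , x)) , (λ y → T (γ , y)) ] (e γ)))))))
sumCaseC E F G .code =
  -- An encoded sum is never nil, so the `idF` branch is unreachable.
  splitF (E .code) (ifF tagF (compF projF (G .code)) (compF projF (F .code))) idF
sumCaseC {e = e} E F G .correct a with e a | E .correct a
... | inj₁ x | D = computes-split-cons {c = E .code} {g = idF} D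
  (computes-if-false {c = tagF} {f = compF projF (G .code)} computes-tag
    (computes-comp {f = projF} {g = F .code} computes-proj (F .correct (a , x))))
... | inj₂ y | D = computes-split-cons {c = E .code} {g = idF} D
  (computes-if-true {c = tagF} {g = compF projF (F .code)} computes-tag
    (computes-comp {f = projF} {g = G .code} computes-proj (G .correct (a , y))))

loopTime : {A C : Set} → (A → C → C) → (A → C → ℕ) → C → List A → ℕ
loopTime h T v []       = 2
loopTime h T v (x ∷ xs) = 2 + (7 + (T x v + (2 + 3))) + loopTime h T (h x v) xs

exec-loopF : ∀ {h : El ((Γ ⊗ σ) ⊗ τ) → El τ} {T} (H : Comp ((Γ ⊗ σ) ⊗ τ) τ h T) {b s} γ v xs {s′} →
  FoldState b s (enc Γ γ) (enc (list σ) xs) (enc τ v) s′ →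
  Exec (while var (1 + b) loop foldBody (H .code) b) s′
    (loopTime (λ x v → h ((γ , x) , v)) (λ x v → T ((γ , x) , v)) v xs)
    (FoldState b s (enc Γ γ) nil (enc τ (foldl (λ v x → h ((γ , x) , v)) v xs)))
exec-loopF H γ v []       st@(_ , el , _) = exec-stop _ el st
exec-loopF H γ v (x ∷ xs) st@(_ , el , _) =
  exec-loop el (exec-foldBody (H .correct ((γ , x) , v)) st)
    (λ st′ → exec-loopF H γ _ xs st′)

foldC : ∀ {l : El Γ → List (El σ)} {z : El Γ → El τ} {h : El ((Γ ⊗ σ) ⊗ τ) → El τ} {R S T} →
  Comp Γ (list σ) l R → Comp Γ τ z S → Comp ((Γ ⊗ σ) ⊗ τ) τ h T →
  Comp Γ τ (λ γ → foldl (λ v x → h ((γ , x) , v)) (z γ) (l γ))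
    (λ γ → (2 + R γ) + ((2 + S γ) +
      (loopTime (λ x v → h ((γ , x) , v)) (λ x v → T ((γ , x) , v)) (z γ) (l γ) + 2)))
foldC L Z H .code = foldF (L .code) (Z .code) (H .code)
foldC {l = l} {z} L Z H .correct γ b s sb =
  exec-copy (L .correct γ) (1 + b) b sb >>> λ {σ₁} (e₁ , f₁) →
  exec-copy (Z .correct γ) (2 + b) b (trans (f₁ <1) sb) >>> λ {σ₂} (e₂ , f₂) →
  exec-loopF H γ (z γ) (l γ)
    (trans (f₂ <2) (trans (f₁ <1) sb) , trans (f₂ <1) e₁ , e₂ ,
     λ z<b → trans (f₂ (<-trans z<b <2)) (f₁ (<-trans z<b <1))) >>> λ (_ , _ , ev , fr) →
  weaken ≤-refl (λ (eq , oth) → trans eq ev , λ z<b → trans (oth (>⇒≢ z<b)) (fr z<b))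
    (assign b _)

-- The step is bounded only on accumulators reached after a prefix of the list; no bound independent
-- of the accumulator could be expected. The constant 14 is the loop test together with the fixed
-- part of the body.
loopTime-≤ : {A C : Set} (h : A → C → C) (T : A → C → ℕ) (M : ℕ) → ∀ v xs →
  (∀ ys x zs → xs ≡ ys ++ x ∷ zs → T x (foldl (λ v x → h x v) v ys) ≤ M) →
  loopTime h T v xs ≤ 2 + length xs * (14 + M)
loopTime-≤ h T M v []       ok = ≤-refl
loopTime-≤ h T M v (x ∷ xs) ok = begin
  2 + (7 + (T x v + (2 + 3))) + loopTime h T (h x v) xs
    ≤⟨ +-mono-≤ (+-monoʳ-≤ 9 (+-monoˡ-≤ 5 (ok [] x xs refl)))
         (loopTime-≤ h T M (h x v) xs λ ys y zs eq → ok (x ∷ ys) y zs (cong (x ∷_) eq)) ⟩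
  9 + (M + 5) + (2 + length xs * (14 + M))
    ≡⟨ cong (_+ (2 + length xs * (14 + M))) (trans (cong (9 +_) (+-comm M 5)) refl) ⟩
  14 + M + (2 + length xs * (14 + M))
    ≡⟨ +-comm (14 + M) (2 + length xs * (14 + M)) ⟩
  2 + length xs * (14 + M) + (14 + M)
    ≡⟨ cong (2 +_) (+-comm (length xs * (14 + M)) (14 + M)) ⟩
  2 + (14 + M + length xs * (14 + M)) ∎
  where open ≤-Reasoning

-- Polynomial bounds

cells : Tree → ℕ
cells nil     = 0
cells (l ∙ r) = 1 + cells l + cells r

size : ∀ τ → El τ → ℕ
size τ a = cells (enc τ a)

-- A single exponent is enough: the base is at least 2, so constants and sums are absorbed by a
-- higher degree.
record PolyBounded {σ : Ty} (φ : El σ → ℕ) : Set where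
  constructor mkPB
  field
    degree  : ℕ
    bounded : ∀ a → φ a ≤ (2 + size σ a) ^ degree

open PolyBounded

n<2^n : ∀ n → n < 2 ^ n
n<2^n zero    = ≤-refl
n<2^n (suc n) = begin
  2 + n           ≤⟨ +-mono-≤ (m^n>0 2 n) (n<2^n n) ⟩
  2 ^ n + 2 ^ n   ≡⟨ cong (2 ^ n +_) (sym (+-identityʳ (2 ^ n))) ⟩
  2 * 2 ^ n       ∎
  where open ≤-Reasoning

pb-const : ∀ c → PolyBounded {σ} (λ _ → c)
pb-const c = mkPB c λ a → ≤-trans (<⇒≤ (n<2^n c)) (^-monoˡ-≤ c (m≤m+n 2 _))

pb-size : PolyBounded {σ} (size σ)
pb-size = mkPB 1 λ a → ≤-trans (m≤n+m _ 2) (≤-reflexive (sym (*-identityʳ _)))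

pb-≤ : ∀ {φ ψ : El σ → ℕ} → (∀ a → φ a ≤ ψ a) → PolyBounded ψ → PolyBounded φ
pb-≤ φ≤ψ (mkPB d B) = mkPB d λ a → ≤-trans (φ≤ψ a) (B a)

pb-* : ∀ {φ ψ : El σ → ℕ} → PolyBounded φ → PolyBounded ψ → PolyBounded (λ a → φ a * ψ a)
pb-* (mkPB d B) (mkPB e C) = mkPB (d + e) λ a →
  ≤-trans (*-mono-≤ (B a) (C a)) (≤-reflexive (sym (^-distribˡ-+-* _ d e)))

pb-+ : ∀ {φ ψ : El σ → ℕ} → PolyBounded φ → PolyBounded ψ → PolyBounded (λ a → φ a + ψ a)
pb-+ {σ} {φ} {ψ} (mkPB d B) (mkPB e C) = mkPB (1 + (d + e)) λ a → let y = 2 + size σ a in begin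
  φ a + ψ a                   ≤⟨ +-mono-≤ (B a) (C a) ⟩
  y ^ d + y ^ e               ≤⟨ +-mono-≤ (^-monoʳ-≤ y (m≤m+n d e)) (^-monoʳ-≤ y (m≤n+m e d)) ⟩
  y ^ (d + e) + y ^ (d + e)   ≡⟨ cong (y ^ (d + e) +_) (sym (+-identityʳ _)) ⟩
  2 * y ^ (d + e)             ≤⟨ *-monoˡ-≤ (y ^ (d + e)) (m≤m+n 2 (size σ a)) ⟩
  y * y ^ (d + e)             ∎
  where open ≤-Reasoning

pb-^ : ∀ {φ : El σ → ℕ} → PolyBounded φ → ∀ n → PolyBounded (λ a → φ a ^ n)
pb-^ B zero    = pb-const 1
pb-^ B (suc n) = pb-* B (pb-^ B n)

pb-∘ : ∀ {f : El σ → El τ} {φ : El τ → ℕ} →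
       PolyBounded (λ a → size τ (f a)) → PolyBounded φ → PolyBounded (λ a → φ (f a))
pb-∘ {f = f} S (mkPB d B) = pb-≤ (λ a → B (f a)) (pb-^ (pb-+ (pb-const 2) S) d)

length≤size : ∀ (xs : List (El σ)) → length xs ≤ size (list σ) xs
length≤size []       = z≤n
length≤size (x ∷ xs) = s≤s (≤-trans (length≤size xs) (m≤n+m _ _))

size-++ : ∀ (xs ys : List (El σ)) →
          size (list σ) (xs ++ ys) ≡ size (list σ) xs + size (list σ) ys
size-++ []       ys = refl
size-++ {σ} (x ∷ xs) ys = cong suc (trans (cong (size σ x +_) (size-++ xs ys))
                                          (sym (+-assoc (size σ x) _ _)))

size-middle : ∀ (ys : List (El σ)) x zs → size σ x ≤ size (list σ) (ys ++ x ∷ zs)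
size-middle {σ} ys x zs = ≤-trans (≤-trans (m≤m+n (size σ x) _) (n≤1+n _))
  (≤-trans (m≤n+m _ (size (list σ) ys)) (≤-reflexive (sym (size-++ ys (x ∷ zs)))))

pb-listCase : ∀ {l : El Γ → List (El σ)} {φ : El Γ → ℕ} {ψ : El ((Γ ⊗ σ) ⊗ list σ) → ℕ} →
  PolyBounded {Γ} (λ γ → size (list σ) (l γ)) → PolyBounded φ → PolyBounded ψ →
  PolyBounded {Γ} (λ γ → listCase (φ γ) (λ x xs → ψ ((γ , x) , xs)) (l γ))
pb-listCase {Γ} {σ} {l} {φ} {ψ} L F (mkPB d B) = pb-≤ le
  (pb-+ F (pb-^ (pb-+ (pb-const 3) (pb-+ pb-size L)) d))
  where
  le : ∀ γ → listCase (φ γ) (λ x xs → ψ ((γ , x) , xs)) (l γ)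
           ≤ φ γ + (3 + (size Γ γ + size (list σ) (l γ))) ^ d
  le γ with l γ
  ... | []     = m≤m+n (φ γ) _
  ... | x ∷ xs = ≤-trans (B ((γ , x) , xs)) (≤-trans (^-monoˡ-≤ d (≤-reflexive
          (cong (3 +_) (trans (cong suc (+-assoc (size Γ γ) _ _)) (sym (+-suc _ _))))))
          (m≤n+m _ (φ γ)))

pb-sumCase : ∀ {e : El Γ → El (ξ ⊕ σ)} {φ : El (Γ ⊗ ξ) → ℕ} {ψ : El (Γ ⊗ σ) → ℕ} →
  PolyBounded {Γ} (λ γ → size (ξ ⊕ σ) (e γ)) → PolyBounded φ → PolyBounded ψ →
  PolyBounded {Γ} (λ γ → [ (λ x → φ (γ , x)) , (λ y → ψ (γ , y)) ] (e γ))
pb-sumCase {Γ} {ξ} {σ} {e} {φ} {ψ} E (mkPB d B) (mkPB d′ B′) = pb-≤ le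
  (pb-+ (pb-^ (pb-+ (pb-const 3) (pb-+ pb-size E)) d)
        (pb-^ (pb-+ (pb-const 3) (pb-+ pb-size E)) d′))
  where
  le : ∀ γ → [ (λ x → φ (γ , x)) , (λ y → ψ (γ , y)) ] (e γ)
           ≤ (3 + (size Γ γ + size (ξ ⊕ σ) (e γ))) ^ d + (3 + (size Γ γ + size (ξ ⊕ σ) (e γ))) ^ d′
  le γ with e γ
  ... | inj₁ x = ≤-trans (≤-trans (B (γ , x))
          (^-monoˡ-≤ d (+-monoʳ-≤ 3 (+-monoʳ-≤ (size Γ γ) (n≤1+n _))))) (m≤m+n _ _)
  ... | inj₂ y = ≤-trans (≤-trans (B′ (γ , y))
          (^-monoˡ-≤ d′ (+-monoʳ-≤ 3 (+-monoʳ-≤ (size Γ γ) (m≤n+m _ 2))))) (m≤n+m _ _)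

pb-when : ∀ {c : El Γ → Bool} {φ ψ : El Γ → ℕ} → PolyBounded φ → PolyBounded ψ →
  PolyBounded {Γ} (λ γ → when c γ then φ γ else ψ γ)
pb-when {c = c} {φ} {ψ} F G = pb-≤ le (pb-+ F G)
  where
  le : ∀ γ → (when c γ then φ γ else ψ γ) ≤ φ γ + ψ γ
  le γ with c γ
  ... | true  = m≤m+n _ _
  ... | false = m≤n+m _ _

-- Polynomial-time functions

-- `sizeBound` makes composition possible: the time of a second program is polynomial in the size of
-- an intermediate result.
record Poly (σ τ : Ty) (f : El σ → El τ) : Set where
  constructor mkPoly
  field
    {time}    : El σ → ℕ
    comp      : Comp σ τ f time
    timeBound : PolyBounded time
    sizeBound : PolyBounded (λ a → size τ (f a))

open Poly

-- The program stays the same and only its specification changes; this is how fold programs are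
-- identified with library functions.
ext : ∀ {f g : El σ → El τ} → (∀ a → f a ≡ g a) → Poly σ τ f → Poly σ τ g
ext {τ = τ} f≗g P = mkPoly
  (mkComp (P .comp .code) λ a → subst (λ y → Computes _ _ (enc τ y) _) (f≗g a) (P .comp .correct a))
  (P .timeBound)
  (pb-≤ (λ a → ≤-reflexive (cong (size τ) (sym (f≗g a)))) (P .sizeBound))

infixl 5 _▸_

_▸_ : ∀ {f : El σ → El τ} {g : El τ → El υ} → Poly σ τ f → Poly τ υ g → Poly σ υ (λ a → g (f a))
P ▸ Q = mkPoly (compC (P .comp) (Q .comp))
  (pb-+ (P .timeBound) (pb-∘ (P .sizeBound) (Q .timeBound)))
  (pb-∘ (P .sizeBound) (Q .sizeBound))

infixr 4 _,ₚ_

_,ₚ_ : ∀ {f : El Γ → El σ} {g : El Γ → El τ} → Poly Γ σ f → Poly Γ τ g → Poly Γ (σ ⊗ τ) (λ γ → f γ , g γ)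
P ,ₚ Q = mkPoly (pairC (P .comp) (Q .comp))
  (pb-+ (pb-+ (pb-const 2) (P .timeBound)) (pb-+ (pb-+ (pb-const 2) (Q .timeBound)) (pb-const 4)))
  (pb-+ (pb-+ (pb-const 1) (P .sizeBound)) (Q .sizeBound))

whenₚ : ∀ {c : El Γ → Bool} {f g : El Γ → El τ} → Poly Γ bool c → Poly Γ τ f → Poly Γ τ g →
  Poly Γ τ (λ γ → when c γ then f γ else g γ)
whenₚ {τ = τ} {c = c} {f} {g} C P Q = mkPoly (ifC (C .comp) (P .comp) (Q .comp))
  (pb-+ (pb-+ (pb-const 2) (C .timeBound)) (pb-+ (pb-const 2) (pb-when (P .timeBound) (Q .timeBound))))
  (pb-≤ le (pb-when {c = c} (P .sizeBound) (Q .sizeBound)))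
  where
  le : ∀ γ → size τ (when c γ then f γ else g γ) ≤ (when c γ then size τ (f γ) else size τ (g γ))
  le γ with c γ
  ... | true  = ≤-refl
  ... | false = ≤-refl

listCaseₚ : ∀ {l : El Γ → List (El σ)} {z : El Γ → El τ} {h : El ((Γ ⊗ σ) ⊗ list σ) → El τ} →
  Poly Γ (list σ) l → Poly Γ τ z → Poly ((Γ ⊗ σ) ⊗ list σ) τ h →
  Poly Γ τ (λ γ → listCase (z γ) (λ x xs → h ((γ , x) , xs)) (l γ))
listCaseₚ {τ = τ} {l = l} {z} {h} L Z H = mkPoly (listCaseC (L .comp) (Z .comp) (H .comp))
  (pb-+ (pb-+ (pb-const 2) (L .timeBound)) (pb-+ (pb-const 2) (pb-+ (pb-const 8)
    (pb-listCase {l = l} (L .sizeBound) (Z .timeBound) (H .timeBound)))))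
  (pb-≤ le (pb-listCase {l = l} (L .sizeBound) (Z .sizeBound) (H .sizeBound)))
  where
  le : ∀ γ → size τ (listCase (z γ) (λ x xs → h ((γ , x) , xs)) (l γ))
           ≤ listCase (size τ (z γ)) (λ x xs → size τ (h ((γ , x) , xs))) (l γ)
  le γ with l γ
  ... | []    = ≤-refl
  ... | _ ∷ _ = ≤-refl

sumCaseₚ : ∀ {e : El Γ → El (ξ ⊕ σ)} {f : El (Γ ⊗ ξ) → El τ} {g : El (Γ ⊗ σ) → El τ} →
  Poly Γ (ξ ⊕ σ) e → Poly (Γ ⊗ ξ) τ f → Poly (Γ ⊗ σ) τ g →
  Poly Γ τ (λ γ → [ (λ x → f (γ , x)) , (λ y → g (γ , y)) ] (e γ))
sumCaseₚ {τ = τ} {e = e} {f} {g} E P Q = mkPoly (sumCaseC (E .comp) (P .comp) (Q .comp))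
  (pb-+ (pb-+ (pb-const 2) (E .timeBound)) (pb-+ (pb-const 2) (pb-+ (pb-const 8) (pb-+ (pb-const 6)
    (pb-+ (pb-const 2) (pb-+ (pb-const 7)
      (pb-sumCase {e = e} (E .sizeBound) (P .timeBound) (Q .timeBound))))))))
  (pb-≤ le (pb-sumCase {e = e} (E .sizeBound) (P .sizeBound) (Q .sizeBound)))
  where
  le : ∀ γ → size τ ([ (λ x → f (γ , x)) , (λ y → g (γ , y)) ] (e γ))
           ≤ [ (λ x → size τ (f (γ , x))) , (λ y → size τ (g (γ , y))) ] (e γ)
  le γ with e γ
  ... | inj₁ _ = ≤-refl
  ... | inj₂ _ = ≤-refl

-- β bounds the accumulators that actually occur.
foldₚ : ∀ {l : El Γ → List (El σ)} {z : El Γ → El τ} {h : El ((Γ ⊗ σ) ⊗ τ) → El τ} {β : El Γ → ℕ} →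
  Poly Γ (list σ) l → Poly Γ τ z → Poly ((Γ ⊗ σ) ⊗ τ) τ h → PolyBounded β →
  (∀ γ ys zs → l γ ≡ ys ++ zs → size τ (foldl (λ v x → h ((γ , x) , v)) (z γ) ys) ≤ β γ) →
  Poly Γ τ (λ γ → foldl (λ v x → h ((γ , x) , v)) (z γ) (l γ))
foldₚ {Γ} {σ} {τ} {l} {z} {h} {β} L Z H B reach = mkPoly (foldC (L .comp) (Z .comp) (H .comp))
  (pb-+ (pb-+ (pb-const 2) (L .timeBound)) (pb-+ (pb-+ (pb-const 2) (Z .timeBound))
    (pb-+ (pb-≤ iterations (pb-+ (pb-const 2) (pb-* (L .sizeBound) (pb-+ (pb-const 14) stepBound))))
          (pb-const 2))))
  (pb-≤ (λ γ → reach γ (l γ) [] (sym (++-identityʳ (l γ)))) B)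
  where
  d = H .timeBound .degree
  M : El Γ → ℕ
  M γ = (4 + (size Γ γ + (size (list σ) (l γ) + β γ))) ^ d
  stepBound : PolyBounded M
  stepBound = pb-^ (pb-+ (pb-const 4) (pb-+ pb-size (pb-+ (L .sizeBound) B))) d
  step : ∀ γ ys x zs → l γ ≡ ys ++ x ∷ zs →
         H .time ((γ , x) , foldl (λ v x → h ((γ , x) , v)) (z γ) ys) ≤ M γ
  step γ ys x zs eq = ≤-trans (H .timeBound .bounded _) (^-monoˡ-≤ d (+-monoʳ-≤ 4
    (≤-trans (≤-reflexive (+-assoc (size Γ γ) _ _)) (+-monoʳ-≤ (size Γ γ) (+-mono-≤
      (≤-trans (size-middle ys x zs) (≤-reflexive (cong (size (list σ)) (sym eq))))
      (reach γ ys (x ∷ zs) eq))))))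
  iterations : ∀ γ → loopTime (λ x v → h ((γ , x) , v)) (λ x v → H .time ((γ , x) , v)) (z γ) (l γ)
             ≤ 2 + size (list σ) (l γ) * (14 + M γ)
  iterations γ = ≤-trans (loopTime-≤ _ _ (M γ) (z γ) (l γ) (step γ))
                   (+-monoʳ-≤ 2 (*-monoˡ-≤ (14 + M γ) (length≤size (l γ))))

-- An increment that depends on the environment and the list item, but not on the accumulator,
-- cannot compound: every accumulator is at most the initial size plus the list length times a
-- polynomial.
additiveFoldₚ : ∀ {l : El Γ → List (El σ)} {z : El Γ → El τ} {h : El ((Γ ⊗ σ) ⊗ τ) → El τ} {ψ : El (Γ ⊗ σ) → ℕ} →
  Poly Γ (list σ) l → Poly Γ τ z → Poly ((Γ ⊗ σ) ⊗ τ) τ h → PolyBounded ψ →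
  (∀ γ x v → size τ (h ((γ , x) , v)) ≤ ψ (γ , x) + size τ v) →
  Poly Γ τ (λ γ → foldl (λ v x → h ((γ , x) , v)) (z γ) (l γ))
additiveFoldₚ {Γ} {σ} {τ} {l} {z} {h} {ψ} L Z H (mkPB d P) grow =
  foldₚ L Z H (pb-+ (pb-* (L .sizeBound) incBound) (Z .sizeBound))
    λ γ ys zs eq → ≤-trans (go γ ys (z γ) (λ x as bs eq′ → inc γ ys zs eq x as bs eq′))
      (+-monoˡ-≤ (size τ (z γ)) (*-monoˡ-≤ (N γ) (≤-trans (length≤size ys)
        (≤-trans (m≤m+n _ (size (list σ) zs))
          (≤-reflexive (trans (sym (size-++ ys zs)) (cong (size (list σ)) (sym eq))))))))
  where
  N : El Γ → ℕ
  N γ = (3 + (size Γ γ + size (list σ) (l γ))) ^ d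
  incBound : PolyBounded N
  incBound = pb-^ (pb-+ (pb-const 3) (pb-+ pb-size (L .sizeBound))) d
  inc : ∀ γ ys zs → l γ ≡ ys ++ zs → ∀ x as bs → ys ≡ as ++ x ∷ bs → ψ (γ , x) ≤ N γ
  inc γ ys zs eq x as bs refl = ≤-trans (P (γ , x)) (^-monoˡ-≤ d (+-monoʳ-≤ 3 (+-monoʳ-≤ (size Γ γ)
    (≤-trans (size-middle as x (bs ++ zs))
      (≤-reflexive (cong (size (list σ)) (sym (trans eq (++-assoc as (x ∷ bs) zs)))))))))
  go : ∀ γ ys v → (∀ x as bs → ys ≡ as ++ x ∷ bs → ψ (γ , x) ≤ N γ) →
       size τ (foldl (λ v x → h ((γ , x) , v)) v ys) ≤ length ys * N γ + size τ v
  go γ []       v ok = ≤-refl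
  go γ (y ∷ ys) v ok = begin
    size τ (foldl _ (h ((γ , y) , v)) ys)
      ≤⟨ go γ ys (h ((γ , y) , v)) (λ x as bs eq → ok x (y ∷ as) bs (cong (y ∷_) eq)) ⟩
    length ys * N γ + size τ (h ((γ , y) , v))
      ≤⟨ +-monoʳ-≤ (length ys * N γ) (≤-trans (grow γ y v) (+-monoˡ-≤ _ (ok y [] ys refl))) ⟩
    length ys * N γ + (N γ + size τ v)
      ≡⟨ sym (+-assoc (length ys * N γ) (N γ) _) ⟩
    length ys * N γ + N γ + size τ v
      ≡⟨ cong (_+ size τ v) (+-comm (length ys * N γ) (N γ)) ⟩
    N γ + length ys * N γ + size τ v ∎
    where open ≤-Reasoning

-- A library of polynomial-time functions

-- Different types share encodings: a list cell is a pair, a successor is a pair with nil, an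
-- injection is a pair with a tag. A program serves every type at which the trees agree.
recast : ∀ {σ τ τ′} {f : El σ → El τ} {g : El σ → El τ′} → (∀ a → enc τ (f a) ≡ enc τ′ (g a)) →
         Poly σ τ f → Poly σ τ′ g
recast f≗g P = mkPoly
  (mkComp (P .comp .code) λ a → subst (λ y → Computes _ _ y _) (f≗g a) (P .comp .correct a))
  (P .timeBound)
  (pb-≤ (λ a → ≤-reflexive (cong cells (sym (f≗g a)))) (P .sizeBound))

exprₚ : ∀ (e : Expr → Expr) {f : El σ → El τ} →
  (∀ b s a → s b ≡ enc σ a → eval (e (var b)) s ≡ enc τ (f a)) → (c : ℕ) →
  (∀ b → cost (e (var b)) ≤ c) → PolyBounded (λ a → size τ (f a)) → Poly σ τ f
exprₚ e ok c ok′ S = mkPoly (exprC e ok c ok′) (pb-const (1 + c)) S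

fstₚ : Poly (σ ⊗ τ) σ proj₁
fstₚ {σ} {τ} = exprₚ hd (λ b s a eq → cong left eq) 2 (λ _ → ≤-refl)
  (pb-≤ (λ (x , y) → ≤-trans (m≤m+n (size σ x) (size τ y)) (n≤1+n _)) pb-size)

sndₚ : Poly (σ ⊗ τ) τ proj₂
sndₚ {σ} {τ} = exprₚ tl (λ b s a eq → cong right eq) 2 (λ _ → ≤-refl)
  (pb-≤ (λ (x , y) → ≤-trans (m≤n+m (size τ y) (size σ x)) (n≤1+n _)) pb-size)

literal : Tree → Expr
literal nil     = nil
literal (l ∙ r) = cons (literal l) (literal r)

eval-literal : ∀ t s → eval (literal t) s ≡ t
eval-literal nil     s = refl
eval-literal (l ∙ r) s = cong₂ _∙_ (eval-literal l s) (eval-literal r s)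

constₚ : (a : El τ) → Poly σ τ (λ _ → a)
constₚ {τ} a = exprₚ (λ _ → literal (enc τ a)) (λ b s _ _ → eval-literal (enc τ a) s)
  (cost (literal (enc τ a))) (λ _ → ≤-refl) (pb-const (size τ a))

infixr 5 _∷ₚ_

_∷ₚ_ : ∀ {f : El Γ → El σ} {l : El Γ → List (El σ)} → Poly Γ σ f → Poly Γ (list σ) l →
       Poly Γ (list σ) (λ γ → f γ ∷ l γ)
P ∷ₚ L = recast (λ _ → refl) (P ,ₚ L)

sucₚ : ∀ {f : El Γ → ℕ} → Poly Γ nat f → Poly Γ nat (λ γ → suc (f γ))
sucₚ P = recast (λ _ → refl) (constₚ {τ = nat} 0 ,ₚ P)

inj₁ₚ : ∀ {f : El Γ → El σ} → Poly Γ σ f → Poly Γ (σ ⊕ τ) (λ γ → inj₁ (f γ))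
inj₁ₚ P = recast (λ _ → refl) (constₚ {τ = nat} 0 ,ₚ P)

inj₂ₚ : ∀ {f : El Γ → El τ} → Poly Γ τ f → Poly Γ (σ ⊕ τ) (λ γ → inj₂ (f γ))
inj₂ₚ P = recast (λ _ → refl) (constₚ {τ = bool} true ,ₚ P)

-- A unary number is also the list of that many zeros.
unary : ℕ → List ℕ
unary n = replicate n 0

encodeℕ-unary : ∀ n → enc nat n ≡ enc (list nat) (unary n)
encodeℕ-unary zero    = refl
encodeℕ-unary (suc n) = cong (nil ∙_) (encodeℕ-unary n)

unaryₚ : ∀ {f : El Γ → ℕ} → Poly Γ nat f → Poly Γ (list nat) (λ γ → unary (f γ))
unaryₚ {f = f} = recast (λ γ → encodeℕ-unary (f γ))

size-nat : ∀ n → size nat n ≡ n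
size-nat zero    = refl
size-nat (suc n) = cong suc (size-nat n)

reverseₚ : ∀ {l : El Γ → List (El σ)} → Poly Γ (list σ) l → Poly Γ (list σ) (λ γ → reverse (l γ))
reverseₚ L = additiveFoldₚ {ψ = λ (γ , x) → suc (size _ x)} L (constₚ []) ((fstₚ ▸ sndₚ) ∷ₚ sndₚ)
  (pb-+ (pb-const 1) (sndₚ .sizeBound)) (λ γ x v → ≤-refl)

foldrₚ : ∀ {l : El Γ → List (El σ)} {z : El Γ → El τ} {h : El ((Γ ⊗ σ) ⊗ τ) → El τ} (ψ : El (Γ ⊗ σ) → ℕ) →
  Poly Γ (list σ) l → Poly Γ τ z → Poly ((Γ ⊗ σ) ⊗ τ) τ h → PolyBounded ψ →
  (∀ γ x v → size τ (h ((γ , x) , v)) ≤ ψ (γ , x) + size τ v) →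
  Poly Γ τ (λ γ → foldr (λ x v → h ((γ , x) , v)) (z γ) (l γ))
foldrₚ {l = l} {z} {h} ψ L Z H B grow =
  ext (λ γ → reverse-foldl (λ v x → h ((γ , x) , v)) (z γ) (l γ))
      (additiveFoldₚ (reverseₚ L) Z H B grow)

mapₚ : ∀ {l : El Γ → List (El σ)} {f : El (Γ ⊗ σ) → El τ} → Poly Γ (list σ) l → Poly (Γ ⊗ σ) τ f →
  Poly Γ (list τ) (λ γ → map (λ x → f (γ , x)) (l γ))
mapₚ {τ = τ} {l = l} {f} L F =
  ext (λ γ → foldr-map γ (l γ))
    (foldrₚ (λ p → suc (size τ (f p))) L (constₚ []) ((fstₚ ▸ F) ∷ₚ sndₚ)
      (pb-+ (pb-const 1) (F .sizeBound)) (λ γ x v → ≤-refl))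
  where
  foldr-map : ∀ γ xs → foldr (λ x v → f (γ , x) ∷ v) [] xs ≡ map (λ x → f (γ , x)) xs
  foldr-map γ []       = refl
  foldr-map γ (x ∷ xs) = cong (f (γ , x) ∷_) (foldr-map γ xs)

infixr 5 _++ₚ_

_++ₚ_ : ∀ {l m : El Γ → List (El σ)} → Poly Γ (list σ) l → Poly Γ (list σ) m →
        Poly Γ (list σ) (λ γ → l γ ++ m γ)
_++ₚ_ {Γ} {σ} {l} {m} L M =
  ext (λ γ → foldr-++ (m γ) (l γ))
    (foldrₚ (λ p → suc (size σ (proj₂ p))) L M ((fstₚ ▸ sndₚ) ∷ₚ sndₚ)
      (pb-+ (pb-const 1) (sndₚ .sizeBound)) (λ γ x v → ≤-refl))
  where
  foldr-++ : ∀ (ys xs : List (El σ)) → foldr _∷_ ys xs ≡ xs ++ ys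
  foldr-++ ys []       = refl
  foldr-++ ys (x ∷ xs) = cong (x ∷_) (foldr-++ ys xs)

concatMapₚ : ∀ {l : El Γ → List (El σ)} {f : El (Γ ⊗ σ) → List (El τ)} →
  Poly Γ (list σ) l → Poly (Γ ⊗ σ) (list τ) f →
  Poly Γ (list τ) (λ γ → concatMap (λ x → f (γ , x)) (l γ))
concatMapₚ {τ = τ} {l = l} {f} L F =
  ext (λ γ → foldr-concat γ (l γ))
    (foldrₚ (λ p → size (list τ) (f p)) L (constₚ []) ((fstₚ ▸ F) ++ₚ sndₚ) (F .sizeBound)
      (λ γ x v → ≤-reflexive (size-++ (f (γ , x)) v)))
  where
  foldr-concat : ∀ γ xs → foldr (λ x v → f (γ , x) ++ v) [] xs ≡ concatMap (λ x → f (γ , x)) xs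
  foldr-concat γ []       = refl
  foldr-concat γ (x ∷ xs) = cong (f (γ , x) ++_) (foldr-concat γ xs)

filterₚ : ∀ {l : El Γ → List (El σ)} {c : El (Γ ⊗ σ) → Bool} → Poly Γ (list σ) l → Poly (Γ ⊗ σ) bool c →
  Poly Γ (list σ) (λ γ → filterᵇ (λ x → c (γ , x)) (l γ))
filterₚ {σ = σ} {l = l} {c} L C =
  ext (λ γ → foldr-filter γ (l γ))
    (foldrₚ (λ p → suc (size σ (proj₂ p))) L (constₚ []) (whenₚ (fstₚ ▸ C) ((fstₚ ▸ sndₚ) ∷ₚ sndₚ) sndₚ)
      (pb-+ (pb-const 1) (sndₚ .sizeBound)) grow)
  where
  grow : ∀ γ x v → size (list σ) (when c (γ , x) then x ∷ v else v) ≤ suc (size σ x) + size (list σ) v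
  grow γ x v with c (γ , x)
  ... | true  = ≤-refl
  ... | false = m≤n+m _ (suc (size σ x))
  foldr-filter : ∀ γ xs → foldr (λ x v → when c (γ , x) then x ∷ v else v) [] xs ≡ filterᵇ (λ x → c (γ , x)) xs
  foldr-filter γ []       = refl
  foldr-filter γ (x ∷ xs) with c (γ , x)
  ... | true  = cong (x ∷_) (foldr-filter γ xs)
  ... | false = foldr-filter γ xs

notₚ : ∀ {f : El Γ → Bool} → Poly Γ bool f → Poly Γ bool (λ γ → not (f γ))
notₚ {f = f} P = ext (λ γ → lemma (f γ)) (whenₚ P (constₚ false) (constₚ true))
  where
  lemma : ∀ b → (when b then false else true) ≡ not b
  lemma true  = refl
  lemma false = refl

_∧ₚ_ _∨ₚ_ : ∀ {f g : El Γ → Bool} → Poly Γ bool f → Poly Γ bool g → _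
_∧ₚ_ {Γ} {f} {g} P Q = ext {g = λ γ → f γ ∧ g γ} (λ γ → lemma (f γ) (g γ)) (whenₚ P Q (constₚ false))
  where
  lemma : ∀ b c → (when b then c else false) ≡ b ∧ c
  lemma true  c = refl
  lemma false c = refl
_∨ₚ_ {Γ} {f} {g} P Q = ext {g = λ γ → f γ ∨ g γ} (λ γ → lemma (f γ) (g γ)) (whenₚ P (constₚ true) Q)
  where
  lemma : ∀ b c → (when b then true else c) ≡ b ∨ c
  lemma true  c = refl
  lemma false c = refl

infixr 6 _∧ₚ_
infixr 5 _∨ₚ_

size-bool : ∀ b → size bool b ≤ 1
size-bool true  = ≤-refl
size-bool false = z≤n

anyₚ : ∀ {l : El Γ → List (El σ)} {c : El (Γ ⊗ σ) → Bool} → Poly Γ (list σ) l → Poly (Γ ⊗ σ) bool c →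
  Poly Γ bool (λ γ → any (λ x → c (γ , x)) (l γ))
anyₚ L C = foldrₚ (λ _ → 1) (mapₚ L C) (constₚ false) ((fstₚ ▸ sndₚ) ∨ₚ sndₚ) (pb-const 1)
  (λ γ x v → ≤-trans (size-bool (x ∨ v)) (m≤m+n 1 _))

allₚ : ∀ {l : El Γ → List (El σ)} {c : El (Γ ⊗ σ) → Bool} → Poly Γ (list σ) l → Poly (Γ ⊗ σ) bool c →
  Poly Γ bool (λ γ → all (λ x → c (γ , x)) (l γ))
allₚ L C = foldrₚ (λ _ → 1) (mapₚ L C) (constₚ true) ((fstₚ ▸ sndₚ) ∧ₚ sndₚ) (pb-const 1)
  (λ γ x v → ≤-trans (size-bool (x ∧ v)) (m≤m+n 1 _))

nullₚ : ∀ {l : El Γ → List (El σ)} → Poly Γ (list σ) l → Poly Γ bool (λ γ → null (l γ))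
nullₚ {l = l} L = ext (λ γ → lemma (l γ)) (listCaseₚ L (constₚ true) (constₚ false))
  where
  lemma : ∀ xs → listCase true (λ _ _ → false) xs ≡ null xs
  lemma []      = refl
  lemma (_ ∷ _) = refl

isZero : ℕ → Bool
isZero zero    = true
isZero (suc _) = false

isZeroₚ : ∀ {f : El Γ → ℕ} → Poly Γ nat f → Poly Γ bool (λ γ → isZero (f γ))
isZeroₚ {f = f} P = ext (λ γ → lemma (f γ)) (nullₚ (unaryₚ P))
  where
  lemma : ∀ n → null (unary n) ≡ isZero n
  lemma zero    = refl
  lemma (suc _) = refl

predₚ : Poly nat nat pred
predₚ = exprₚ tl (λ { b s zero eq → cong right eq ; b s (suc a) eq → cong right eq }) 2 (λ _ → ≤-refl)
  (pb-≤ (λ { zero → z≤n ; (suc a) → n≤1+n _ }) pb-size)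

tail : {A : Set} → List A → List A
tail = drop 1

size-tail : ∀ (xs : List (El σ)) → size (list σ) (tail xs) ≤ size (list σ) xs
size-tail []       = z≤n
size-tail {σ} (x ∷ xs) = ≤-trans (m≤n+m _ (size σ x)) (n≤1+n _)

tailₚ : Poly (list σ) (list σ) tail
tailₚ = exprₚ tl (λ { b s [] eq → cong right eq ; b s (_ ∷ _) eq → cong right eq }) 2 (λ _ → ≤-refl)
  (pb-≤ size-tail pb-size)

_∸ₚ_ _+ₚ_ : ∀ {f g : El Γ → ℕ} → Poly Γ nat f → Poly Γ nat g → _
_∸ₚ_ {Γ} {f} {g} P Q = ext {g = λ γ → f γ ∸ g γ} (λ γ → lemma (f γ) (g γ))
  (additiveFoldₚ {ψ = λ _ → 0} (unaryₚ Q) P (sndₚ ▸ predₚ) (pb-const 0) (λ γ x v → size-pred v))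
  where
  size-pred : ∀ v → size nat (pred v) ≤ size nat v
  size-pred zero    = z≤n
  size-pred (suc v) = n≤1+n _
  lemma : ∀ m n → foldl (λ v _ → pred v) m (unary n) ≡ m ∸ n
  lemma m zero          = refl
  lemma zero (suc n)    = trans (lemma zero n) (0∸n≡0 n)
  lemma (suc m) (suc n) = lemma m n
_+ₚ_ {Γ} {f} {g} P Q = ext {g = λ γ → f γ + g γ} (λ γ → lemma (f γ) (g γ))
  (additiveFoldₚ {ψ = λ _ → 1} (unaryₚ Q) P (sucₚ sndₚ) (pb-const 1) (λ γ x v → ≤-refl))
  where
  lemma : ∀ m n → foldl (λ v _ → suc v) m (unary n) ≡ m + n
  lemma m zero    = sym (+-identityʳ m)
  lemma m (suc n) = trans (lemma (suc m) n) (sym (+-suc m n))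

infixl 6 _+ₚ_ _∸ₚ_

timesₚ : ∀ c {f : El Γ → ℕ} → Poly Γ nat f → Poly Γ nat (λ γ → c * f γ)
timesₚ zero    P = constₚ 0
timesₚ (suc c) P = P +ₚ timesₚ c P

dropₚ : ∀ {f : El Γ → ℕ} {l : El Γ → List (El σ)} → Poly Γ nat f → Poly Γ (list σ) l →
        Poly Γ (list σ) (λ γ → drop (f γ) (l γ))
dropₚ {σ = σ} {f} {l} P L = ext (λ γ → lemma (f γ) (l γ))
  (additiveFoldₚ {ψ = λ _ → 0} (unaryₚ P) L (sndₚ ▸ tailₚ) (pb-const 0) (λ γ x v → size-tail v))
  where
  lemma : ∀ n (xs : List (El σ)) → foldl (λ v _ → tail v) xs (unary n) ≡ drop n xs
  lemma zero    xs       = refl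
  lemma (suc n) []       = trans (lemma n []) (drop-[] n)
    where
    drop-[] : ∀ n → drop {A = El σ} n [] ≡ []
    drop-[] zero    = refl
    drop-[] (suc n) = refl
  lemma (suc n) (x ∷ xs) = lemma n xs

-- Each step duplicates the head of the accumulator, so its growth is not controlled by the list
-- item. Instead the accumulators are identified as `downFrom` lists, whose size is at most
-- quadratic.
downFromₚ : ∀ {f : El Γ → ℕ} → Poly Γ nat f → Poly Γ (list nat) (λ γ → downFrom (f γ))
downFromₚ {f = f} P = ext (λ γ → trans (lemma [] (unary (f γ)) 0 refl)
    (cong downFrom (trans (+-identityʳ _) (length-replicate (f γ)))))
  (foldₚ {β = λ γ → suc (f γ) * suc (f γ)} (unaryₚ P) (constₚ [])
    (listCaseₚ sndₚ (constₚ (0 ∷ [])) (sucₚ (fstₚ ▸ sndₚ) ∷ₚ (fstₚ ▸ sndₚ) ∷ₚ sndₚ))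
    (pb-≤ (λ γ → ≤-reflexive (cong (λ n → suc n * suc n) (sym (size-nat (f γ)))))
      (pb-* (pb-+ (pb-const 1) (P .sizeBound)) (pb-+ (pb-const 1) (P .sizeBound))))
    reach)
  where
  step : List ℕ → ℕ → List ℕ
  step v _ = listCase (0 ∷ []) (λ x xs → suc x ∷ x ∷ xs) v
  step-downFrom : ∀ n x → step (downFrom n) x ≡ downFrom (suc n)
  step-downFrom zero    x = refl
  step-downFrom (suc n) x = refl
  lemma : ∀ v xs n → v ≡ downFrom n → foldl step v xs ≡ downFrom (length xs + n)
  lemma v []       n refl = refl
  lemma v (x ∷ xs) n refl = trans (lemma _ xs (suc n) (step-downFrom n x))
                                  (cong downFrom (+-suc (length xs) n))
  size-downFrom : ∀ n → size (list nat) (downFrom n) ≤ suc n * suc n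
  size-downFrom zero    = z≤n
  size-downFrom (suc n) = s≤s (+-mono-≤ (≤-trans (≤-reflexive (size-nat n)) (m≤n+m n 1))
    (≤-trans (size-downFrom n) (*-monoʳ-≤ (suc n) (n≤1+n (suc n)))))
  reach : ∀ γ ys zs → unary (f γ) ≡ ys ++ zs → size (list nat) (foldl step [] ys) ≤ suc (f γ) * suc (f γ)
  reach γ ys zs eq = ≤-trans (≤-reflexive (cong (size (list nat)) (lemma [] ys 0 refl)))
    (≤-trans (size-downFrom (length ys + 0)) (*-mono-≤ le le))
    where
    le : suc (length ys + 0) ≤ suc (f γ)
    le = s≤s (≤-trans (≤-reflexive (+-identityʳ _)) (≤-trans (m≤m+n (length ys) (length zs))
      (≤-reflexive (trans (sym (length-++ ys)) (trans (cong length (sym eq)) (length-replicate (f γ)))))))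

tuples : {A : Set} → ℕ → List A → List (List A)
tuples zero    xs = [] ∷ []
tuples (suc c) xs = concatMap (λ x → map (x ∷_) (tuples c xs)) xs

-- `c` is fixed outside the program and unrolled into `c` nested loops, so the degree of the
-- polynomial depends on it.
tuplesₚ : ∀ c {l : El Γ → List (El σ)} → Poly Γ (list σ) l → Poly Γ (list (list σ)) (λ γ → tuples c (l γ))
tuplesₚ zero    L = constₚ ([] ∷ [])
tuplesₚ (suc c) L = concatMapₚ L (mapₚ (fstₚ ▸ tuplesₚ c L) ((fstₚ ▸ sndₚ) ∷ₚ sndₚ))

eqb : ∀ τ → El τ → El τ → Bool
eqb nat m n = isZero (m ∸ n) ∧ isZero (n ∸ m)
eqb bool true  b = b
eqb bool false b = not b
eqb (list τ) []       []       = true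
eqb (list τ) []       (_ ∷ _)  = false
eqb (list τ) (_ ∷ _)  []       = false
eqb (list τ) (x ∷ xs) (y ∷ ys) = eqb τ x y ∧ eqb (list τ) xs ys
eqb (σ ⊗ τ) (x , y) (x′ , y′) = eqb σ x x′ ∧ eqb τ y y′
eqb (σ ⊕ τ) (inj₁ x) (inj₁ y) = eqb σ x y
eqb (σ ⊕ τ) (inj₁ x) (inj₂ y) = false
eqb (σ ⊕ τ) (inj₂ x) (inj₁ y) = false
eqb (σ ⊕ τ) (inj₂ x) (inj₂ y) = eqb τ x y

-- A fold reads one list only, so the list case folds over the first list and keeps the unread part
-- of the second in the accumulator.
eqₚ : ∀ τ {f g : El Γ → El τ} → Poly Γ τ f → Poly Γ τ g → Poly Γ bool (λ γ → eqb τ (f γ) (g γ))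
eqₚ nat P Q = isZeroₚ (P ∸ₚ Q) ∧ₚ isZeroₚ (Q ∸ₚ P)
eqₚ bool {f} {g} P Q = ext (λ γ → lemma (f γ) (g γ)) (whenₚ P Q (notₚ Q))
  where
  lemma : ∀ b c → (when b then c else not c) ≡ eqb bool b c
  lemma true  c = refl
  lemma false c = refl
eqₚ (σ ⊗ τ) {f} {g} P Q = eqₚ σ (P ▸ fstₚ) (Q ▸ fstₚ) ∧ₚ eqₚ τ (P ▸ sndₚ) (Q ▸ sndₚ)
eqₚ (σ ⊕ τ) {f} {g} P Q = ext (λ γ → lemma (f γ) (g γ))
  (sumCaseₚ P (sumCaseₚ (fstₚ ▸ Q) (eqₚ σ (fstₚ ▸ sndₚ) sndₚ) (constₚ false))
              (sumCaseₚ (fstₚ ▸ Q) (constₚ false) (eqₚ τ (fstₚ ▸ sndₚ) sndₚ)))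
  where
  lemma : ∀ a b → [ (λ x → [ (λ y → eqb σ x y) , (λ _ → false) ] b) ,
                    (λ x → [ (λ _ → false) , (λ y → eqb τ x y) ] b) ] a ≡ eqb (σ ⊕ τ) a b
  lemma (inj₁ _) (inj₁ _) = refl
  lemma (inj₁ _) (inj₂ _) = refl
  lemma (inj₂ _) (inj₁ _) = refl
  lemma (inj₂ _) (inj₂ _) = refl
eqₚ {Γ} (list τ) {f} {g} P Q = ext (λ γ → lemma (f γ) (g γ)) (scan ▸ (sndₚ ∧ₚ nullₚ fstₚ))
  where
  step : List (El τ) × Bool → El τ → List (El τ) × Bool
  -- If the second list runs out first, or a comparison fails, the flag is false for good; if the
  -- second list is too long, the final `null` test detects it.
  step (ys , ok) x = listCase ([] , false) (λ y ys → ys , eqb τ x y ∧ ok) ys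
  scan : Poly Γ (list τ ⊗ bool) (λ γ → foldl step (g γ , true) (f γ))
  scan = additiveFoldₚ {ψ = λ _ → 1} P (Q ,ₚ constₚ true)
    (listCaseₚ (sndₚ ▸ fstₚ) (constₚ ([] , false))
      (sndₚ ,ₚ (eqₚ τ (fstₚ ▸ fstₚ ▸ fstₚ ▸ sndₚ) (fstₚ ▸ sndₚ) ∧ₚ (fstₚ ▸ fstₚ ▸ sndₚ ▸ sndₚ))))
    (pb-const 1) (λ γ x v → grow x v)
    where
    grow : ∀ x v → size (list τ ⊗ bool) (step v x) ≤ 1 + size (list τ ⊗ bool) v
    grow x ([] , ok)     = s≤s z≤n
    grow x (y ∷ ys , ok) = s≤s (≤-trans (+-monoʳ-≤ (size (list τ) ys) (size-bool (eqb τ x y ∧ ok)))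
      (≤-trans (≤-reflexive (+-comm _ 1)) (s≤s (≤-trans (m≤n+m _ (size τ y))
        (≤-trans (m≤m+n _ (size bool ok)) (n≤1+n _))))))
  result : List (El τ) × Bool → Bool
  result (ys , ok) = ok ∧ null ys
  lemma-false : ∀ xs ys → result (foldl step (ys , false) xs) ≡ false
  lemma-false []       ys       = refl
  lemma-false (x ∷ xs) []       = lemma-false xs []
  lemma-false (x ∷ xs) (y ∷ ys) with eqb τ x y
  ... | true  = lemma-false xs ys
  ... | false = lemma-false xs ys
  lemma : ∀ xs ys → result (foldl step (ys , true) xs) ≡ eqb (list τ) xs ys
  lemma []       []       = refl
  lemma []       (_ ∷ _)  = refl
  lemma (x ∷ xs) []       = lemma-false xs []
  lemma (x ∷ xs) (y ∷ ys) with eqb τ x y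
  ... | true  = lemma xs ys
  ... | false = lemma-false xs ys

nub : ∀ τ → List (El τ) → List (El τ)
nub τ = foldr (λ x v → when any (eqb τ x) v then v else x ∷ v) []

nubₚ : ∀ {l : El Γ → List (El σ)} → Poly Γ (list σ) l → Poly Γ (list σ) (λ γ → nub σ (l γ))
nubₚ {σ = σ} L = foldrₚ (λ p → suc (size σ (proj₂ p))) L (constₚ [])
    (whenₚ (anyₚ sndₚ (eqₚ σ (fstₚ ▸ fstₚ ▸ sndₚ) sndₚ)) sndₚ ((fstₚ ▸ sndₚ) ∷ₚ sndₚ))
    (pb-+ (pb-const 1) (sndₚ .sizeBound)) (λ γ x v → grow x v)
  where
  grow : ∀ x v → size (list σ) (when any (eqb σ x) v then v else x ∷ v) ≤ suc (size σ x) + size (list σ) v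
  grow x v with any (eqb σ x) v
  ... | true  = m≤n+m _ (suc (size σ x))
  ... | false = ≤-refl

-- The hypergraph of a set cover instance

setTy slotTy connectorTy labelTy instanceTy : Ty
setTy       = list bool
slotTy      = nat ⊗ nat ⊗ setTy
connectorTy = nat ⊗ list slotTy ⊗ list slotTy
labelTy     = nat ⊕ connectorTy
instanceTy  = nat ⊗ list setTy ⊗ nat

-- A slot (u , i , A) assigns the element u to A, the i-th set of the cover. The
-- level of a connector only serves to orient the links between connectors.
Slot Connector Label : Set
Slot      = El slotTy
Connector = El connectorTy
Label     = El labelTy

element index : Slot → ℕ
element (u , _ , _) = u
index   (_ , i , _) = i

slotSet : Slot → List Bool
slotSet (_ , _ , A) = A

level : Connector → ℕ
level (j , _ , _) = j

before after : Connector → List Slot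
before (_ , x , _) = x
after  (_ , _ , y) = y

elementₚ : ∀ {f : El Γ → Slot} → Poly Γ slotTy f → Poly Γ nat (λ γ → element (f γ))
elementₚ P = P ▸ fstₚ

indexₚ : ∀ {f : El Γ → Slot} → Poly Γ slotTy f → Poly Γ nat (λ γ → index (f γ))
indexₚ P = P ▸ sndₚ ▸ fstₚ

slotSetₚ : ∀ {f : El Γ → Slot} → Poly Γ slotTy f → Poly Γ setTy (λ γ → slotSet (f γ))
slotSetₚ P = P ▸ sndₚ ▸ sndₚ

levelₚ : ∀ {f : El Γ → Connector} → Poly Γ connectorTy f → Poly Γ nat (λ γ → level (f γ))
levelₚ P = P ▸ fstₚ

beforeₚ : ∀ {f : El Γ → Connector} → Poly Γ connectorTy f → Poly Γ (list slotTy) (λ γ → before (f γ))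
beforeₚ P = P ▸ sndₚ ▸ fstₚ

afterₚ : ∀ {f : El Γ → Connector} → Poly Γ connectorTy f → Poly Γ (list slotTy) (λ γ → after (f γ))
afterₚ P = P ▸ sndₚ ▸ sndₚ

-- Elements beyond the ground set are padding, contained in every set.
member : List Bool → ℕ → Bool
member A u = listCase true (λ b _ → b) (drop u A)

memberₚ : ∀ {f : El Γ → List Bool} {g : El Γ → ℕ} → Poly Γ setTy f → Poly Γ nat g →
          Poly Γ bool (λ γ → member (f γ) (g γ))
memberₚ P Q = listCaseₚ (dropₚ Q P) (constₚ true) (fstₚ ▸ sndₚ)

-- One step of division by repeated subtraction; the first component is what remains to be divided
-- into blocks.
blockStep : ℕ → ℕ × ℕ → ℕ × ℕ
blockStep s (rest , q) = when isZero rest then (rest , q) else (rest ∸ s , suc q)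

-- ⌈ n / s ⌉ + 3
blocks : ℕ → ℕ → ℕ
blocks s n = proj₂ (foldl (λ v _ → blockStep s v) (n , 3) (unary n))

blocksₚ : ∀ s {f : El Γ → ℕ} → Poly Γ nat f → Poly Γ nat (λ γ → blocks s (f γ))
blocksₚ s P = additiveFoldₚ {ψ = λ _ → 1} (unaryₚ P) (P ,ₚ constₚ 3)
    (whenₚ (isZeroₚ (sndₚ ▸ fstₚ)) sndₚ (((sndₚ ▸ fstₚ) ∸ₚ constₚ s) ,ₚ sucₚ (sndₚ ▸ sndₚ)))
    (pb-const 1) (λ γ x v → grow v) ▸ sndₚ
  where
  grow : ∀ v → size (nat ⊗ nat) (blockStep s v) ≤ 1 + size (nat ⊗ nat) v
  grow (zero  , q) = n≤1+n _
  grow (suc m , q) = s≤s (≤-trans (+-monoˡ-≤ _ (≤-trans (≤-reflexive (size-nat (suc m ∸ s)))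
      (≤-trans (m∸n≤m (suc m) s) (≤-reflexive (sym (size-nat (suc m)))))))
    (≤-reflexive (+-suc (size nat (suc m)) (size nat q))))

-- The size of the padded ground set, a multiple of `s`; only the elements of the tail block lie
-- beyond it.
realElements : ℕ → El instanceTy → ℕ
realElements s (n , _ , _) = s * blocks s n

realElementsₚ : ∀ s → Poly instanceTy nat (realElements s)
realElementsₚ s = timesₚ s (blocksₚ s fstₚ)

slots : ℕ → El instanceTy → List Slot
slots s I@(n , G , t) = concatMap (λ u → concatMap (λ i → map (λ A → u , i , A) (filterᵇ (λ A → member A u) G))
  (downFrom t)) (downFrom (realElements s I))

slotsₚ : ∀ s → Poly instanceTy (list slotTy) (slots s)
slotsₚ s = concatMapₚ (downFromₚ (realElementsₚ s)) (concatMapₚ (downFromₚ (fstₚ ▸ sndₚ ▸ sndₚ))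
  (mapₚ (filterₚ (fstₚ ▸ fstₚ ▸ sndₚ ▸ fstₚ) (memberₚ sndₚ (fstₚ ▸ fstₚ ▸ sndₚ)))
    ((fstₚ ▸ fstₚ ▸ sndₚ) ,ₚ (fstₚ ▸ sndₚ) ,ₚ sndₚ)))

_≼ᵇ_ : Slot → Slot → Bool
a ≼ᵇ b = not (isZero (index b ∸ index a)) ∨ (eqb nat (index a) (index b) ∧ eqb setTy (slotSet a) (slotSet b))

≼ₚ : ∀ {f g : El Γ → Slot} → Poly Γ slotTy f → Poly Γ slotTy g → Poly Γ bool (λ γ → f γ ≼ᵇ g γ)
≼ₚ P Q = notₚ (isZeroₚ (indexₚ Q ∸ₚ indexₚ P)) ∨ₚ
         (eqₚ nat (indexₚ P) (indexₚ Q) ∧ₚ eqₚ setTy (slotSetₚ P) (slotSetₚ Q))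

-- Order is demanded only between adjacent blocks and inside one block; transitivity of `_≼_`
-- supplies the remaining pairs.
linked : Connector → Connector → Bool
linked p q = eqb nat (level q) (suc (level p))
           ∧ eqb (list slotTy) (after p) (before q)
           ∧ all (λ a → all (λ b → a ≼ᵇ b) (before q)) (before p)
           ∧ all (λ a → all (λ b → (a ≼ᵇ b) ∨ (b ≼ᵇ a)) (before q)) (before q)

linkedₚ : ∀ {f g : El Γ → Connector} → Poly Γ connectorTy f → Poly Γ connectorTy g →
          Poly Γ bool (λ γ → linked (f γ) (g γ))
linkedₚ P Q = eqₚ nat (levelₚ Q) (sucₚ (levelₚ P))
           ∧ₚ eqₚ (list slotTy) (afterₚ P) (beforeₚ Q)
           ∧ₚ allₚ (beforeₚ P) (allₚ (fstₚ ▸ beforeₚ Q) (≼ₚ (fstₚ ▸ sndₚ) sndₚ))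
           ∧ₚ allₚ (beforeₚ Q) (allₚ (fstₚ ▸ beforeₚ Q) (≼ₚ (fstₚ ▸ sndₚ) sndₚ ∨ₚ ≼ₚ sndₚ (fstₚ ▸ sndₚ)))

opaque

  slotBlocks : ℕ → El instanceTy → List (List Slot)
  slotBlocks s I = tuples s (slots s I)

  slotBlocksₚ : ∀ s → Poly instanceTy (list (list slotTy)) (slotBlocks s)
  slotBlocksₚ s = tuplesₚ s (slotsₚ s)

-- Fills the `s` positions after the last connector. Its elements lie beyond the padded ground set
-- and are allowed only in `after`, so they cannot take the place of an element that must be
-- covered.
tailBlock : ℕ → El instanceTy → List Slot
tailBlock s I = map (λ d → realElements s I + d , 0 , []) (upTo s)

tailBlockₚ : ∀ s → Poly instanceTy (list slotTy) (tailBlock s)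
tailBlockₚ s = mapₚ (constₚ (upTo s)) (((fstₚ ▸ realElementsₚ s) +ₚ sndₚ) ,ₚ constₚ 0 ,ₚ constₚ [])

opaque

  connectors : ℕ → El instanceTy → List Connector
  connectors s I = concatMap (λ j → concatMap (λ x → map (λ y → j , x , y)
    (tailBlock s I ∷ slotBlocks s I)) (slotBlocks s I)) (downFrom (suc (blocks s (proj₁ I))))

  connectorsₚ : ∀ s → Poly instanceTy (list connectorTy) (connectors s)
  connectorsₚ s = concatMapₚ (downFromₚ (sucₚ (blocksₚ s fstₚ))) (concatMapₚ (fstₚ ▸ slotBlocksₚ s)
    (mapₚ (fstₚ ▸ fstₚ ▸ (tailBlockₚ s ∷ₚ slotBlocksₚ s)) ((fstₚ ▸ fstₚ ▸ sndₚ) ,ₚ (fstₚ ▸ sndₚ) ,ₚ sndₚ)))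

allLabels : ℕ → El instanceTy → List Label
allLabels s I = map inj₁ (downFrom (realElements s I + s)) ++ map inj₂ (connectors s I)
opaque

  labels : ℕ → El instanceTy → List Label
  labels s I = nub labelTy (allLabels s I)

  labelsₚ : ∀ s → Poly instanceTy (list labelTy) (labels s)
  labelsₚ s = nubₚ (mapₚ (downFromₚ (realElementsₚ s +ₚ constₚ s)) (inj₁ₚ sndₚ) ++ₚ
                    mapₚ (connectorsₚ s) (inj₂ₚ sndₚ))

elementLabels : List Slot → List Label
elementLabels = map (λ a → inj₁ (element a))

elementLabelsₚ : ∀ {l : El Γ → List Slot} → Poly Γ (list slotTy) l →
                 Poly Γ (list labelTy) (λ γ → elementLabels (l γ))
elementLabelsₚ L = mapₚ L (inj₁ₚ (elementₚ sndₚ))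

linkEdge : Connector → Connector → List Label
linkEdge p q = inj₂ p ∷ inj₂ q ∷ elementLabels (after p)

starEdge : Connector → List Slot → List Label
starEdge p as = inj₂ p ∷ elementLabels as

linkEdges starEdges : ℕ → El instanceTy → List (List Label)
linkEdges s I = concatMap (λ p → map (λ q → linkEdge p q)
  (filterᵇ (λ q → linked p q) (connectors s I))) (connectors s I)
starEdges s I = concatMap (λ p → map (λ as → starEdge p as)
  (tuples (suc s) (before p ++ after p))) (connectors s I)

candidates : ℕ → El instanceTy → List (List Label)
candidates s I = linkEdges s I ++ starEdges s I

candidatesₚ : ∀ s → Poly instanceTy (list (list labelTy)) (candidates s)
candidatesₚ s =
  concatMapₚ (connectorsₚ s) (mapₚ (filterₚ (fstₚ ▸ connectorsₚ s) (linkedₚ (fstₚ ▸ sndₚ) sndₚ))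
    (inj₂ₚ (fstₚ ▸ sndₚ) ∷ₚ inj₂ₚ sndₚ ∷ₚ elementLabelsₚ (afterₚ (fstₚ ▸ sndₚ)))) ++ₚ
  concatMapₚ (connectorsₚ s) (mapₚ (tuplesₚ (suc s) (beforeₚ sndₚ ++ₚ afterₚ sndₚ))
    (inj₂ₚ (fstₚ ▸ sndₚ) ∷ₚ elementLabelsₚ sndₚ))

bits : List Label → List Label → List Bool
bits V L = map (λ v → any (λ w → eqb labelTy v w) L) V

weight : List Bool → ℕ
weight bs = length (filterᵇ (λ b → b) bs)

lengthₚ : ∀ {l : El Γ → List (El σ)} → Poly Γ (list σ) l → Poly Γ nat (λ γ → length (l γ))
lengthₚ L = foldrₚ (λ _ → 1) L (constₚ 0) (sucₚ sndₚ) (pb-const 1) (λ γ x v → ≤-refl)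

-- Slot blocks and `tuples` may repeat an element, and such a candidate has too few distinct labels
-- to be a hyperedge; the weight test discards it.
uniformBits : ℕ → El instanceTy → List (List Bool)
uniformBits s I = filterᵇ (λ bs → eqb nat (weight bs) (2 + s))
  (map (λ L → bits (labels s I) L) (candidates s I))

opaque

  hyperedges : ℕ → El instanceTy → List (List Bool)
  hyperedges s I = nub setTy (uniformBits s I)

  hyperedgesₚ : ∀ s → Poly instanceTy (list setTy) (hyperedges s)
  hyperedgesₚ s = nubₚ (filterₚ
    (mapₚ (candidatesₚ s) (mapₚ (fstₚ ▸ labelsₚ s) (anyₚ (fstₚ ▸ sndₚ) (eqₚ labelTy (fstₚ ▸ sndₚ) sndₚ))))
    (eqₚ nat (lengthₚ (filterₚ sndₚ sndₚ)) (constₚ (2 + s))))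

-- One connector more than there are blocks, each followed by `s` elements.
pathLength : ℕ → El instanceTy → ℕ
pathLength s I = suc s * suc (blocks s (proj₁ I))

reduction : ℕ → El instanceTy → El (nat ⊗ list setTy ⊗ nat)
reduction s I = length (labels s I) , hyperedges s I , pathLength s I

reductionₚ : ∀ s → Poly instanceTy (nat ⊗ list setTy ⊗ nat) (reduction s)
reductionₚ s = lengthₚ (labelsₚ s) ,ₚ hyperedgesₚ s ,ₚ timesₚ (suc s) (sucₚ (blocksₚ s fstₚ))

-- Lists

eqb⇒≡ : ∀ τ {x y} → T (eqb τ x y) → x ≡ y
eqb⇒≡ nat {m} {n} e with Equivalence.to (T-∧ {isZero (m ∸ n)}) e
... | a , b = ≤-antisym (m∸n≡0⇒m≤n (zero! a)) (m∸n≡0⇒m≤n (zero! b))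
  where
  zero! : ∀ {k} → T (isZero k) → k ≡ 0
  zero! {zero} _ = refl
eqb⇒≡ bool {true}  {true}  e = refl
eqb⇒≡ bool {false} {false} e = refl
eqb⇒≡ (list τ) {[]}     {[]}     e = refl
eqb⇒≡ (list τ) {x ∷ xs} {y ∷ ys} e with Equivalence.to (T-∧ {eqb τ x y}) e
... | a , b = cong₂ _∷_ (eqb⇒≡ τ a) (eqb⇒≡ (list τ) b)
eqb⇒≡ (σ ⊗ τ) {x , _} {x′ , _} e with Equivalence.to (T-∧ {eqb σ x x′}) e
... | a , b = cong₂ _,_ (eqb⇒≡ σ a) (eqb⇒≡ τ b)
eqb⇒≡ (σ ⊕ τ) {inj₁ x} {inj₁ y} e = cong inj₁ (eqb⇒≡ σ e)
eqb⇒≡ (σ ⊕ τ) {inj₂ x} {inj₂ y} e = cong inj₂ (eqb⇒≡ τ e)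

eqb-refl : ∀ τ x → T (eqb τ x x)
eqb-refl nat n rewrite n∸n≡0 n = _
eqb-refl bool true  = _
eqb-refl bool false = _
eqb-refl (list τ) []       = _
eqb-refl (list τ) (x ∷ xs) = Equivalence.from T-∧ (eqb-refl τ x , eqb-refl (list τ) xs)
eqb-refl (σ ⊗ τ) (x , y) = Equivalence.from T-∧ (eqb-refl σ x , eqb-refl τ y)
eqb-refl (σ ⊕ τ) (inj₁ x) = eqb-refl σ x
eqb-refl (σ ⊕ τ) (inj₂ y) = eqb-refl τ y

dec : ∀ τ → DecidableEquality (El τ)
dec τ x y with T? (eqb τ x y)
... | yes e = yes (eqb⇒≡ τ e)
... | no ¬e = no λ { refl → ¬e (eqb-refl τ x) }

anyEq⁺ : ∀ τ {x xs} → x ∈ xs → T (any (λ y → eqb τ x y) xs)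
anyEq⁺ τ {x} x∈xs = any⁺ _ (Any.map (λ { refl → eqb-refl τ x }) x∈xs)

anyEq⁻ : ∀ τ {x} xs → T (any (λ y → eqb τ x y) xs) → x ∈ xs
anyEq⁻ τ xs e = Any.map (eqb⇒≡ τ) (any⁻ _ xs e)

∈-nub⁻ : ∀ τ {x} xs → x ∈ nub τ xs → x ∈ xs
∈-nub⁻ τ (y ∷ xs) x∈ with any (eqb τ y) (nub τ xs) | x∈
... | true  | x∈′       = there (∈-nub⁻ τ xs x∈′)
... | false | here eq   = here eq
... | false | there x∈′ = there (∈-nub⁻ τ xs x∈′)

∈-nub⁺ : ∀ τ {x} xs → x ∈ xs → x ∈ nub τ xs
∈-nub⁺ τ (y ∷ xs) x∈ with any (eqb τ y) (nub τ xs) in eq | x∈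
... | true  | here refl = anyEq⁻ τ (nub τ xs) (Equivalence.from T-≡ eq)
... | true  | there x∈′ = ∈-nub⁺ τ xs x∈′
... | false | here eq′  = here eq′
... | false | there x∈′ = there (∈-nub⁺ τ xs x∈′)

nub-unique : ∀ τ xs → Unique (nub τ xs)
nub-unique τ []       = []
nub-unique τ (y ∷ xs) with any (eqb τ y) (nub τ xs) in eq
... | true  = nub-unique τ xs
... | false = ¬Any⇒All¬ _ (λ y∈ → subst T eq (anyEq⁺ τ y∈)) ∷ nub-unique τ xs

module _ {A : Set} where

  unique-⊆⇒length≤ : ∀ {xs ys : List A} → Unique xs → xs ⊆ ys → length xs ≤ length ys
  unique-⊆⇒length≤ {[]}     _         _     = z≤n
  unique-⊆⇒length≤ {x ∷ xs} (x∉ ∷ u) xs⊆ys with ∈-∃++ (xs⊆ys (here refl))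
  ... | as , bs , refl = begin
    suc (length xs)             ≤⟨ s≤s (unique-⊆⇒length≤ u shrink) ⟩
    suc (length (as ++ bs))     ≡⟨ cong suc (length-++ as) ⟩
    suc (length as + length bs) ≡⟨ +-suc (length as) (length bs) ⟨
    length as + length (x ∷ bs) ≡⟨ length-++ as ⟨
    length (as ++ x ∷ bs)       ∎
    where
    open ≤-Reasoning
    shrink : xs ⊆ as ++ bs
    shrink {z} z∈ with ∈-++⁻ as (xs⊆ys (there z∈))
    ... | inj₁ z∈as         = ∈-++⁺ˡ z∈as
    ... | inj₂ (here refl)  = contradiction z∈ (All¬⇒¬Any x∉)
    ... | inj₂ (there z∈bs) = ∈-++⁺ʳ as z∈bs

  -- Pigeonhole: an entry of `ys` missing from `xs` could be added to `xs`, making a duplicate-free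
  -- list inside `ys` longer than `ys`.
  unique-⊆⇒⊇ : DecidableEquality A → ∀ {xs ys : List A} → Unique xs → xs ⊆ ys →
               length ys ≤ length xs → ys ⊆ xs
  unique-⊆⇒⊇ _≟A_ {xs} {ys} u xs⊆ys le {y} y∈ with Any.any? (y ≟A_) xs
  ... | yes y∈xs = y∈xs
  ... | no  y∉xs = contradiction
    (unique-⊆⇒length≤ {y ∷ xs} {ys} (¬Any⇒All¬ xs y∉xs ∷ u) λ { (here refl) → y∈ ; (there z∈) → xs⊆ys z∈ })
    (≤⇒≯ le)

  lookup-injective : ∀ {xs : List A} → Unique xs → ∀ i j → lookup xs i ≡ lookup xs j → i ≡ j
  lookup-injective (x∉ ∷ u) zero    zero    eq = refl
  lookup-injective (x∉ ∷ u) zero    (suc j) eq = contradiction eq (All.lookup x∉ (∈-lookup j))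
  lookup-injective (x∉ ∷ u) (suc i) zero    eq = contradiction (sym eq) (All.lookup x∉ (∈-lookup i))
  lookup-injective (x∉ ∷ u) (suc i) (suc j) eq = cong suc (lookup-injective u i j eq)

  nth : A → List A → ℕ → A
  nth a []       _       = a
  nth a (x ∷ xs) zero    = x
  nth a (x ∷ xs) (suc i) = nth a xs i

  nth-∈ : ∀ a xs {i} → i < length xs → nth a xs i ∈ xs
  nth-∈ a (x ∷ xs) {zero}  _         = here refl
  nth-∈ a (x ∷ xs) {suc i} (s≤s i<n) = there (nth-∈ a xs i<n)

  nth-injective : ∀ a {xs} → Unique xs → ∀ {i j} → i < length xs → j < length xs →
                  nth a xs i ≡ nth a xs j → i ≡ j
  nth-injective a (x∉ ∷ u) {zero}  {zero}  _ _ _ = refl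
  nth-injective a {_ ∷ xs} (x∉ ∷ u) {zero}  {suc j} _ (s≤s j<) eq =
    contradiction eq (All.lookup x∉ (nth-∈ a xs j<))
  nth-injective a {_ ∷ xs} (x∉ ∷ u) {suc i} {zero}  (s≤s i<) _ eq =
    contradiction (sym eq) (All.lookup x∉ (nth-∈ a xs i<))
  nth-injective a (x∉ ∷ u) {suc i} {suc j} (s≤s i<) (s≤s j<) eq = cong suc (nth-injective a u i< j< eq)

module _ {A B : Set} where

  nth-window : ∀ b (f : A → B) xs i d r → d < r → i + d < length xs →
    ∃[ x ] x ∈ take r (drop i xs) × nth b (map f xs) (i + d) ≡ f x
  nth-window b f (x ∷ xs) zero    zero    (suc r) _         _         = x , here refl , refl
  nth-window b f (x ∷ xs) zero    (suc d) (suc r) (s≤s d<r) (s≤s d<n) =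
    let y , y∈ , eq = nth-window b f xs zero d r d<r d<n in y , there y∈ , eq
  nth-window b f (x ∷ xs) (suc i) d       r       d<r       (s≤s i<n) = nth-window b f xs i d r d<r i<n

  map-unique : {f : A → B} → ∀ {xs} → (∀ {x y} → x ∈ xs → y ∈ xs → f x ≡ f y → x ≡ y) →
               Unique xs → Unique (map f xs)
  map-unique {f} {[]}     inj []       = []
  map-unique {f} {x ∷ xs} inj (x∉ ∷ u) =
    ¬Any⇒All¬ _ (λ fx∈ → let y , y∈ , eq = ∈-map⁻ f fx∈ in
      All.lookup x∉ y∈ (inj (here refl) (there y∈) eq))
    ∷ map-unique (λ x∈ y∈ → inj (there x∈) (there y∈)) u

tabulate-window : ∀ {A : Set} k (f : Fin k → A) i r {x} → x ∈ take r (drop i (tabulate f)) →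
  ∃[ j ] ∃[ d ] d < r × toℕ j ≡ i + d × x ≡ f j
tabulate-window (suc k) f zero    (suc r) (here eq)  = zero , 0 , s≤s z≤n , refl , eq
tabulate-window (suc k) f zero    (suc r) (there x∈) =
  let j , d , d<r , eq , eq′ = tabulate-window k (f ∘ suc) zero r x∈ in
  suc j , suc d , s≤s d<r , cong suc eq , eq′
tabulate-window zero    f zero    (suc r) ()
tabulate-window zero    f (suc i) (suc r) ()
tabulate-window (suc k) f (suc i) r       x∈ =
  let j , d , d<r , eq , eq′ = tabulate-window k (f ∘ suc) i r x∈ in suc j , d , d<r , cong suc eq , eq′

-- Subsets as bit lists

∈-setOf⁺ : ∀ {n} {x : Fin n} {vs} → x ∈ vs → x Sub.∈ setOf vs
∈-setOf⁺ {x = x} (here refl) = x∈p∪q⁺ (inj₁ (x∈⁅x⁆ x))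
∈-setOf⁺ (there x∈)          = x∈p∪q⁺ (inj₂ (∈-setOf⁺ x∈))

∈-setOf⁻ : ∀ {n} {x : Fin n} vs → x Sub.∈ setOf vs → x ∈ vs
∈-setOf⁻ []       x∈ = contradiction x∈ ∉⊥
∈-setOf⁻ (v ∷ vs) x∈ with x∈p∪q⁻ ⁅ v ⁆ (setOf vs) x∈
... | inj₁ x∈v  = here (x∈⁅y⁆⇒x≡y v x∈v)
... | inj₂ x∈vs = there (∈-setOf⁻ vs x∈vs)

module _ {A : Set} where

  toList-injective : ∀ {n} {xs ys : Vec A n} → toList xs ≡ toList ys → xs ≡ ys
  toList-injective {xs = []}     {[]}     eq = refl
  toList-injective {xs = x ∷ xs} {y ∷ ys} eq =
    cong₂ _∷_ (∷-injectiveˡ eq) (toList-injective (∷-injectiveʳ eq))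

  toList≡map : ∀ {B : Set} (f : A → B) (xs : List A) (v : Vec B (length xs)) →
               (∀ i → Vec.lookup v i ≡ f (lookup xs i)) → toList v ≡ map f xs
  toList≡map f []       []      ok = refl
  toList≡map f (x ∷ xs) (b ∷ v) ok = cong₂ _∷_ (ok zero) (toList≡map f xs v (ok ∘ suc))

  map≡toList : ∀ {B : Set} (f : A → B) (xs : List A) (v : Vec B (length xs)) →
               toList v ≡ map f xs → ∀ i → Vec.lookup v i ≡ f (lookup xs i)
  map≡toList f (x ∷ xs) (b ∷ v) eq zero    = ∷-injectiveˡ eq
  map≡toList f (x ∷ xs) (b ∷ v) eq (suc i) = map≡toList f xs v (∷-injectiveʳ eq) i

  fromLists : ∀ n (ls : List (List A)) → All (λ l → length l ≡ n) ls →
              Σ (List (Vec A n)) λ vs → map toList vs ≡ ls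
  fromLists n []       []         = [] , refl
  fromLists _ (l ∷ ls) (refl ∷ a) = let vs , eq = fromLists _ ls a in
    Vec.fromList l ∷ vs , cong₂ _∷_ (toList∘fromList l) eq

∣∣≡weight : ∀ {n} (p : Subset n) → ∣ p ∣ ≡ weight (toList p)
∣∣≡weight []          = refl
∣∣≡weight (true ∷ p)  = cong suc (∣∣≡weight p)
∣∣≡weight (false ∷ p) = ∣∣≡weight p

encodeSubsets : ∀ {n} (ps : List (Subset n)) → encodeList encodeSubset ps ≡ enc (list setTy) (map toList ps)
encodeSubsets []       = refl
encodeSubsets (p ∷ ps) = cong (encodeSubset p ∙_) (encodeSubsets ps)

-- Membership in the lists that define the hypergraph

∈-concatMap-intro : ∀ {A B : Set} (f : A → List B) {y x} xs → x ∈ xs → y ∈ f x → y ∈ concatMap f xs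
∈-concatMap-intro f xs x∈ y∈ = ∈-concatMap⁺ f {xs = xs} (lose x∈ y∈)

∈-concatMap-elim : ∀ {A B : Set} (f : A → List B) {y} xs → y ∈ concatMap f xs → ∃[ x ] x ∈ xs × y ∈ f x
∈-concatMap-elim f xs y∈ = find (∈-concatMap⁻ f {xs = xs} y∈)

∈-tuples⁺ : ∀ {A : Set} {xs} (as : List A) → as ⊆ xs → as ∈ tuples (length as) xs
∈-tuples⁺ []       as⊆ = here refl
∈-tuples⁺ {xs = xs} (a ∷ as) as⊆ =
  ∈-concatMap-intro (λ x → map (x ∷_) (tuples (length as) xs)) xs (as⊆ (here refl)) (∈-map⁺ (a ∷_) (∈-tuples⁺ as (as⊆ ∘ there)))

∈-tuples⁻ : ∀ {A : Set} c {xs} {as : List A} → as ∈ tuples c xs → length as ≡ c × as ⊆ xs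
∈-tuples⁻ zero    (here refl) = refl , λ ()
∈-tuples⁻ (suc c) {xs} as∈ with ∈-concatMap-elim (λ x → map (x ∷_) (tuples c xs)) xs as∈
... | a , a∈ , as∈′ with ∈-map⁻ (a ∷_) as∈′
... | as , as∈″ , refl = let eq , as⊆ = ∈-tuples⁻ c as∈″ in
  cong suc eq , λ { (here refl) → a∈ ; (there x∈) → as⊆ x∈ }

∈-filterᵇ⁺ : ∀ {A : Set} (p : A → Bool) {x xs} → x ∈ xs → T (p x) → x ∈ filterᵇ p xs
∈-filterᵇ⁺ p = ∈-filter⁺ (T? ∘ p)

∈-filterᵇ⁻ : ∀ {A : Set} (p : A → Bool) {x xs} → x ∈ filterᵇ p xs → x ∈ xs × T (p x)
∈-filterᵇ⁻ p {xs = xs} = ∈-filter⁻ (T? ∘ p) {xs = xs}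

infix 4 _≼_

_≼_ : Slot → Slot → Set
a ≼ b = index a < index b ⊎ (index a ≡ index b × slotSet a ≡ slotSet b)

≼-trans : ∀ {a b c} → a ≼ b → b ≼ c → a ≼ c
≼-trans (inj₁ p)       (inj₁ q)       = inj₁ (<-trans p q)
≼-trans (inj₁ p)       (inj₂ (q , _)) = inj₁ (<-≤-trans p (≤-reflexive q))
≼-trans (inj₂ (p , _)) (inj₁ q)       = inj₁ (≤-<-trans (≤-reflexive p) q)
≼-trans (inj₂ (p , e)) (inj₂ (q , f)) = inj₂ (trans p q , trans e f)

≼⇒same-set : ∀ {a b} → a ≼ b → index a ≡ index b → slotSet a ≡ slotSet b
≼⇒same-set (inj₁ i<i)     eq = contradiction eq (<⇒≢ i<i)
≼⇒same-set (inj₂ (_ , e)) _  = e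

≼ᵇ⇒≼ : ∀ a b → T (a ≼ᵇ b) → a ≼ b
≼ᵇ⇒≼ a b t with Equivalence.to (T-∨ {not (isZero (index b ∸ index a))}) t
... | inj₁ pos = inj₁ (≰⇒> λ b≤a → subst (T ∘ not ∘ isZero) (m≤n⇒m∸n≡0 b≤a) pos)
... | inj₂ e   = let e₁ , e₂ = Equivalence.to (T-∧ {eqb nat (index a) (index b)}) e in
  inj₂ (eqb⇒≡ nat e₁ , eqb⇒≡ setTy e₂)

≼⇒≼ᵇ : ∀ a b → a ≼ b → T (a ≼ᵇ b)
≼⇒≼ᵇ a b (inj₁ a<b) = Equivalence.from (T-∨ {not (isZero (index b ∸ index a))}) (inj₁ (pos (m<n⇒0<n∸m a<b)))
  where
  pos : ∀ {n} → 0 < n → T (not (isZero n))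
  pos (s≤s _) = _
≼⇒≼ᵇ (_ , i , A) (_ , _ , _) (inj₂ (refl , refl)) =
  Equivalence.from (T-∨ {not (isZero (i ∸ i))}) (inj₂ (eqb-refl (nat ⊗ setTy) (i , A)))

record Linked (p q : Connector) : Set where
  field
    level-suc    : level q ≡ suc (level p)
    after≡before : after p ≡ before q
    ordered      : ∀ {a b} → a ∈ before p → b ∈ before q → a ≼ b
    comparable   : ∀ {a b} → a ∈ before q → b ∈ before q → a ≼ b ⊎ b ≼ a

linked⇒Linked : ∀ p q → T (linked p q) → Linked p q
linked⇒Linked p q t with Equivalence.to (T-∧ {eqb nat (level q) (suc (level p))}) t
... | t₁ , t′ with Equivalence.to (T-∧ {eqb (list slotTy) (after p) (before q)}) t′
... | t₂ , t″ with Equivalence.to (T-∧ {all (λ a → all (λ b → a ≼ᵇ b) (before q)) (before p)}) t″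
... | t₃ , t₄ = record
  { level-suc    = eqb⇒≡ nat t₁
  ; after≡before = eqb⇒≡ (list slotTy) t₂
  ; ordered      = λ {a} {b} a∈ b∈ → ≼ᵇ⇒≼ a b
      (All.lookup (all⁺ _ (before q) (All.lookup (all⁺ _ (before p) t₃) a∈)) b∈)
  ; comparable   = λ {a} {b} a∈ b∈ → [ (λ t → inj₁ (≼ᵇ⇒≼ a b t)) , (λ t → inj₂ (≼ᵇ⇒≼ b a t)) ]
      (Equivalence.to (T-∨ {a ≼ᵇ b}) (All.lookup (all⁺ _ (before q) (All.lookup (all⁺ _ (before q) t₄) a∈)) b∈))
  }

Linked⇒linked : ∀ p q → Linked p q → T (linked p q)
Linked⇒linked p q l = Equivalence.from T-∧
  ( subst (λ n → T (eqb nat n (suc (level p)))) (sym level-suc) (eqb-refl nat (suc (level p)))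
  , Equivalence.from T-∧
  ( subst (λ n → T (eqb (list slotTy) n (before q))) (sym after≡before) (eqb-refl (list slotTy) (before q))
  , Equivalence.from T-∧
  ( all⁻ _ (All.tabulate λ {a} a∈ → all⁻ _ (All.tabulate λ {b} b∈ → ≼⇒≼ᵇ a b (ordered a∈ b∈)))
  , all⁻ _ (All.tabulate λ {a} a∈ → all⁻ _ (All.tabulate λ {b} b∈ →
      Equivalence.from (T-∨ {a ≼ᵇ b}) ([ (λ c → inj₁ (≼⇒≼ᵇ a b c)) , (λ c → inj₂ (≼⇒≼ᵇ b a c)) ] (comparable a∈ b∈)))))))
  where open Linked l

-- Tight paths in terms of labels

-- Containment of a window in a candidate is enough: the window has `r` distinct labels and the
-- candidates in use have length `r`, so the two agree as sets. `label` is total, but only positions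
-- below `k` matter.
record LabelPath (r : ℕ) (V : List Label) (Candidate : List Label → Set) (k : ℕ) : Set where
  field
    label     : ℕ → Label
    valid     : ∀ {i} → i < k → label i ∈ V
    injective : ∀ {i j} → i < k → j < k → label i ≡ label j → i ≡ j
    window    : ∀ i → i + r ≤ k → ∃[ L ] Candidate L × (∀ d → d < r → label (i + d) ∈ L)

module LabelledHypergraph (r : ℕ) (V : List Label) (V-unique : Unique V) (Candidate : List Label → Set)
  (length-candidate : ∀ {L} → Candidate L → length L ≡ r)
  (E : List (List Bool)) (E-unique : Unique E)
  (∈-E⁺ : ∀ {L} → Candidate L → weight (bits V L) ≡ r → bits V L ∈ E)
  (∈-E⁻ : ∀ {bs} → bs ∈ E → weight bs ≡ r × ∃[ L ] Candidate L × bs ≡ bits V L) where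

  private
    subsets : Σ (List (Subset (length V))) λ es → map toList es ≡ E
    subsets = fromLists (length V) (E) (All.tabulate λ bs∈ →
      let _ , L , _ , eq = ∈-E⁻ bs∈ in trans (cong length eq) (length-map _ V))
    es = proj₁ subsets

    ∈-subsets⁻ : ∀ {e} → e ∈ es → toList e ∈ E
    ∈-subsets⁻ e∈ = subst (_ ∈_) (proj₂ subsets) (∈-map⁺ toList e∈)

    ∈-subsets⁺ : ∀ {e} → toList e ∈ E → e ∈ es
    ∈-subsets⁺ e∈ with ∈-map⁻ toList (subst (_ ∈_) (sym (proj₂ subsets)) e∈)
    ... | e′ , e′∈ , eq = subst (_∈ es) (sym (toList-injective eq)) e′∈

  hypergraph : UniformHypergraph r
  hypergraph = record
    { nodes    = length V
    ; edges    = es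
    ; distinct = Unique.map⁻ (subst Unique (sym (proj₂ subsets)) E-unique)
    ; uniform  = All.tabulate λ {e} e∈ → trans (∣∣≡weight e) (proj₁ (∈-E⁻ (∈-subsets⁻ e∈)))
    }

  length-edges : length es ≡ length E
  length-edges = trans (sym (length-map toList es)) (cong length (proj₂ subsets))

  encode-hypergraph : ∀ k → Problem.encode (HyperPath r) (hypergraph , k)
                          ≡ enc (nat ⊗ list setTy ⊗ nat) (length V , E , k)
  encode-hypergraph k = cong (λ t → encodeℕ (length V) ∙ t ∙ encodeℕ k)
    (trans (encodeSubsets es) (cong (enc (list setTy)) (proj₂ subsets)))

  private
    lookup-setOf⁺ : ∀ {x vs} → x ∈ vs → Vec.lookup (setOf {length V} vs) x ≡ true
    lookup-setOf⁺ x∈ = []=⇒lookup (∈-setOf⁺ x∈)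

    lookup-setOf⁻ : ∀ {x vs} → Vec.lookup (setOf {length V} vs) x ≡ true → x ∈ vs
    lookup-setOf⁻ {x} {vs} eq = ∈-setOf⁻ vs (lookup⇒[]= x (setOf vs) eq)

  tightPath⇒labelPath : ∀ {k} → TightPath hypergraph k → LabelPath r V Candidate k
  tightPath⇒labelPath {k} P = record
    { label     = g
    ; valid     = λ i<k → let x , x∈ , eq = ∈-map⁻ (lookup V) (nth-∈ _ w (len i<k)) in
                    subst (_∈ V) (sym eq) (∈-lookup x)
    ; injective = λ i<k j<k → nth-injective _ w-unique (len i<k) (len j<k)
    ; window    = window′
    }
    where
    open TightPath P
    w = map (lookup V) path
    -- The default `inj₁ 0` is returned only beyond the end of the path.
    g = nth (inj₁ 0) w
    len : ∀ {i} → i < k → i < length w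
    len i<k = <-≤-trans i<k (≤-reflexive (sym (trans (length-map _ path) length≡k)))
    w-unique : Unique w
    w-unique = Unique.map⁺ (lookup-injective V-unique _ _) distinctNodes
    window′ : ∀ i → i + r ≤ k → ∃[ L ] Candidate L × (∀ d → d < r → g (i + d) ∈ L)
    window′ i i+r≤k with ∈-E⁻ (∈-subsets⁻ (tight i i+r≤k))
    ... | _ , L , c , eq = L , c , λ d d<r →
      let x , x∈ , eq′ = nth-window (inj₁ 0) (lookup V) path i d r d<r
            (<-≤-trans (+-monoʳ-< i d<r) (≤-trans i+r≤k (≤-reflexive (sym length≡k)))) in
      subst (_∈ L) (sym eq′) (anyEq⁻ labelTy L (Equivalence.from T-≡
        (trans (sym (map≡toList _ V (setOf (take r (drop i path))) eq x)) (lookup-setOf⁺ x∈))))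

  -- The `r` distinct labels of a window exhaust a candidate of length `r`. Hence this candidate has
  -- no repetition, passes the weight test, and its bits are the characteristic vector of the
  -- window.
  labelPath⇒tightPath : ∀ {k} → LabelPath r V Candidate k → TightPath hypergraph k
  labelPath⇒tightPath {k} P = record
    { path          = path
    ; length≡k      = length-tabulate f
    ; distinctNodes = path-unique
    ; tight         = tight
    }
    where
    open LabelPath P
    f : Fin k → Fin (length V)
    f j = Any.index (valid (toℕ<n j))
    lookup-f : ∀ j → lookup V (f j) ≡ label (toℕ j)
    lookup-f j = sym (lookup-index (valid (toℕ<n j)))
    path = tabulate f
    path-unique : Unique path
    path-unique = Unique.tabulate⁺ λ {i} {j} eq → toℕ-injective
      (injective (toℕ<n i) (toℕ<n j) (trans (sym (lookup-f i)) (trans (cong (lookup V) eq) (lookup-f j))))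
    tight : ∀ i → i + r ≤ k → setOf (take r (drop i path)) ∈ es
    tight i i+r≤k with window i i+r≤k
    ... | L , c , ok = ∈-subsets⁺ (subst (_∈ E) (sym toList≡bits) (∈-E⁺ c weight≡r))
      where
      xs = take r (drop i path)
      W = map (lookup V) xs
      W-unique : Unique W
      W-unique = Unique.map⁺ (lookup-injective V-unique _ _) (Unique.take⁺ r (Unique.drop⁺ i path-unique))
      length-W : length W ≡ r
      length-W = trans (length-map _ xs) (trans (length-take r (drop i path))
        (trans (cong (r ⊓_) (trans (length-drop i path) (cong (_∸ i) (length-tabulate f))))
          (m≤n⇒m⊓n≡m (m+n≤o⇒m≤o∸n r (≤-trans (≤-reflexive (+-comm r i)) i+r≤k)))))
      W⊆L : W ⊆ L
      W⊆L v∈ with ∈-map⁻ (lookup V) v∈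
      ... | x , x∈ , refl with tabulate-window k f i r x∈
      ... | j , d , d<r , eq , refl =
        subst (_∈ L) (sym (trans (lookup-f j) (cong label eq))) (ok d d<r)
      L⊆W : L ⊆ W
      L⊆W = unique-⊆⇒⊇ (dec labelTy) W-unique W⊆L (≤-reflexive (trans (length-candidate c) (sym length-W)))
      bit : Label → Bool
      bit v = any (λ w → eqb labelTy v w) L
      toList≡bits : toList (setOf xs) ≡ bits V L
      toList≡bits = toList≡map bit V (setOf xs) agree
        where
        true⇔ : ∀ {a b} → (a ≡ true → b ≡ true) → (b ≡ true → a ≡ true) → a ≡ b
        true⇔ {false} {false} p q = refl
        true⇔ {false} {true}  p q = q refl
        true⇔ {true}  {b}     p q = sym (p refl)
        agree : ∀ x → Vec.lookup (setOf xs) x ≡ bit (lookup V x)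
        agree x = true⇔
          (λ eq → Equivalence.to T-≡ (anyEq⁺ labelTy (W⊆L (∈-map⁺ (lookup V) (lookup-setOf⁻ {vs = xs} eq)))))
          (λ eq → let y , y∈ , eq′ = ∈-map⁻ (lookup V) (L⊆W (anyEq⁻ labelTy L (Equivalence.from T-≡ eq))) in
             lookup-setOf⁺ (subst (_∈ xs) (sym (lookup-injective V-unique _ _ eq′)) y∈))
      weight≡r : weight (bits V L) ≡ r
      weight≡r = trans (weight-map V) (≤-antisym
        (≤-trans (unique-⊆⇒length≤ (Unique.filter⁺ (T? ∘ bit) V-unique)
           (λ v∈ → anyEq⁻ labelTy L (proj₂ (∈-filterᵇ⁻ bit {xs = V} v∈))))
           (≤-reflexive (length-candidate c)))
        (≤-trans (≤-reflexive (sym length-W)) (unique-⊆⇒length≤ W-unique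
           (λ v∈ → ∈-filterᵇ⁺ bit (W⊆V v∈) (anyEq⁺ labelTy (W⊆L v∈))))))
        where
        W⊆V : W ⊆ V
        W⊆V v∈ with ∈-map⁻ (lookup V) v∈
        ... | x , _ , refl = ∈-lookup x
        weight-map : ∀ vs → weight (map bit vs) ≡ length (filterᵇ bit vs)
        weight-map []       = refl
        weight-map (v ∷ vs) with bit v
        ... | true  = cong suc (weight-map vs)
        ... | false = weight-map vs

module _ (s : ℕ) (I : El instanceTy) where

  private
    n = proj₁ I
    G = proj₁ (proj₂ I)
    t = proj₂ (proj₂ I)
    N = realElements s I
    V = labels s I
    r = 2 + s

  ValidSlot : Slot → Set
  ValidSlot (u , i , A) = u < N × i < t × A ∈ G × T (member A u)

  private
    slotsAt : ℕ → ℕ → List Slot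
    slotsAt u i = map (λ A → u , i , A) (filterᵇ (λ A → member A u) G)

    slotsOf : ℕ → List Slot
    slotsOf u = concatMap (slotsAt u) (downFrom t)

  ∈-slots⁺ : ∀ a → ValidSlot a → a ∈ slots s I
  ∈-slots⁺ (u , i , A) (u< , i< , A∈ , m) = ∈-concatMap-intro slotsOf (downFrom N) (∈-downFrom⁺ u<)
    (∈-concatMap-intro (slotsAt u) (downFrom t) (∈-downFrom⁺ i<)
      (∈-map⁺ (λ A → u , i , A) (∈-filterᵇ⁺ (λ A → member A u) A∈ m)))

  ∈-slots⁻ : ∀ {a} → a ∈ slots s I → ValidSlot a
  ∈-slots⁻ a∈ with ∈-concatMap-elim slotsOf (downFrom N) a∈
  ... | u , u∈ , a∈₁ with ∈-concatMap-elim (slotsAt u) (downFrom t) a∈₁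
  ... | i , i∈ , a∈₂ with ∈-map⁻ (λ A → u , i , A) a∈₂
  ... | A , A∈ , refl = let A∈G , m = ∈-filterᵇ⁻ (λ A → member A u) {xs = G} A∈ in
    ∈-downFrom⁻ u∈ , ∈-downFrom⁻ i∈ , A∈G , m

  ValidConnector : Connector → Set
  ValidConnector p = level p ≤ blocks s n × before p ∈ slotBlocks s I ×
                     (after p ≡ tailBlock s I ⊎ after p ∈ slotBlocks s I)

  private
    connectorsAt : ℕ → List Slot → List Connector
    connectorsAt j x = map (λ y → j , x , y) (tailBlock s I ∷ slotBlocks s I)

    connectorsOf : ℕ → List Connector
    connectorsOf j = concatMap (connectorsAt j) (slotBlocks s I)

  opaque
    unfolding connectors

    ∈-connectors⁺ : ∀ p → ValidConnector p → p ∈ connectors s I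
    ∈-connectors⁺ (j , x , y) (j≤ , x∈ , y∈) =
      ∈-concatMap-intro connectorsOf (downFrom (suc (blocks s n))) (∈-downFrom⁺ (s≤s j≤))
        (∈-concatMap-intro (connectorsAt j) (slotBlocks s I) x∈
          (∈-map⁺ (λ y → j , x , y) ([ here , there ]′ y∈)))

    ∈-connectors⁻ : ∀ {p} → p ∈ connectors s I → ValidConnector p
    ∈-connectors⁻ p∈ with ∈-concatMap-elim connectorsOf (downFrom (suc (blocks s n))) p∈
    ... | j , j∈ , p∈₁ with ∈-concatMap-elim (connectorsAt j) (slotBlocks s I) p∈₁
    ... | x , x∈ , p∈₂ with ∈-map⁻ (λ y → j , x , y) p∈₂
    ... | y , here y≡  , refl = ≤-pred (∈-downFrom⁻ j∈) , x∈ , inj₁ y≡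
    ... | y , there y∈ , refl = ≤-pred (∈-downFrom⁻ j∈) , x∈ , inj₂ y∈

  opaque
    unfolding slotBlocks

    ∈-slotBlocks⁺ : ∀ as → length as ≡ s → (∀ {a} → a ∈ as → ValidSlot a) → as ∈ slotBlocks s I
    ∈-slotBlocks⁺ as len ok = subst (λ c → as ∈ tuples c (slots s I)) len
      (∈-tuples⁺ as λ {a} a∈ → ∈-slots⁺ a (ok a∈))

    ∈-slotBlocks⁻ : ∀ {as} → as ∈ slotBlocks s I → length as ≡ s × (∀ {a} → a ∈ as → ValidSlot a)
    ∈-slotBlocks⁻ as∈ = let len , as⊆ = ∈-tuples⁻ s as∈ in len , λ a∈ → ∈-slots⁻ (as⊆ a∈)

  length-before : ∀ {p} → p ∈ connectors s I → length (before p) ≡ s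
  length-before p∈ = let _ , x∈ , _ = ∈-connectors⁻ p∈ in proj₁ (∈-slotBlocks⁻ x∈)

  before-valid : ∀ {p a} → p ∈ connectors s I → a ∈ before p → ValidSlot a
  before-valid p∈ = let _ , x∈ , _ = ∈-connectors⁻ p∈ in proj₂ (∈-slotBlocks⁻ x∈)

  length-after : ∀ {p} → p ∈ connectors s I → length (after p) ≡ s
  length-after p∈ with ∈-connectors⁻ p∈
  ... | _ , _ , inj₁ y≡ = trans (cong length y≡) (trans (length-map _ (upTo s)) (length-upTo s))
  ... | _ , _ , inj₂ y∈ = proj₁ (∈-slotBlocks⁻ y∈)

  data Candidate : List Label → Set where
    link : ∀ {p q} → p ∈ connectors s I → q ∈ connectors s I → Linked p q → Candidate (linkEdge p q)
    star : ∀ {p as} → p ∈ connectors s I → length as ≡ suc s → as ⊆ before p ++ after p →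
           Candidate (starEdge p as)

  private
    linkEdgesAt starEdgesAt : Connector → List (List Label)
    linkEdgesAt p = map (linkEdge p) (filterᵇ (linked p) (connectors s I))
    starEdgesAt p = map (starEdge p) (tuples (suc s) (before p ++ after p))

  ∈-candidates⁺ : ∀ {L} → Candidate L → L ∈ candidates s I
  ∈-candidates⁺ (link {p} {q} p∈ q∈ l) = ∈-++⁺ˡ (∈-concatMap-intro linkEdgesAt (connectors s I) p∈
    (∈-map⁺ (linkEdge p) (∈-filterᵇ⁺ (linked p) q∈ (Linked⇒linked p q l))))
  ∈-candidates⁺ (star {p} {as} p∈ len as⊆) =
    ∈-++⁺ʳ (linkEdges s I) (∈-concatMap-intro starEdgesAt (connectors s I) p∈
      (∈-map⁺ (starEdge p) (subst (λ c → as ∈ tuples c (before p ++ after p)) len (∈-tuples⁺ as as⊆))))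

  ∈-candidates⁻ : ∀ {L} → L ∈ candidates s I → Candidate L
  ∈-candidates⁻ L∈ with ∈-++⁻ (linkEdges s I) L∈
  ∈-candidates⁻ L∈ | inj₁ L∈₁ with ∈-concatMap-elim linkEdgesAt (connectors s I) L∈₁
  ... | p , p∈ , L∈₂ with ∈-map⁻ (linkEdge p) L∈₂
  ... | q , q∈ , refl = let q∈′ , l = ∈-filterᵇ⁻ (linked p) {xs = connectors s I} q∈ in
    link p∈ q∈′ (linked⇒Linked p q l)
  ∈-candidates⁻ L∈ | inj₂ L∈₁ with ∈-concatMap-elim starEdgesAt (connectors s I) L∈₁
  ... | p , p∈ , L∈₂ with ∈-map⁻ (starEdge p) L∈₂
  ... | as , as∈ , refl = let len , as⊆ = ∈-tuples⁻ (suc s) as∈ in star p∈ len as⊆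

  length-candidate : ∀ {L} → Candidate L → length L ≡ r
  length-candidate (link {p} p∈ q∈ l) = cong (2 +_) (trans (length-map _ (after p)) (length-after p∈))
  length-candidate (star {as = as} p∈ len as⊆) = cong suc (trans (length-map _ as) len)

  opaque
    unfolding labels

    ∈-labels⁺-element : ∀ {u} → u < N + s → inj₁ u ∈ V
    ∈-labels⁺-element u< = ∈-nub⁺ labelTy (allLabels s I) (∈-++⁺ˡ (∈-map⁺ inj₁ (∈-downFrom⁺ u<)))

    ∈-labels⁺-connector : ∀ {p} → p ∈ connectors s I → inj₂ p ∈ V
    ∈-labels⁺-connector p∈ = ∈-nub⁺ labelTy (allLabels s I) (∈-++⁺ʳ (map inj₁ (downFrom (N + s))) (∈-map⁺ inj₂ p∈))

    labels-unique : Unique V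
    labels-unique = nub-unique labelTy (allLabels s I)

  opaque
    unfolding hyperedges

    ∈-hyperedges⁺ : ∀ {L} → Candidate L → weight (bits V L) ≡ r → bits V L ∈ hyperedges s I
    ∈-hyperedges⁺ {L} c w = ∈-nub⁺ setTy (uniformBits s I) (∈-filterᵇ⁺ (λ bs → eqb nat (weight bs) r) (∈-map⁺ (bits V) (∈-candidates⁺ c))
      (subst (λ n → T (eqb nat n r)) (sym w) (eqb-refl nat r)))

    ∈-hyperedges⁻ : ∀ {bs} → bs ∈ hyperedges s I → weight bs ≡ r × ∃[ L ] Candidate L × bs ≡ bits V L
    ∈-hyperedges⁻ bs∈ with ∈-filterᵇ⁻ (λ bs → eqb nat (weight bs) r) {xs = map (bits V) (candidates s I)}
                          (∈-nub⁻ setTy (uniformBits s I) bs∈)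
    ... | bs∈′ , w with ∈-map⁻ (bits V) bs∈′
    ... | L , L∈ , eq = eqb⇒≡ nat w , L , ∈-candidates⁻ L∈ , eq

    hyperedges-unique : Unique (hyperedges s I)
    hyperedges-unique = nub-unique setTy (uniformBits s I)

  open LabelledHypergraph (2 + s) (labels s I) labels-unique Candidate length-candidate
    (hyperedges s I) hyperedges-unique ∈-hyperedges⁺ ∈-hyperedges⁻ public

-- From tight paths to covers

record CoverBy (n : ℕ) (G : List (List Bool)) (t : ℕ) : Set where
  field
    sets        : List (List Bool)
    length-sets : length sets ≤ t
    sets⊆G      : sets ⊆ G
    covered     : ∀ {u} → u < n → ∃[ A ] A ∈ sets × T (member A u)

range : ℕ → ℕ → List ℕ
range b m = applyUpTo (b +_) m

∈-range⁻ : ∀ {b m c} → c ∈ range b m → b ≤ c × c < b + m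
∈-range⁻ {b} {m} c∈ with ∈-applyUpTo⁻ (b +_) {n = m} c∈
... | d , d<m , refl = m≤m+n b d , +-monoʳ-< b d<m

range-unique : ∀ b m → Unique (range b m)
range-unique b m = Unique.applyUpTo⁺₁ (b +_) m λ i<j _ eq → <⇒≢ i<j (+-cancelˡ-≡ b _ _ eq)

ranges-unique : ∀ b m b′ m′ → b + m ≤ b′ → Unique (range b m ++ range b′ m′)
ranges-unique b m b′ m′ le = Unique.++⁺ (range-unique b m) (range-unique b′ m′) λ (c∈ , c∈′) →
  <⇒≱ (proj₂ (∈-range⁻ {b} {m} c∈)) (≤-trans le (proj₁ (∈-range⁻ {b′} {m′} c∈′)))

length-ranges : ∀ b m b′ m′ → length (range b m ++ range b′ m′) ≡ m + m′
length-ranges b m b′ m′ = trans (length-++ (range b m))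
  (cong₂ _+_ (length-applyUpTo (b +_) m) (length-applyUpTo (b′ +_) m′))

inj₁∈elementLabels : ∀ {u} as → inj₁ u ∈ elementLabels as → ∃[ a ] a ∈ as × element a ≡ u
inj₁∈elementLabels as u∈ with ∈-map⁻ (λ a → inj₁ (element a)) u∈
... | a , a∈ , refl = a , a∈ , refl

inj₂∉elementLabels : ∀ {p : Connector} as → inj₂ p ∉ elementLabels as
inj₂∉elementLabels as p∈ with ∈-map⁻ (λ a → inj₁ (element a)) p∈
... | _ , _ , ()

elementLabels-mono : ∀ {as bs} → as ⊆ bs → elementLabels as ⊆ elementLabels bs
elementLabels-mono as⊆bs v∈ with ∈-map⁻ (λ a → inj₁ (element a)) v∈
... | a , a∈ , refl = ∈-map⁺ (λ a → inj₁ (element a)) (as⊆bs a∈)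

-- Local structure of a tight path

module _ (s : ℕ) (I : El instanceTy) (1≤s : 1 ≤ s) {k : ℕ} (P : LabelPath (2 + s) (labels s I) (Candidate s I) k) where

  private
    r = 2 + s
    open LabelPath P

  _inWindow_ : ℕ → ℕ → Set
  a inWindow i = i ≤ a × a < i + r

  record WindowIs (i : ℕ) (L : List Label) : Set where
    field
      to   : ∀ {a} → a inWindow i → label a ∈ L
      from : ∀ {v} → v ∈ L → ∃[ a ] a inWindow i × label a ≡ v

  private
    labels-of : ∀ {ps} → Unique ps → (∀ {c} → c ∈ ps → c < k) → Unique (map label ps)
    labels-of u lt = map-unique (λ c∈ d∈ → injective (lt c∈) (lt d∈)) u

  crowded : ∀ {ps M} → Unique ps → (∀ {c} → c ∈ ps → c < k) → (∀ {c} → c ∈ ps → label c ∈ M) →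
            length ps ≤ length M
  crowded {ps} u lt ok = ≤-trans (≤-reflexive (sym (length-map label ps)))
    (unique-⊆⇒length≤ (labels-of u lt) λ v∈ → let c , c∈ , eq = ∈-map⁻ label v∈ in subst (_∈ _) (sym eq) (ok c∈))

  opaque
    -- `from` is by counting: `r` positions with distinct labels fill a candidate of length `r`.
    windowIs : ∀ i → i + r ≤ k → ∃[ L ] Candidate s I L × WindowIs i L
    windowIs i i+r≤k with window i i+r≤k
    ... | L , c , ok = L , c , record { to = to ; from = from }
      where
      to : ∀ {a} → a inWindow i → label a ∈ L
      to {a} (i≤a , a<) = subst (λ b → label b ∈ L) (m+[n∸m]≡n i≤a)
        (ok (a ∸ i) (+-cancelˡ-< i (a ∸ i) r (subst (_< i + r) (sym (m+[n∸m]≡n i≤a)) a<)))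
      lt : ∀ {c} → c ∈ range i r → c < k
      lt c∈ = <-≤-trans (proj₂ (∈-range⁻ c∈)) i+r≤k
      from : ∀ {v} → v ∈ L → ∃[ a ] a inWindow i × label a ≡ v
      from v∈ with ∈-map⁻ label (unique-⊆⇒⊇ (dec labelTy) (labels-of (range-unique i r) lt)
          (λ v∈ → let c , c∈ , eq = ∈-map⁻ label v∈ in subst (_∈ L) (sym eq) (to (∈-range⁻ c∈)))
          (≤-reflexive (trans (length-candidate s I c)
            (sym (trans (length-map label (range i r)) (length-applyUpTo (i +_) r))))) v∈)
      ... | a , a∈ , eq = a , ∈-range⁻ a∈ , sym eq

  Link : ℕ → Connector → Connector → Set
  Link i p q = Linked p q × WindowIs i (linkEdge p q) × p ∈ connectors s I × q ∈ connectors s I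

  Linked-asym : ∀ {p q} → Linked p q → ¬ Linked q p
  Linked-asym l l′ = <-asym (≤-reflexive (sym (Linked.level-suc l))) (≤-reflexive (sym (Linked.level-suc l′)))

  private
    ends : ∀ {p q v} → inj₂ v ∈ linkEdge p q → v ≡ p ⊎ v ≡ q
    ends (here refl)         = inj₁ refl
    ends (there (here refl)) = inj₂ refl
    ends {p} (there (there v∈)) = contradiction v∈ (inj₂∉elementLabels (after p))

  opaque
    -- A star edge has only one connector and no label occurs twice on the path, so the window is a
    -- link edge and the two connectors are its ends.
    two-connectors : ∀ i → i + r ≤ k → ∀ {a b p q} → a inWindow i → b inWindow i → a ≢ b →
      label a ≡ inj₂ p → label b ≡ inj₂ q → Link i p q ⊎ Link i q p
    two-connectors i i+r≤k {a} {b} {p} {q} ia ib a≢b ea eb with windowIs i i+r≤k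
    ... | _ , star {p′} {as} _ _ _ , w = contradiction (inj₂-injective (trans (sym ea) (trans p≡q eb)))
        λ { refl → a≢b (injective (<-≤-trans (proj₂ ia) i+r≤k) (<-≤-trans (proj₂ ib) i+r≤k) (trans ea (sym eb))) }
      where
      open WindowIs w
      only : ∀ {v} → inj₂ v ∈ starEdge p′ as → v ≡ p′
      only (here refl) = refl
      only (there v∈)  = contradiction v∈ (inj₂∉elementLabels as)
      p≡q : label a ≡ label b
      p≡q = trans ea (trans (cong inj₂ (trans (only (subst (_∈ _) ea (to ia)))
                                              (sym (only (subst (_∈ _) eb (to ib)))))) (sym eb))
    ... | _ , link p∈ q∈ l , w with ends (subst (_∈ _) ea (WindowIs.to w ia)) | ends (subst (_∈ _) eb (WindowIs.to w ib))
    ... | inj₁ refl | inj₂ refl = inj₁ (l , w , p∈ , q∈)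
    ... | inj₂ refl | inj₁ refl = inj₂ (l , w , p∈ , q∈)
    ... | inj₁ refl | inj₁ refl = contradiction
      (injective (<-≤-trans (proj₂ ia) i+r≤k) (<-≤-trans (proj₂ ib) i+r≤k) (trans ea (sym eb))) a≢b
    ... | inj₂ refl | inj₂ refl = contradiction
      (injective (<-≤-trans (proj₂ ia) i+r≤k) (<-≤-trans (proj₂ ib) i+r≤k) (trans ea (sym eb))) a≢b

  -- A pair of connectors determines the edges containing it, so it lies in only one window.
  one-window : ∀ i → suc i + r ≤ k → ∀ {p q} → Link i p q → ¬ Link (suc i) p q
  one-window i le (_ , w , _) (_ , w′ , _) with WindowIs.from w′ (WindowIs.to w (≤-refl , m<m+n i (s≤s z≤n)))
  ... | a , (i<a , a<) , eq = <⇒≢ i<a (sym (injective (<-≤-trans a< le)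
          (<-≤-trans (<-trans i<a a<) le) eq))

  -- Both windows would be link edges with the same two ends. The levels force the same orientation,
  -- hence the same edge, against `one-window`.
  far-apart : ∀ i → suc i + r ≤ k → ∀ {a b p q} → a inWindow i → b inWindow i →
    a inWindow (suc i) → b inWindow (suc i) → a ≢ b → label a ≡ inj₂ p → label b ≡ inj₂ q → ⊥
  far-apart i le ia ib ia′ ib′ a≢b ea eb
    with two-connectors i (≤-trans (n≤1+n _) le) ia ib a≢b ea eb
       | two-connectors (suc i) le ia′ ib′ a≢b ea eb
  ... | inj₁ l | inj₁ l′ = one-window i le l l′
  ... | inj₂ l | inj₂ l′ = one-window i le l l′
  ... | inj₁ l | inj₂ l′ = Linked-asym (proj₁ l) (proj₁ l′)
  ... | inj₂ l | inj₁ l′ = Linked-asym (proj₁ l) (proj₁ l′)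

  opaque
    -- In a star edge the elements are taken from the two blocks of `p` by construction; in a link
    -- edge they form the block after the lower end, which is the block before the upper end.
    near-elements : ∀ i → i + r ≤ k → ∀ {a b p u} → a inWindow i → b inWindow i →
      label a ≡ inj₂ p → label b ≡ inj₁ u → label b ∈ elementLabels (before p ++ after p)
    near-elements i i+r≤k {a} {b} {p} {u} ia ib ea eb with windowIs i i+r≤k
    ... | _ , star {p′} {as} _ _ as⊆ , w with subst (_∈ _) ea (WindowIs.to w ia) | subst (_∈ _) eb (WindowIs.to w ib)
    ... | here refl | there u∈ = subst (_∈ _) (sym eb) (elementLabels-mono as⊆ u∈)
    ... | there p∈  | _        = contradiction p∈ (inj₂∉elementLabels as)
    near-elements i i+r≤k {a} {b} {p} {u} ia ib ea eb | _ , link {p′} {q′} _ _ l , w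
      with ends (subst (_∈ _) ea (WindowIs.to w ia)) | subst (_∈ _) eb (WindowIs.to w ib)
    ... | inj₁ refl | there (there u∈) = subst (_∈ _) (sym eb) (elementLabels-mono (∈-++⁺ʳ (before p)) u∈)
    ... | inj₂ refl | there (there u∈) = subst (_∈ _) (sym eb) (elementLabels-mono
      (λ a∈ → ∈-++⁺ˡ (subst (_ ∈_) (Linked.after≡before l) a∈)) u∈)

  opaque
    connector-in-window : ∀ i → i + r ≤ k → ∃[ a ] ∃[ p ] a inWindow i × label a ≡ inj₂ p
    connector-in-window i i+r≤k with windowIs i i+r≤k
    ... | _ , star {p} _ _ _ , w = let a , ia , eq = WindowIs.from w (here refl) in a , p , ia , eq
    ... | _ , link {p} _ _ _ , w = let a , ia , eq = WindowIs.from w (here refl) in a , p , ia , eq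

  connector-valid : ∀ i → i + r ≤ k → ∀ {a p} → a inWindow i → label a ≡ inj₂ p → p ∈ connectors s I
  connector-valid i i+r≤k ia ea with windowIs i i+r≤k
  ... | _ , link p∈ q∈ _ , w = [ (λ { refl → p∈ }) , (λ { refl → q∈ }) ] (ends (subst (_∈ _) ea (WindowIs.to w ia)))
  ... | _ , star {as = as} p∈ _ _ , w with subst (_∈ _) ea (WindowIs.to w ia)
  ... | here refl = p∈
  ... | there p∈′ = contradiction p∈′ (inj₂∉elementLabels as)

  -- true: along the path; false: against it
  LinkO : Bool → ℕ → Connector → Connector → Set
  LinkO true  i p q = Link i p q
  LinkO false i p q = Link i q p

  -- The connector sits at `a = i + suc s`, the last position of window `i` and the first of window
  -- `a`. Both windows fit into the path, so `suc s` positions are visible on either side.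
  module Interior (i : ℕ) (le : i + suc s + r ≤ k) {p : Connector} (ep : label (i + suc s) ≡ inj₂ p) where

    private
      a = i + suc s
      a≡ : a ≡ suc (i + s)
      a≡ = +-suc i s
      i+r≤k : i + r ≤ k
      i+r≤k = ≤-trans (+-monoˡ-≤ r (m≤m+n i (suc s))) le
      i+r≡ : i + r ≡ suc a
      i+r≡ = +-suc i (suc s)
      1+i≤a : suc i ≤ a
      1+i≤a = ≤-trans (s≤s (m≤m+n i s)) (≤-reflexive (sym a≡))
      aInI : a inWindow i
      aInI = m≤m+n i (suc s) , ≤-reflexive (sym i+r≡)
      aInA : a inWindow a
      aInA = ≤-refl , m<m+n a (s≤s z≤n)
      valid-p : p ∈ connectors s I
      valid-p = connector-valid a le aInA ep
      M = elementLabels (before p ++ after p)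
      length-M : length M ≡ s + s
      length-M = trans (length-map _ (before p ++ after p)) (trans (length-++ (before p))
        (cong₂ _+_ (length-before s I valid-p) (length-after s I valid-p)))

      leftIn : ∀ {c} → c ∈ range (suc i) s → c inWindow i × c inWindow (suc i) × c < a
      leftIn c∈ = let i<c , c< = ∈-range⁻ c∈; c<a = <-≤-trans c< (≤-reflexive (sym a≡)) in
        (<⇒≤ i<c , <-trans c<a (proj₂ aInI)) ,
        (i<c , <-≤-trans c<a (≤-trans (n≤1+n a) (≤-trans (≤-reflexive (sym i+r≡)) (n≤1+n _)))) , c<a

      rightIn : ∀ {c} → c ∈ range (suc a) s → c inWindow a × c inWindow (i + s) × a < c
      rightIn {c} c∈ = let a<c , c< = ∈-range⁻ c∈ in
        (<⇒≤ a<c , <-≤-trans c< (≤-trans (≤-reflexive (sym (+-suc a s))) (+-monoʳ-≤ a (n≤1+n (suc s))))) ,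
        (≤-trans (≤-trans (+-monoʳ-≤ i (n≤1+n s)) (n≤1+n a)) a<c ,
         <-≤-trans c< (≤-reflexive (trans (cong (λ x → suc x + s) a≡) (sym (trans (+-suc (i + s) (suc s)) (cong suc (+-suc (i + s) s)))))))
        , a<c

      -- These positions share the two consecutive windows `i` and `suc i` with `a`, so `far-apart`
      -- excludes a connector.
      left-element : ∀ {c} → c ∈ range (suc i) s → ∃[ u ] label c ≡ inj₁ u
      left-element {c} c∈ with label c in ec
      ... | inj₁ u = u , refl
      ... | inj₂ q = let w , w′ , c<a = leftIn c∈ in ⊥-elim
        (far-apart i (≤-trans (+-monoˡ-≤ r 1+i≤a) le) aInI w
          (1+i≤a , ≤-trans (proj₂ aInI) (n≤1+n _)) w′ (>⇒≢ c<a) ep ec)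

      -- The mirror image, with the windows `i + s` and `a`, which are consecutive because `a` is
      -- `suc (i + s)`.
      right-element : ∀ {c} → c ∈ range (suc a) s → ∃[ u ] label c ≡ inj₁ u
      right-element {c} c∈ with label c in ec
      ... | inj₁ u = u , refl
      ... | inj₂ q = let w , w′ , a<c = rightIn c∈ in ⊥-elim
        (far-apart (i + s) (subst (λ x → x + r ≤ k) a≡ le)
          (+-monoʳ-≤ i (n≤1+n s) , ≤-trans (≤-reflexive (cong suc a≡)) (≤-trans (≤-reflexive (sym (trans (+-suc (i + s) 1) (cong suc (+-comm (i + s) 1))))) (+-monoʳ-≤ (i + s) (s≤s (s≤s z≤n)))))
          w′ (subst (λ x → a inWindow x) a≡ aInA) (subst (λ x → c inWindow x) a≡ w) (<⇒≢ a<c) ep ec)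

      left-near : ∀ {c} → c ∈ range (suc i) s → label c ∈ M
      left-near c∈ = near-elements i i+r≤k aInI (proj₁ (leftIn c∈)) ep (proj₂ (left-element c∈))

      right-near : ∀ {c} → c ∈ range (suc a) s → label c ∈ M
      right-near c∈ = near-elements a le aInA (proj₁ (rightIn c∈)) ep (proj₂ (right-element c∈))

      left<k : ∀ {c} → c ∈ range (suc i) s → c < k
      left<k c∈ = <-≤-trans (proj₂ (proj₁ (leftIn c∈))) i+r≤k

      right<k : ∀ {c} → c ∈ range (suc a) s → c < k
      right<k c∈ = <-≤-trans (proj₂ (proj₁ (rightIn c∈))) le

      b = a + suc s
      b≡ : b ≡ suc a + s
      b≡ = +-suc a s
      bInA : b inWindow a
      bInA = m≤m+n a (suc s) , ≤-reflexive (sym (+-suc a (suc s)))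

      iInI : i inWindow i
      iInI = ≤-refl , m<m+n i (s≤s z≤n)

      left≤ : suc i + s ≤ suc a
      left≤ = ≤-trans (≤-reflexive (sym a≡)) (n≤1+n a)

    private
      around : List ℕ
      around = range (suc i) s ++ range (suc a) s

      around<k : ∀ {c} → c ∈ around → c < k
      around<k c∈ = [ left<k , right<k ]′ (∈-++⁻ (range (suc i) s) c∈)

      around-near : ∀ {c} → c ∈ around → label c ∈ M
      around-near c∈ = [ left-near , right-near ]′ (∈-++⁻ (range (suc i) s) c∈)

      -- M has room only for the 2s elements around the connector.
      full : ∀ {x} → x < k → x ∉ around → label x ∉ M
      full {x} x<k fresh near = <⇒≱ (≤-refl {suc (s + s)}) (begin
        suc (s + s)          ≡⟨ cong suc (sym (length-ranges (suc i) s (suc a) s)) ⟩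
        length (x ∷ around)  ≤⟨ crowded (¬Any⇒All¬ around fresh ∷ ranges-unique (suc i) s (suc a) s left≤)
          (λ { (here refl) → x<k ; (there c∈) → around<k c∈ })
          (λ { (here refl) → near ; (there c∈) → around-near c∈ }) ⟩
        length M             ≡⟨ length-M ⟩
        s + s                ∎)
        where open ≤-Reasoning

    opaque
      -- An element at `b` would share a window with `p` and hence belong to `M`, whose places are
      -- all taken by the elements around `a`.
      next : ∃[ q ] label b ≡ inj₂ q
      next with label b in eb
      ... | inj₂ q = q , refl
      ... | inj₁ v = contradiction (near-elements a le aInA bInA ep eb) (full (<-≤-trans (proj₂ bInA) le) fresh)
        where
        fresh : b ∉ around
        fresh b∈ with ∈-++⁻ (range (suc i) s) b∈
        ... | inj₁ b∈l = <⇒≱ (proj₂ (proj₂ (leftIn b∈l))) (m≤m+n a (suc s))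
        ... | inj₂ b∈r = <⇒≢ (proj₂ (∈-range⁻ {suc a} b∈r)) b≡

    opaque
      previous : ∃[ q ] label i ≡ inj₂ q
      previous with label i in ei
      ... | inj₂ q = q , refl
      ... | inj₁ v = contradiction (near-elements i i+r≤k aInI iInI ep ei) (full (<-≤-trans (proj₂ iInI) i+r≤k) fresh)
        where
        fresh : i ∉ around
        fresh i∈ with ∈-++⁻ (range (suc i) s) i∈
        ... | inj₁ i∈l = <-irrefl refl (proj₁ (∈-range⁻ {suc i} i∈l))
        ... | inj₂ i∈r = <-asym 1+i≤a (proj₁ (∈-range⁻ {suc a} i∈r))

    private
      q = proj₁ next
      q′ = proj₁ previous

      in-block : ∀ {j x y c u} → Link j x y → c inWindow j → label c ≡ inj₁ u → label c ∈ elementLabels (after x)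
      in-block (_ , w , _) jc ec with subst (_∈ _) ec (WindowIs.to w jc)
      ... | there (there u∈) = subst (_∈ _) (sym ec) u∈

      -- The 2s elements around a connector do not fit into one block.
      one-block : (m : List Slot) → length m ≡ s →
        (∀ {c} → c ∈ range (suc i) s → label c ∈ elementLabels m) →
        (∀ {c} → c ∈ range (suc a) s → label c ∈ elementLabels m) → ⊥
      one-block m len okl okr = <⇒≱ (m<m+n s 1≤s) (begin
        s + s                     ≡⟨ sym (length-ranges (suc i) s (suc a) s) ⟩
        length around             ≤⟨ crowded (ranges-unique (suc i) s (suc a) s left≤) around<k
          (λ c∈ → [ okl , okr ]′ (∈-++⁻ (range (suc i) s) c∈)) ⟩
        length (elementLabels m)  ≡⟨ trans (length-map _ m) len ⟩
        s                         ∎)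
        where open ≤-Reasoning

    opaque
      -- If the path turned at `p`, both gaps around it would be filled from one block: from
      -- `after p` if `p` is the lower end of both links, from `before p` if it is the upper end of
      -- both.
      monotone : ∃[ o ] LinkO o a p q × LinkO o i q′ p
      monotone with two-connectors a le aInA bInA (<⇒≢ (m<m+n a (s≤s z≤n))) ep (proj₂ next)
                  | two-connectors i i+r≤k iInI aInI (<⇒≢ 1+i≤a) (proj₂ previous) ep
      ... | inj₁ l | inj₁ l′ = true , l , l′
      ... | inj₂ l | inj₂ l′ = false , l , l′
      ... | inj₁ l | inj₂ l′ = ⊥-elim (one-block (after p) (length-after s I valid-p)
        (λ c∈ → in-block l′ (proj₁ (leftIn c∈)) (proj₂ (left-element c∈)))
        (λ c∈ → in-block l (proj₁ (rightIn c∈)) (proj₂ (right-element c∈))))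
      ... | inj₂ l | inj₁ l′ = ⊥-elim (one-block (before p) (length-before s I valid-p)
        (λ c∈ → subst (λ m → _ ∈ elementLabels m) (Linked.after≡before (proj₁ l′))
          (in-block l′ (proj₁ (leftIn c∈)) (proj₂ (left-element c∈))))
        (λ c∈ → subst (λ m → _ ∈ elementLabels m) (Linked.after≡before (proj₁ l))
          (in-block l (proj₁ (rightIn c∈)) (proj₂ (right-element c∈)))))

  opaque
    neighbours : ∀ i → i + suc s + r ≤ k → ∀ {p} → label (i + suc s) ≡ inj₂ p →
      ∃[ o ] ∃[ q ] ∃[ q′ ] label (i + suc s + suc s) ≡ inj₂ q × label i ≡ inj₂ q′ ×
        LinkO o (i + suc s) p q × LinkO o i q′ p
    neighbours i le ep = let o , l , l′ = monotone in
      o , proj₁ next , proj₁ previous , proj₂ next , proj₂ previous , l , l′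
      where open Interior i le ep

-- Choosing one set per index

takeFirst : {A : Set} → List A → List A
takeFirst = take 1

length-takeFirst : ∀ {A : Set} (xs : List A) → length (takeFirst xs) ≤ 1
length-takeFirst []       = z≤n
length-takeFirst (x ∷ xs) = s≤s z≤n

takeFirst-nonempty : ∀ {A : Set} {x : A} {xs} → x ∈ xs → ∃[ y ] y ∈ takeFirst xs × y ∈ xs
takeFirst-nonempty {xs = y ∷ ys} _ = y , here refl , here refl

∈-takeFirst⁻ : ∀ {A : Set} {x : A} {xs} → x ∈ takeFirst xs → x ∈ xs
∈-takeFirst⁻ {xs = y ∷ ys} (here eq) = here eq

module _ {n t : ℕ} {G : List (List Bool)} (S : List Slot)
  (comparable : ∀ {a b} → a ∈ S → b ∈ S → a ≼ b ⊎ b ≼ a)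
  (valid : ∀ {a} → a ∈ S → index a < t × slotSet a ∈ G × T (member (slotSet a) (element a)))
  (onto : ∀ {u} → u < n → ∃[ a ] a ∈ S × element a ≡ u) where

  private
    indexed : ℕ → List Slot
    indexed i = filterᵇ (λ a → eqb nat (index a) i) S

    -- One representative per index suffices, because comparable slots with equal index carry the
    -- same set.
    chosen : ℕ → List (List Bool)
    chosen zero    = []
    chosen (suc i) = map slotSet (takeFirst (indexed i)) ++ chosen i

    length-chosen : ∀ i → length (chosen i) ≤ i
    length-chosen zero    = z≤n
    length-chosen (suc i) = ≤-trans (≤-reflexive (length-++ (map slotSet (takeFirst (indexed i)))))
      (+-mono-≤ (≤-trans (≤-reflexive (length-map slotSet (takeFirst (indexed i)))) (length-takeFirst (indexed i)))
                (length-chosen i))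

    chosen⊆G : ∀ i → chosen i ⊆ G
    chosen⊆G (suc i) A∈ with ∈-++⁻ (map slotSet (takeFirst (indexed i))) A∈
    ... | inj₂ A∈′ = chosen⊆G i A∈′
    ... | inj₁ A∈′ with ∈-map⁻ slotSet A∈′
    ... | a , a∈ , refl =
      proj₁ (proj₂ (valid (proj₁ (∈-filterᵇ⁻ (λ a → eqb nat (index a) i) {xs = S} (∈-takeFirst⁻ a∈)))))

    slotSet∈chosen : ∀ {a} → a ∈ S → ∀ i → index a < i → slotSet a ∈ chosen i
    slotSet∈chosen {a} a∈ (suc i) a<i with index a ≟ i
    ... | no  a≢i  = ∈-++⁺ʳ (map slotSet (takeFirst (indexed i)))
                       (slotSet∈chosen a∈ i (≤∧≢⇒< (≤-pred a<i) a≢i))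
    ... | yes refl with takeFirst-nonempty (∈-filterᵇ⁺ (λ b → eqb nat (index b) (index a)) a∈ (eqb-refl nat (index a)))
    ... | b , b∈first , b∈ with ∈-filterᵇ⁻ (λ b → eqb nat (index b) (index a)) {xs = S} b∈
    ... | b∈S , same = ∈-++⁺ˡ (subst (_∈ map slotSet (takeFirst (indexed (index a)))) set≡ (∈-map⁺ slotSet b∈first))
      where
      set≡ : slotSet b ≡ slotSet a
      set≡ = [ (λ b≼a → ≼⇒same-set {b} {a} b≼a (eqb⇒≡ nat same))
             , (λ a≼b → sym (≼⇒same-set {a} {b} a≼b (sym (eqb⇒≡ nat same)))) ]′ (comparable b∈S a∈)

  coverFromSlots : CoverBy n G t
  coverFromSlots = record
    { sets        = chosen t
    ; length-sets = length-chosen t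
    ; sets⊆G      = chosen⊆G t
    ; covered     = λ u<n → let a , a∈ , eq = onto u<n ; i< , _ , m = valid a∈ in
        slotSet a , slotSet∈chosen a∈ t i< , subst (T ∘ member (slotSet a)) eq m
    }

-- Global structure of a tight path

module Chain (s : ℕ) (I : El instanceTy) (1≤s : 1 ≤ s) (B : ℕ) (3≤B : 3 ≤ B)
  (real≡ : realElements s I ≡ s * B) (n≤ : proj₁ I ≤ s * B)
  (P : LabelPath (2 + s) (labels s I) (Candidate s I) (suc s * suc B)) where

  private
    r = 2 + s
    k = suc s * suc B
    open LabelPath P

    pos : ℕ → ℕ → ℕ
    pos c zero    = c
    pos c (suc j) = pos c j + suc s

    pos-≡ : ∀ c j → pos c j ≡ c + suc s * j
    pos-≡ c zero    = sym (trans (cong (c +_) (*-zeroʳ (suc s))) (+-identityʳ c))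
    pos-≡ c (suc j) = trans (cong (_+ suc s) (pos-≡ c j)) (trans (+-assoc c (suc s * j) (suc s))
      (cong (c +_) (trans (+-comm (suc s * j) (suc s)) (sym (*-suc (suc s) j)))))

    fits : ∀ {c j} → c ≤ s → j < B → pos c j + r ≤ k
    fits {c} {j} c≤s j<B = begin
      pos c j + r                     ≡⟨ cong (_+ r) (pos-≡ c j) ⟩
      c + suc s * j + r               ≤⟨ +-monoˡ-≤ r (+-monoˡ-≤ (suc s * j) c≤s) ⟩
      s + suc s * j + r               ≡⟨ +-suc (s + suc s * j) (suc s) ⟩
      suc s + suc s * j + suc s       ≡⟨ cong (_+ suc s) (*-suc (suc s) j) ⟨
      suc s * suc j + suc s           ≡⟨ +-comm (suc s * suc j) (suc s) ⟩
      suc s + suc s * suc j           ≡⟨ *-suc (suc s) (suc j) ⟨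
      suc s * suc (suc j)             ≤⟨ *-monoʳ-≤ (suc s) (s≤s j<B) ⟩
      k ∎
      where open ≤-Reasoning

    -- The residue class of the positions of the connectors.
    opaque
      -- The search begins at `pos 0 1` rather than at 0, so that the connector found has a full
      -- window to its left.
      start : ∃[ c ] c ≤ s × ∃[ p ] label (pos c 1) ≡ inj₂ p
      start = from-window (connector-in-window s I 1≤s P (pos 0 1) (fits z≤n (≤-trans (s≤s (s≤s z≤n)) 3≤B)))
        where
        from-window : ∃[ a ] ∃[ p ] (pos 0 1 ≤ a × a < pos 0 1 + r) × label a ≡ inj₂ p →
                      ∃[ c ] c ≤ s × ∃[ p ] label (pos c 1) ≡ inj₂ p
        from-window (a , p , (le , lt) , ea) with a ≟ pos 0 2
        -- A window has one position more than there are residue classes. A connector in its last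
        -- position is exchanged for the preceding one, which sits in the first position; this needs
        -- room for a third block.
        ... | yes refl = let _ , _ , q′ , _ , eq , _ = neighbours s I 1≤s P (pos 0 1) (fits {0} {2} z≤n 3≤B) ea in
          0 , z≤n , q′ , eq
        ... | no a≢ = a ∸ suc s , ≤-pred c< , p , trans (cong label (m∸n+n≡m le)) ea
          where
          a<′ : a < suc s + suc s
          a<′ = ≤∧≢⇒< (≤-pred (≤-trans lt (≤-reflexive (+-suc (suc s) (suc s))))) a≢
          c< : a ∸ suc s < suc s
          c< = +-cancelˡ-< (suc s) (a ∸ suc s) (suc s) (≤-trans (s≤s (≤-reflexive (m+[n∸m]≡n le))) a<′)

    c = proj₁ start
    c≤s = proj₁ (proj₂ start)

    -- A total inverse of `inj₂`; the default stands for positions without a connector, which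
    -- `IsLink` rules out.
    connector : Label → Connector
    connector (inj₁ _) = 0 , [] , []
    connector (inj₂ p) = p

    at : ℕ → Connector
    at j = connector (label (pos c j))

    IsLink : Bool → ℕ → Set
    IsLink o j = label (pos c j) ≡ inj₂ (at j) × label (pos c (suc j)) ≡ inj₂ (at (suc j)) ×
                 LinkO s I 1≤s P o (pos c j) (at j) (at (suc j))

    at≡ : ∀ j {p} → label (pos c j) ≡ inj₂ p → at j ≡ p
    at≡ j eq = cong connector eq

    label≡at : ∀ j {p} → label (pos c j) ≡ inj₂ p → label (pos c j) ≡ inj₂ (at j)
    label≡at j eq = trans eq (cong inj₂ (sym (at≡ j eq)))

    opaque
      around : ∀ j → suc j < B → label (pos c (suc j)) ≡ inj₂ (at (suc j)) →
               ∃[ o ] IsLink o (suc j) × IsLink o j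
      around j j<B ep = let o , q , q′ , eq , eq′ , l , l′ = neighbours s I 1≤s P (pos c j) (fits c≤s j<B) ep in
        o ,
        (ep , label≡at (2 + j) eq , subst (LinkO s I 1≤s P o (pos c (suc j)) (at (suc j))) (sym (at≡ (2 + j) eq)) l) ,
        (label≡at j eq′ , ep , subst (λ x → LinkO s I 1≤s P o (pos c j) x (at (suc j))) (sym (at≡ j eq′)) l′)

    same-orientation : ∀ j {o o′} → IsLink o j → IsLink o′ j → o ≡ o′
    same-orientation j {true}  {true}  _ _ = refl
    same-orientation j {false} {false} _ _ = refl
    same-orientation j {true}  {false} (_ , _ , l , _) (_ , _ , l′ , _) = ⊥-elim (Linked-asym s I 1≤s P l l′)
    same-orientation j {false} {true}  (_ , _ , l , _) (_ , _ , l′ , _) = ⊥-elim (Linked-asym s I 1≤s P l l′)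

    opaque
      orientation : ∃[ o ] IsLink o 0
      orientation = let o , _ , l = around 0 (≤-trans (s≤s (s≤s z≤n)) 3≤B) (label≡at 1 (proj₂ (proj₂ (proj₂ start)))) in o , l

    o = proj₁ orientation

    opaque
      -- Adjacent links meet in a connector, where `around` gives them a common orientation; so the
      -- orientation of the first link spreads along the path.
      links : ∀ j → j < B → IsLink o j
      links zero    _   = proj₂ orientation
      links (suc j) j<B = let l = links j (<-trans (n<1+n j) j<B)
                              o′ , l₁ , l₀ = around j j<B (proj₁ (proj₂ l)) in
        subst (λ o → IsLink o (suc j)) (sym (same-orientation j l l₀)) l₁

    -- The upper end of the j-th link; the elements of the gap are those before it.
    upper : Bool → ℕ → Connector
    upper true  j = at (suc j)
    upper false j = at j

    block : ℕ → List Slot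
    block j = before (upper o j)

    upper-valid : ∀ o j → IsLink o j → upper o j ∈ connectors s I
    upper-valid true  j (_ , _ , _ , _ , _ , q∈) = q∈
    upper-valid false j (_ , _ , _ , _ , _ , q∈) = q∈

    upper-comparable : ∀ o j → IsLink o j → ∀ {a b} → a ∈ before (upper o j) → b ∈ before (upper o j) → a ≼ b ⊎ b ≼ a
    upper-comparable true  j (_ , _ , l , _) = Linked.comparable l
    upper-comparable false j (_ , _ , l , _) = Linked.comparable l

    -- A path traversed against the levels meets the blocks in descending order.
    Directed : Bool → Slot → Slot → Set
    Directed true  a b = a ≼ b
    Directed false a b = b ≼ a

    Directed-trans : ∀ o {a b d} → Directed o a b → Directed o b d → Directed o a d
    Directed-trans true  {a} {b} {d} = ≼-trans {a} {b} {d}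
    Directed-trans false {a} {b} {d} p q = ≼-trans {d} {b} {a} q p

    Directed⇒comparable : ∀ o {a b} → Directed o a b → a ≼ b ⊎ b ≼ a
    Directed⇒comparable true  = inj₁
    Directed⇒comparable false = inj₂

    -- `Linked.ordered` compares the blocks before the two ends of one link. Forwards the relevant
    -- link is the later one, backwards the earlier one.
    upper-ordered : ∀ o j → IsLink o j → IsLink o (suc j) →
      ∀ {a b} → a ∈ before (upper o j) → b ∈ before (upper o (suc j)) → Directed o a b
    upper-ordered true  j _ (_ , _ , l , _) a∈ b∈ = Linked.ordered l a∈ b∈
    upper-ordered false j (_ , _ , l , _) _ a∈ b∈ = Linked.ordered l b∈ a∈

    length-block : ∀ {j} → j < B → length (block j) ≡ s
    length-block {j} j<B = length-before s I (upper-valid o j (links j j<B))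

    block-nonempty : ∀ {j} → j < B → ∃[ a ] a ∈ block j
    block-nonempty {j} j<B with block j | length-block j<B
    ... | []    | eq = contradiction 1≤s (subst (λ x → ¬ 1 ≤ x) eq λ ())
    ... | a ∷ _ | _  = a , here refl

    -- Transitivity passes through some slot of every block in between; these blocks are nonempty
    -- because `s` is positive.
    ordered : ∀ j d → suc d + j < B → ∀ {a b} → a ∈ block j → b ∈ block (suc d + j) → Directed o a b
    ordered j zero    lt a∈ b∈ = upper-ordered o j (links j (<-trans (n<1+n j) lt)) (links (suc j) lt) a∈ b∈
    ordered j (suc d) lt {a} {b} a∈ b∈ =
      let lt′ = <-trans (n<1+n (suc d + j)) lt
          m , m∈ = block-nonempty lt′ in
      Directed-trans o {a} {m} {b} (ordered j d lt′ a∈ m∈)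
        (upper-ordered o (suc d + j) (links (suc d + j) lt′) (links (suc (suc d + j)) lt) m∈ b∈)

    ordered-< : ∀ {i j} → i < j → j < B → ∀ {a b} → a ∈ block i → b ∈ block j → Directed o a b
    ordered-< {i} {j} i<j j<B {a} {b} a∈ b∈ =
      ordered i (j ∸ suc i) (subst (_< B) (sym eq) j<B) a∈ (subst (λ x → b ∈ block x) (sym eq) b∈)
      where
      eq : suc (j ∸ suc i) + i ≡ j
      eq = trans (sym (+-suc (j ∸ suc i) i)) (m∸n+n≡m i<j)

    comparable : ∀ {i j} → i < B → j < B → ∀ {a b} → a ∈ block i → b ∈ block j → a ≼ b ⊎ b ≼ a
    comparable {i} {j} i<B j<B {a} {b} a∈ b∈ with <-cmp i j
    ... | tri< i<j _ _  = Directed⇒comparable o {a} {b} (ordered-< i<j j<B a∈ b∈)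
    ... | tri≈ _ refl _ = upper-comparable o i (links i i<B) a∈ b∈
    ... | tri> _ _ j<i  = swap (Directed⇒comparable o {b} {a} (ordered-< j<i i<B b∈ a∈))

    -- The connectors of the link edge already sit at its two end positions, so by injectivity a
    -- position in between carries an element of the block.
    gap-labels : ∀ o j → j < B → IsLink o j → ∀ {d} → d ∈ range (suc (pos c j)) s →
                 label d ∈ elementLabels (before (upper o j))
    gap-labels o j j<B (e₁ , e₂ , l) {d} d∈ = go o l
      where
      j<d = proj₁ (∈-range⁻ {suc (pos c j)} {s} d∈)
      d<′ : d < pos c (suc j)
      d<′ = ≤-trans (proj₂ (∈-range⁻ {suc (pos c j)} {s} d∈)) (≤-reflexive (sym (+-suc (pos c j) s)))
      end<k : pos c (suc j) < k
      end<k = ≤-trans (≤-reflexive (sym (+-suc (pos c j) (suc s)))) (fits c≤s j<B)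
      inside : ∀ {p q} → Link s I 1≤s P (pos c j) p q → label d ∈ linkEdge p q
      inside (_ , w , _) = WindowIs.to w (<⇒≤ j<d , <-trans d<′ (≤-reflexive (sym (+-suc (pos c j) (suc s)))))
      not₁ : label d ≢ inj₂ (at j)
      not₁ eq = >⇒≢ j<d (injective (<-trans d<′ end<k) (<-trans j<d (<-trans d<′ end<k)) (trans eq (sym e₁)))
      not₂ : label d ≢ inj₂ (at (suc j))
      not₂ eq = <⇒≢ d<′ (injective (<-trans d<′ end<k) end<k (trans eq (sym e₂)))
      go : ∀ o → LinkO s I 1≤s P o (pos c j) (at j) (at (suc j)) → label d ∈ elementLabels (before (upper o j))
      go true l with inside l
      ... | here eq          = contradiction eq not₁
      ... | there (here eq)  = contradiction eq not₂
      ... | there (there d∈) = subst (λ m → _ ∈ elementLabels m) (Linked.after≡before (proj₁ l)) d∈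
      go false l with inside l
      ... | here eq          = contradiction eq not₂
      ... | there (here eq)  = contradiction eq not₁
      ... | there (there d∈) = subst (λ m → _ ∈ elementLabels m) (Linked.after≡before (proj₁ l)) d∈

    slotsUpTo : ℕ → List Slot
    slotsUpTo zero    = []
    slotsUpTo (suc j) = block j ++ slotsUpTo j

    gaps : ℕ → List ℕ
    gaps zero    = []
    gaps (suc j) = range (suc (pos c j)) s ++ gaps j

    ∈-slotsUpTo⁻ : ∀ i {a} → a ∈ slotsUpTo i → ∃[ j ] j < i × a ∈ block j
    ∈-slotsUpTo⁻ (suc i) a∈ with ∈-++⁻ (block i) a∈
    ... | inj₁ a∈′ = i , ≤-refl , a∈′
    ... | inj₂ a∈′ = let j , j<i , a∈″ = ∈-slotsUpTo⁻ i a∈′ in j , ≤-trans j<i (n≤1+n i) , a∈″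

    gaps-below : ∀ i {d} → d ∈ gaps i → d < pos c i
    gaps-below (suc i) {d} d∈ with ∈-++⁻ (range (suc (pos c i)) s) d∈
    ... | inj₁ d∈′ = ≤-trans (proj₂ (∈-range⁻ {suc (pos c i)} {s} d∈′)) (≤-reflexive (sym (+-suc (pos c i) s)))
    ... | inj₂ d∈′ = ≤-trans (gaps-below i d∈′) (m≤m+n (pos c i) (suc s))

    gaps-unique : ∀ i → Unique (gaps i)
    gaps-unique zero    = []
    gaps-unique (suc i) = Unique.++⁺ (range-unique (suc (pos c i)) s) (gaps-unique i)
      λ (d∈ , d∈′) → <-asym (gaps-below i d∈′) (proj₁ (∈-range⁻ {suc (pos c i)} {s} d∈))

    length-gaps : ∀ i → length (gaps i) ≡ i * s
    length-gaps zero    = refl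
    length-gaps (suc i) = trans (length-++ (range (suc (pos c i)) s))
      (cong₂ _+_ (length-applyUpTo (suc (pos c i) +_) s) (length-gaps i))

    gaps-labels : ∀ i → i ≤ B → ∀ {d} → d ∈ gaps i → label d ∈ elementLabels (slotsUpTo i)
    gaps-labels (suc i) i<B {d} d∈ with ∈-++⁻ (range (suc (pos c i)) s) d∈
    ... | inj₁ d∈′ = elementLabels-mono ∈-++⁺ˡ (gap-labels o i i<B (links i i<B) d∈′)
    ... | inj₂ d∈′ = elementLabels-mono (∈-++⁺ʳ (block i)) (gaps-labels i (<⇒≤ i<B) d∈′)

    S = slotsUpTo B

    S-valid : ∀ {a} → a ∈ S → ValidSlot s I a
    S-valid a∈ = let j , j<B , a∈′ = ∈-slotsUpTo⁻ B a∈ in before-valid s I (upper-valid o j (links j j<B)) a∈′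

    pos-B<k : pos c B ≤ k
    pos-B<k = ≤-trans (≤-reflexive (pos-≡ c B)) (≤-trans (+-monoˡ-≤ (suc s * B) (≤-trans c≤s (n≤1+n s)))
      (≤-reflexive (sym (*-suc (suc s) B))))

    -- The gap positions carry s B distinct labels of padded elements, and there are only s B of
    -- these, so none is missing. Tail elements do not interfere, since the gaps are read from
    -- `before`.
    onto : ∀ {u} → u < proj₁ I → ∃[ a ] a ∈ S × element a ≡ u
    onto {u} u<n = inj₁∈elementLabels S (gap⊆S (all-elements (∈-map⁺ inj₁ (∈-downFrom⁺ (<-≤-trans u<n n≤)))))
      where
      W = map label (gaps B)
      gap<k : ∀ {d} → d ∈ gaps B → d < k
      gap<k d∈ = <-≤-trans (gaps-below B d∈) pos-B<k
      gap⊆S : W ⊆ elementLabels S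
      gap⊆S v∈ = let d , d∈ , eq = ∈-map⁻ label v∈ in subst (_∈ elementLabels S) (sym eq) (gaps-labels B ≤-refl d∈)
      W⊆ : W ⊆ map inj₁ (downFrom (s * B))
      W⊆ v∈ with ∈-map⁻ (λ a → inj₁ (element a)) (gap⊆S v∈)
      ... | a , a∈ , refl = ∈-map⁺ inj₁ (∈-downFrom⁺ (subst (element a <_) real≡ (proj₁ (S-valid a∈))))
      all-elements : map inj₁ (downFrom (s * B)) ⊆ W
      all-elements = unique-⊆⇒⊇ (dec labelTy)
        (map-unique (λ d∈ d∈′ → injective (gap<k d∈) (gap<k d∈′)) (gaps-unique B)) W⊆
        (≤-reflexive (trans (trans (length-map inj₁ (downFrom (s * B))) (length-downFrom (s * B)))
          (sym (trans (length-map label (gaps B)) (trans (length-gaps B) (*-comm B s))))))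

  cover : CoverBy (proj₁ I) (proj₁ (proj₂ I)) (proj₂ (proj₂ I))
  cover = coverFromSlots S
    (λ a∈ b∈ → let i , i<B , a∈′ = ∈-slotsUpTo⁻ B a∈ ; j , j<B , b∈′ = ∈-slotsUpTo⁻ B b∈ in
       comparable i<B j<B a∈′ b∈′)
    (λ a∈ → let _ , i<t , A∈G , m = S-valid a∈ in i<t , A∈G , m)
    onto

-- From covers to tight paths

-- Each element goes to the first set of the list that contains it, so the slots come out sorted by
-- index; elements in no set are dropped.
distribute : List (List Bool) → ℕ → List ℕ → List Slot
distribute []       i us = []
distribute (A ∷ As) i us = map (λ u → u , i , A) (filterᵇ (member A) us)
                    ++ distribute As (suc i) (filterᵇ (not ∘ member A) us)

not-T : ∀ {b} → T (not b) → ¬ T b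
not-T {false} _ ()

¬T-not : ∀ {b} → ¬ T b → T (not b)
¬T-not {false} _  = _
¬T-not {true}  ¬t = ¬t _

distribute-onto : ∀ As i us {u} → u ∈ us → ∀ {A} → A ∈ As → T (member A u) → ∃[ a ] a ∈ distribute As i us × element a ≡ u
distribute-onto (A ∷ As) i us {u} u∈ {A′} A′∈ m with T? (member A u)
... | yes mA = (u , i , A) , ∈-++⁺ˡ (∈-map⁺ (λ u → u , i , A) (∈-filterᵇ⁺ (member A) u∈ mA)) , refl
... | no ¬mA with A′∈
... | here refl   = contradiction m ¬mA
... | there A′∈As =
  let a , a∈ , eq = distribute-onto As (suc i) _ (∈-filterᵇ⁺ (not ∘ member A) u∈ (¬T-not ¬mA)) A′∈As m in
  a , ∈-++⁺ʳ (map (λ u → u , i , A) (filterᵇ (member A) us)) a∈ , eq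

distribute-valid : ∀ As i us {a} → a ∈ distribute As i us →
  i ≤ index a × index a < i + length As × slotSet a ∈ As × T (member (slotSet a) (element a)) × element a ∈ us
distribute-valid (A ∷ As) i us a∈ with ∈-++⁻ (map (λ u → u , i , A) (filterᵇ (member A) us)) a∈
... | inj₁ a∈₁ with ∈-map⁻ (λ u → u , i , A) a∈₁
... | u , u∈ , refl = let u∈us , m = ∈-filterᵇ⁻ (member A) {xs = us} u∈ in
  ≤-refl , m<m+n i (s≤s z≤n) , here refl , m , u∈us
distribute-valid (A ∷ As) i us a∈ | inj₂ a∈₂ with distribute-valid As (suc i) (filterᵇ (not ∘ member A) us) a∈₂
... | i< , <len , A∈ , m , u∈ = <⇒≤ i< , ≤-trans <len (≤-reflexive (sym (+-suc i (length As)))) , there A∈ , m ,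
  proj₁ (∈-filterᵇ⁻ (not ∘ member A) {xs = us} u∈)

distribute-unique : ∀ As i us → Unique us → Unique (map element (distribute As i us))
distribute-unique []       i us u! = []
distribute-unique (A ∷ As) i us u! = subst Unique (sym eq)
  (Unique.++⁺ (Unique.filter⁺ (T? ∘ member A) u!)
    (distribute-unique As (suc i) rest (Unique.filter⁺ (T? ∘ not ∘ member A) u!)) disjoint)
  where
  rest = filterᵇ (not ∘ member A) us
  eq : map element (distribute (A ∷ As) i us) ≡ filterᵇ (member A) us ++ map element (distribute As (suc i) rest)
  eq = trans (map-++ element (map (λ u → u , i , A) (filterᵇ (member A) us)) _)
    (cong (_++ map element (distribute As (suc i) rest)) (trans (sym (map-∘ (filterᵇ (member A) us))) (map-id _)))
  disjoint : ∀ {u} → u ∈ filterᵇ (member A) us × u ∈ map element (distribute As (suc i) rest) → ⊥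
  disjoint (u∈ , u∈′) with ∈-map⁻ element u∈′
  ... | a , a∈ , refl = not-T (proj₂ (∈-filterᵇ⁻ (not ∘ member A) {xs = us}
      (proj₂ (proj₂ (proj₂ (proj₂ (distribute-valid As (suc i) rest a∈)))))))
    (proj₂ (∈-filterᵇ⁻ (member A) {xs = us} u∈))

distribute-sorted : ∀ As i us → AllPairs _≼_ (distribute As i us)
distribute-sorted []       i us = []
distribute-sorted (A ∷ As) i us = AllPairs.++⁺ (same (filterᵇ (member A) us))
  (distribute-sorted As (suc i) (filterᵇ (not ∘ member A) us))
  (All.tabulate λ a∈ → All.tabulate λ {b} b∈ → cross a∈ b∈)
  where
  same : ∀ vs → AllPairs _≼_ (map (λ u → u , i , A) vs)
  same []       = []
  same (v ∷ vs) = All.tabulate (λ {b} b∈ → first b∈) ∷ same vs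
    where
    first : ∀ {b} → b ∈ map (λ u → u , i , A) vs → (v , i , A) ≼ b
    first b∈ with ∈-map⁻ (λ u → u , i , A) b∈
    ... | _ , _ , refl = inj₂ (refl , refl)
  cross : ∀ {a b} → a ∈ map (λ u → u , i , A) (filterᵇ (member A) us) →
          b ∈ distribute As (suc i) (filterᵇ (not ∘ member A) us) → a ≼ b
  cross a∈ b∈ with ∈-map⁻ (λ u → u , i , A) a∈
  ... | _ , _ , refl = inj₁ (proj₁ (distribute-valid As (suc i) _ b∈))

AllPairs-nth : ∀ {A : Set} {R : A → A → Set} a {xs} → AllPairs R xs → ∀ {i j} → i < j → j < length xs →
               R (nth a xs i) (nth a xs j)
AllPairs-nth a {x ∷ xs} (px ∷ pxs) {zero}  {suc j} _         (s≤s j<) = All.lookup px (nth-∈ a xs j<)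
AllPairs-nth a {x ∷ xs} (px ∷ pxs) {suc i} {suc j} (s≤s i<j) (s≤s j<) = AllPairs-nth a pxs i<j j<

nth-map : ∀ {A B : Set} (f : A → B) a xs i → nth (f a) (map f xs) i ≡ f (nth a xs i)
nth-map f a []       i       = refl
nth-map f a (x ∷ xs) zero    = refl
nth-map f a (x ∷ xs) (suc i) = nth-map f a xs i

-- `slot` continues beyond `N` with the tail slots, so that one formula describes all blocks, the
-- last one included.
record SlotOrder (s : ℕ) (I : El instanceTy) (N : ℕ) : Set where
  field
    slot      : ℕ → Slot
    valid     : ∀ {i} → i < N → ValidSlot s I (slot i)
    sorted    : ∀ {i j} → i ≤ j → j < N → slot i ≼ slot j
    tail-slot : ∀ {i} → N ≤ i → slot i ≡ (i , 0 , [])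
    injective : ∀ {i j} → element (slot i) ≡ element (slot j) → i ≡ j

slotOrder : ∀ s n G t → 1 ≤ n → (∀ {A} → A ∈ G → length A ≡ n) → CoverBy n G t →
            SlotOrder s (n , G , t) (realElements s (n , G , t))
slotOrder s n G t 1≤n lengths C = record
  { slot      = slot
  ; valid     = slot-valid
  ; sorted    = slot-sorted
  ; tail-slot = slot-tail
  ; injective = slot-injective
  }
  where
  open CoverBy C
  N = realElements s (n , G , t)
  us = downFrom N
  Σs = distribute sets 0 us
  d₀ : Slot
  d₀ = 0 , 0 , []
  member-padding : ∀ A u → length A ≤ u → T (member A u)
  member-padding []      zero    _        = _
  member-padding []      (suc u) _        = _
  member-padding (_ ∷ A) (suc u) (s≤s le) = member-padding A u le
  cover-all : ∀ u → ∃[ A ] A ∈ sets × T (member A u)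
  cover-all u with u <? n
  ... | yes u<n = covered u<n
  -- A padding element needs some set to be assigned to; the set covering element 0 serves, which is
  -- why the ground set must be nonempty.
  ... | no  u≮n = let A , A∈ , _ = covered 1≤n in
    A , A∈ , member-padding A u (≤-trans (≤-reflexive (lengths (sets⊆G A∈))) (≮⇒≥ u≮n))
  elements-unique : Unique (map element Σs)
  elements-unique = distribute-unique sets 0 us (Unique.downFrom⁺ N)
  -- Two duplicate-free lists with the same entries: each element of the padded ground set receives
  -- exactly one slot.
  length-Σs : length Σs ≡ N
  length-Σs = trans (sym (length-map element Σs)) (≤-antisym
    (≤-trans (unique-⊆⇒length≤ elements-unique (λ u∈ → let a , a∈ , eq = ∈-map⁻ element u∈ in
        subst (_∈ us) (sym eq) (proj₂ (proj₂ (proj₂ (proj₂ (distribute-valid sets 0 us a∈)))))))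
      (≤-reflexive (length-downFrom N)))
    (≤-trans (≤-reflexive (sym (length-downFrom N)))
      (unique-⊆⇒length≤ (Unique.downFrom⁺ N) λ {u} u∈ → let A , A∈ , m = cover-all u ; a , a∈ , eq = distribute-onto sets 0 us u∈ A∈ m in
        subst (_∈ map element Σs) eq (∈-map⁺ element a∈))))
  <Σs : ∀ {i} → i < N → i < length Σs
  <Σs i<N = <-≤-trans i<N (≤-reflexive (sym length-Σs))
  slot : ℕ → Slot
  slot i with i <? N
  ... | yes _ = nth d₀ Σs i
  ... | no  _ = i , 0 , []
  slot-nth : ∀ {i} → i < N → slot i ≡ nth d₀ Σs i
  slot-nth {i} i<N with i <? N
  ... | yes _   = refl
  ... | no  i≮N = contradiction i<N i≮N
  slot-tail : ∀ {i} → N ≤ i → slot i ≡ (i , 0 , [])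
  slot-tail {i} N≤i with i <? N
  ... | yes i<N = contradiction N≤i (<⇒≱ i<N)
  ... | no  _   = refl
  slot-valid : ∀ {i} → i < N → ValidSlot s (n , G , t) (slot i)
  slot-valid {i} i<N rewrite slot-nth i<N =
    let _ , i<t , A∈ , m , u∈ = distribute-valid sets 0 us (nth-∈ d₀ Σs (<Σs i<N)) in
    ∈-downFrom⁻ u∈ , <-≤-trans i<t length-sets , sets⊆G A∈ , m
  slot-sorted : ∀ {i j} → i ≤ j → j < N → slot i ≼ slot j
  slot-sorted {i} {j} i≤j j<N rewrite slot-nth (≤-<-trans i≤j j<N) | slot-nth j<N with m≤n⇒m<n∨m≡n i≤j
  ... | inj₁ i<j  = AllPairs-nth d₀ (distribute-sorted sets 0 us) i<j (<Σs j<N)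
  ... | inj₂ refl = inj₂ (refl , refl)
  slot-injective : ∀ {i j} → element (slot i) ≡ element (slot j) → i ≡ j
  slot-injective {i} {j} eq = go (i <? N) (j <? N)
    where
    go : Dec (i < N) → Dec (j < N) → i ≡ j
    go (yes i<N) (yes j<N) = nth-injective 0 elements-unique
      (<-≤-trans (<Σs i<N) (≤-reflexive (sym (length-map element Σs))))
      (<-≤-trans (<Σs j<N) (≤-reflexive (sym (length-map element Σs))))
      (trans (nth-map element d₀ Σs i) (trans (trans (cong element (sym (slot-nth i<N))) (trans eq (cong element (slot-nth j<N))))
        (sym (nth-map element d₀ Σs j))))
    go (no i≮N) (no j≮N) = trans (cong element (sym (slot-tail (≮⇒≥ i≮N)))) (trans eq (cong element (slot-tail (≮⇒≥ j≮N))))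
    go (yes i<N) (no j≮N) = contradiction (subst (_< N) (trans eq (cong element (slot-tail (≮⇒≥ j≮N)))) (proj₁ (slot-valid i<N))) j≮N
    go (no i≮N) (yes j<N) = contradiction (subst (_< N) (trans (sym eq) (cong element (slot-tail (≮⇒≥ i≮N)))) (proj₁ (slot-valid j<N))) i≮N

quotient-remainder : ∀ n .{{_ : NonZero n}} j {d} → d < n → (d + j * n) / n ≡ j × (d + j * n) % n ≡ d
quotient-remainder n j {d} d<n =
  trans (+-distrib-/-∣ʳ d (divides-refl j)) (cong₂ _+_ (m<n⇒m/n≡0 d<n) (m*n/n≡m j n)) ,
  trans ([m+kn]%n≡m%n d j n) (m<n⇒m%n≡m d<n)

-- The tight path of a cover

module Path (s : ℕ) (I : El instanceTy) (1≤s : 1 ≤ s) (B : ℕ) (1≤B : 1 ≤ B) (blocks≡ : blocks s (proj₁ I) ≡ B)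
  (real≡ : realElements s I ≡ s * B) (O : SlotOrder s I (s * B)) where

  private
    open SlotOrder O renaming (valid to slot-valid; injective to slot-injective)

    r = 2 + s
    k = suc s * suc B

    block : ℕ → List Slot
    block j = applyUpTo (λ d → slot (s * j + d)) s

    ∈-block⁺ : ∀ j {d} → d < s → slot (s * j + d) ∈ block j
    ∈-block⁺ j = ∈-applyUpTo⁺ (λ d → slot (s * j + d))

    ∈-block⁻ : ∀ j {a} → a ∈ block j → ∃[ d ] d < s × a ≡ slot (s * j + d)
    ∈-block⁻ j = ∈-applyUpTo⁻ (λ d → slot (s * j + d))

    -- What is before the first connector is irrelevant, but must not exceed what follows.
    initial-block : List Slot
    initial-block = applyUpTo (λ _ → slot 0) s

    connector : ℕ → Connector
    connector zero    = zero , initial-block , block zero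
    connector (suc j) = suc j , block j , block (suc j)

    level≡ : ∀ j → level (connector j) ≡ j
    level≡ zero    = refl
    level≡ (suc j) = refl

    after≡ : ∀ j → after (connector j) ≡ block j
    after≡ zero    = refl
    after≡ (suc j) = refl

    inBlock< : ∀ {j d} → j < B → d < s → s * j + d < s * B
    inBlock< {j} {d} j<B d<s = <-≤-trans (+-monoʳ-< (s * j) d<s) (≤-trans
      (≤-reflexive (trans (+-comm (s * j) s) (sym (*-suc s j)))) (*-monoʳ-≤ s j<B))

    0<real : 0 < s * B
    0<real = *-mono-≤ 1≤s 1≤B

    block-valid : ∀ {j} → j < B → ∀ {a} → a ∈ block j → ValidSlot s I a
    block-valid {j} j<B a∈ with ∈-block⁻ j a∈
    ... | d , d<s , refl = slot-valid (inBlock< j<B d<s)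

    block∈ : ∀ {j} → j < B → block j ∈ slotBlocks s I
    block∈ {j} j<B = ∈-slotBlocks⁺ s I (block j) (length-applyUpTo _ s) (block-valid j<B)

    applyUpTo-cong : ∀ {A : Set} (f g : ℕ → A) m → (∀ d → f d ≡ g d) → applyUpTo f m ≡ applyUpTo g m
    applyUpTo-cong f g zero    ok = refl
    applyUpTo-cong f g (suc m) ok = cong₂ _∷_ (ok 0) (applyUpTo-cong (f ∘ suc) (g ∘ suc) m (ok ∘ suc))

    last-block : block B ≡ tailBlock s I
    last-block = trans (applyUpTo-cong _ _ s (λ d → trans (tail-slot (m≤m+n (s * B) d))
        (cong (λ x → x + d , 0 , []) (sym real≡))))
      (sym (map-upTo (λ d → realElements s I + d , 0 , []) s))

    connector∈ : ∀ {j} → j ≤ B → connector j ∈ connectors s I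
    connector∈ {j} j≤B = ∈-connectors⁺ s I (connector j)
      (≤-trans (≤-reflexive (level≡ j)) (≤-trans j≤B (≤-reflexive (sym blocks≡))) , before∈ j j≤B ,
       subst (λ y → y ≡ tailBlock s I ⊎ y ∈ slotBlocks s I) (sym (after≡ j)) (after∈ (m≤n⇒m<n∨m≡n j≤B)))
      where
      before∈ : ∀ j → j ≤ B → before (connector j) ∈ slotBlocks s I
      before∈ zero    _   = ∈-slotBlocks⁺ s I initial-block (length-applyUpTo _ s) λ a∈ → first-valid a∈
        where
        first-valid : ∀ {a} → a ∈ initial-block → ValidSlot s I a
        first-valid a∈ with ∈-applyUpTo⁻ (λ _ → slot 0) {n = s} a∈
        ... | _ , _ , refl = slot-valid 0<real
      before∈ (suc j) j<B = block∈ j<B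
      after∈ : j < B ⊎ j ≡ B → block j ≡ tailBlock s I ⊎ block j ∈ slotBlocks s I
      after∈ (inj₁ j<B)  = inj₂ (block∈ j<B)
      after∈ (inj₂ refl) = inj₁ last-block

    linked-next : ∀ {j} → j < B → Linked (connector j) (connector (suc j))
    linked-next {j} j<B = record
      { level-suc    = cong suc (sym (level≡ j))
      ; after≡before = after≡ j
      ; ordered      = ordered j j<B
      ; comparable   = comparable
      }
      where
      ordered : ∀ j → j < B → ∀ {a b} → a ∈ before (connector j) → b ∈ block j → a ≼ b
      ordered zero 0<B a∈ b∈ with ∈-applyUpTo⁻ (λ _ → slot 0) {n = s} a∈ | ∈-block⁻ 0 b∈
      ... | _ , _ , refl | d , d<s , refl = sorted z≤n (inBlock< 0<B d<s)
      ordered (suc j) j<B a∈ b∈ with ∈-block⁻ j a∈ | ∈-block⁻ (suc j) b∈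
      ... | d , d<s , refl | e , e<s , refl = sorted (≤-trans (+-monoʳ-≤ (s * j) (<⇒≤ d<s))
        (≤-trans (≤-reflexive (trans (+-comm (s * j) s) (sym (*-suc s j)))) (m≤m+n (s * suc j) e))) (inBlock< j<B e<s)
      comparable : ∀ {a b} → a ∈ block j → b ∈ block j → a ≼ b ⊎ b ≼ a
      comparable a∈ b∈ with ∈-block⁻ j a∈ | ∈-block⁻ j b∈
      ... | d , d<s , refl | e , e<s , refl with ≤-total d e
      ... | inj₁ d≤e = inj₁ (sorted (+-monoʳ-≤ (s * j) d≤e) (inBlock< j<B e<s))
      ... | inj₂ e≤d = inj₂ (sorted (+-monoʳ-≤ (s * j) e≤d) (inBlock< j<B d<s))

    -- The pair (j , d) stands for the position d + j (s + 1).
    at : ℕ → ℕ → Label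
    at j zero    = inj₂ (connector j)
    at j (suc d) = inj₁ (element (slot (s * j + d)))

    label : ℕ → Label
    label i = at (i / suc s) (i % suc s)

    label-at : ∀ j {d} → d < suc s → label (d + j * suc s) ≡ at j d
    label-at j d<s = let q , m = quotient-remainder (suc s) j d<s in cong₂ at q m

    position : ∀ i → i ≡ i % suc s + i / suc s * suc s
    position i = m≡m%n+[m/n]*n i (suc s)

    slot-element< : ∀ {i} → i < s * B + s → element (slot i) < s * B + s
    slot-element< {i} i< with i <? s * B
    ... | yes i<N = <-≤-trans (subst (element (slot i) <_) real≡ (proj₁ (slot-valid i<N))) (m≤m+n (s * B) s)
    ... | no  i≮N = subst (_< s * B + s) (sym (cong element (tail-slot (≮⇒≥ i≮N)))) i<

    at-valid : ∀ {j d} → j ≤ B → d < suc s → at j d ∈ labels s I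
    at-valid {j} {zero}  j≤B d< = ∈-labels⁺-connector s I (connector∈ j≤B)
    at-valid {j} {suc d} j≤B (s≤s d<s) = ∈-labels⁺-element s I
      (subst (λ x → element (slot (s * j + d)) < x + s) (sym real≡)
        (slot-element< (+-mono-≤-< (*-monoʳ-≤ s j≤B) d<s)))

    -- The connectors of the path differ in level and the slots in their elements; division by `s`
    -- recovers block and offset from the place of a slot.
    at-injective : ∀ {j d j′ d′} → d < suc s → d′ < suc s → at j d ≡ at j′ d′ → j ≡ j′ × d ≡ d′
    at-injective {j} {zero}  {j′} {zero}   _ _ eq =
      trans (sym (level≡ j)) (trans (cong [ (λ _ → 0) , level ]′ eq) (level≡ j′)) , refl
    at-injective {j} {suc d} {j′} {suc d′} (s≤s d<) (s≤s d′<) eq =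
      let q , m = quotient-remainder s ⦃ nonZero ⦄ j d< ; q′ , m′ = quotient-remainder s ⦃ nonZero ⦄ j′ d′< in
      trans (sym q) (trans (cong (λ x → (x / s) ⦃ nonZero ⦄) same) q′) ,
      cong suc (trans (sym m) (trans (cong (λ x → (x % s) ⦃ nonZero ⦄) same) m′))
      where
      nonZero : NonZero s
      nonZero = >-nonZero 1≤s
      index≡ : s * j + d ≡ s * j′ + d′
      index≡ = slot-injective (cong [ id , (λ _ → 0) ]′ eq)
      flip-sum : ∀ j d → d + j * s ≡ s * j + d
      flip-sum j d = trans (+-comm d (j * s)) (cong (_+ d) (*-comm j s))
      same : d + j * s ≡ d′ + j′ * s
      same = trans (flip-sum j d) (trans index≡ (sym (flip-sum j′ d′)))

    row≤ : ∀ {i} → i < k → i / suc s ≤ B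
    row≤ {i} i<k = ≤-pred (m<n*o⇒m/o<n {n = suc B} (subst (i <_) (*-comm (suc s) (suc B)) i<k))

    -- The elements of a window that starts inside block `j` at offset `d`: the rest of this block
    -- and the first `suc d` elements of the next, with the connector between them left out.
    run : ℕ → ℕ → List Slot
    run j d = applyUpTo (λ e → slot (s * j + d + e)) (suc s)

    run⊆ : ∀ {j d} → d < s → run j d ⊆ block j ++ block (suc j)
    run⊆ {j} {d} d<s a∈ with ∈-applyUpTo⁻ (λ e → slot (s * j + d + e)) a∈
    ... | e , e< , refl with d + e <? s
    ... | yes lt = ∈-++⁺ˡ (subst (λ x → slot x ∈ block j) (sym (+-assoc (s * j) d e)) (∈-block⁺ j lt))
    ... | no ¬lt = ∈-++⁺ʳ (block j) (subst (λ x → slot x ∈ block (suc j)) eq (∈-block⁺ (suc j) f<s))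
      where
      f = d + e ∸ s
      s+f : s + f ≡ d + e
      s+f = m+[n∸m]≡n (≮⇒≥ ¬lt)
      f<s : f < s
      f<s = +-cancelˡ-< s f s (subst (_< s + s) (sym s+f) (+-mono-<-≤ d<s (≤-pred e<)))
      eq : s * suc j + f ≡ s * j + d + e
      eq = trans (cong (_+ f) (trans (*-suc s j) (+-comm s (s * j)))) (trans (+-assoc (s * j) s f)
        (trans (cong (s * j +_) s+f) (sym (+-assoc (s * j) d e))))

    element∈ : ∀ {a as} → a ∈ as → inj₁ (element a) ∈ elementLabels as
    element∈ = ∈-map⁺ (λ a → inj₁ (element a))

    -- A row has `suc s` positions and a window only one more, so a window starting in row `j` does
    -- not reach beyond row `suc j`.
    shifted : ∀ j d e → e < r → d < suc s →
      (d + e < suc s × label (d + j * suc s + e) ≡ at j (d + e)) ⊎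
      (∃[ f ] d + e ≡ suc s + f × label (d + j * suc s + e) ≡ at (suc j) f)
    shifted j d e e<r d<s with d + e <? suc s
    ... | yes lt = inj₁ (lt , trans (cong label (swap-sum (j * suc s))) (label-at j lt))
      where
      swap-sum : ∀ x → d + x + e ≡ d + e + x
      swap-sum x = trans (+-assoc d x e) (trans (cong (d +_) (+-comm x e)) (sym (+-assoc d e x)))
    ... | no ¬lt = inj₂ (f , sym s+f , trans (cong label eq) (label-at (suc j) f<))
      where
      f = d + e ∸ suc s
      s+f : suc s + f ≡ d + e
      s+f = m+[n∸m]≡n (≮⇒≥ ¬lt)
      f< : f < suc s
      f< = +-cancelˡ-< (suc s) f (suc s) (subst (_< suc s + suc s) (sym s+f) 
        (<-≤-trans (+-mono-≤-< (≤-pred d<s) e<r) (≤-reflexive (+-suc s (suc s)))))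
      eq : d + j * suc s + e ≡ f + suc j * suc s
      eq = begin
        d + j * suc s + e      ≡⟨ +-assoc d (j * suc s) e ⟩
        d + (j * suc s + e)    ≡⟨ cong (d +_) (+-comm (j * suc s) e) ⟩
        d + (e + j * suc s)    ≡⟨ +-assoc d e (j * suc s) ⟨
        d + e + j * suc s      ≡⟨ cong (_+ j * suc s) s+f ⟨
        suc s + f + j * suc s  ≡⟨ cong (_+ j * suc s) (+-comm (suc s) f) ⟩
        f + suc s + j * suc s  ≡⟨ +-assoc f (suc s) (j * suc s) ⟩
        f + suc j * suc s      ∎
        where open ≡-Reasoning

    -- A window that starts at a connector ends at the next one and is a link edge; any other window
    -- contains only the connector of the next row and is a star edge.
    window-at : ∀ j d → d < suc s → suc j ≤ B →
      ∃[ L ] Candidate s I L × (∀ e → e < r → label (d + j * suc s + e) ∈ L)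
    window-at j zero d<s j<B = linkEdge (connector j) (connector (suc j)) ,
      link (connector∈ (<⇒≤ j<B)) (connector∈ j<B) (linked-next j<B) ,
      λ e e<r → ok e e<r (shifted j 0 e e<r d<s)
      where
      ok : ∀ e → e < r →
        (e < suc s × label (j * suc s + e) ≡ at j e) ⊎ (∃[ f ] e ≡ suc s + f × label (j * suc s + e) ≡ at (suc j) f) →
        label (j * suc s + e) ∈ linkEdge (connector j) (connector (suc j))
      ok zero    _ (inj₁ (_ , eq)) = here eq
      ok (suc e) _ (inj₁ (s≤s e<s , eq)) = there (there (subst (_∈ _) (sym eq)
        (element∈ (subst (slot (s * j + e) ∈_) (sym (after≡ j)) (∈-block⁺ j e<s)))))
      ok e e<r   (inj₂ (zero , _ , eq)) = there (here eq)
      ok e e<r   (inj₂ (suc f , eq , _)) = contradiction (subst (_< r) eq e<r)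
        (≤⇒≯ (s≤s (≤-trans (s≤s (m≤m+n s f)) (≤-reflexive (sym (+-suc s f))))))
    window-at j (suc d) (s≤s d<s) j<B = starEdge (connector (suc j)) (run j d) ,
      star (connector∈ j<B) (length-applyUpTo (λ e → slot (s * j + d + e)) (suc s)) (run⊆ d<s) ,
      λ e e<r → ok e e<r (shifted j (suc d) e e<r (s≤s d<s))
      where
      ok : ∀ e → e < r →
        (suc d + e < suc s × label (suc d + j * suc s + e) ≡ at j (suc d + e)) ⊎
        (∃[ f ] suc d + e ≡ suc s + f × label (suc d + j * suc s + e) ≡ at (suc j) f) →
        label (suc d + j * suc s + e) ∈ starEdge (connector (suc j)) (run j d)
      ok e _ (inj₁ (s≤s lt , eq)) = there (subst (_∈ _) (sym eq) (element∈
        (subst (λ x → slot x ∈ run j d) (+-assoc (s * j) d e)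
          (∈-applyUpTo⁺ (λ e → slot (s * j + d + e)) (≤-trans (≤-trans (s≤s (m≤n+m e d)) lt) (n≤1+n s))))))
      ok e _ (inj₂ (zero , _ , eq)) = here eq
      ok zero e<r (inj₂ (suc f , eq , _)) = contradiction (suc-injective (trans (cong suc (sym (+-identityʳ d))) eq))
        (<⇒≢ (<-≤-trans d<s (m≤m+n s (suc f))))
      ok (suc e) (s≤s e<) (inj₂ (suc f , eq , lab)) = there (subst (_∈ _) (sym lab) (element∈
        (subst (λ x → slot x ∈ run j d) index≡ (∈-applyUpTo⁺ (λ e → slot (s * j + d + e)) e<))))
        where
        d+e≡ : d + e ≡ s + f
        d+e≡ = suc-injective (trans (sym (+-suc d e)) (trans (suc-injective eq) (+-suc s f)))
        index≡ : s * j + d + e ≡ s * suc j + f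
        index≡ = trans (+-assoc (s * j) d e) (trans (cong (s * j +_) d+e≡) (trans (sym (+-assoc (s * j) s f))
          (cong (_+ f) (trans (+-comm (s * j) s) (sym (*-suc s j))))))

  path : LabelPath r (labels s I) (Candidate s I) k
  path = record
    { label     = label
    ; valid     = λ {i} i<k → at-valid (row≤ i<k) (m%n<n i (suc s))
    ; injective = λ {i} {j} _ _ eq → let q , m = at-injective (m%n<n i (suc s)) (m%n<n j (suc s)) eq in
        trans (position i) (trans (cong₂ (λ d j → d + j * suc s) m q) (sym (position j)))
    ; window    = λ i le → let L , c , ok = window-at (i / suc s) (i % suc s) (m%n<n i (suc s)) (row< i le) in
        L , c , λ e e<r → subst (λ x → label (x + e) ∈ L) (sym (position i)) (ok e e<r)
    }
    where
    -- A window is longer than a row, so none starts in the last row.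
    row< : ∀ i → i + r ≤ k → suc (i / suc s) ≤ B
    row< i le = ≤-pred (*-cancelʳ-< (suc s) (suc (i / suc s)) (suc B) (begin-strict
      suc s + i / suc s * suc s  ≤⟨ +-monoʳ-≤ (suc s) (m/n*n≤m i (suc s)) ⟩
      suc s + i                  ≡⟨ +-comm (suc s) i ⟩
      i + suc s                  <⟨ +-monoʳ-< i (n<1+n (suc s)) ⟩
      i + r                      ≤⟨ le ⟩
      k                          ≡⟨ *-comm (suc s) (suc B) ⟩
      suc B * suc s              ∎))
      where open ≤-Reasoning

-- The number of blocks

blockRun : ℕ → ℕ → ℕ × ℕ → ℕ × ℕ
blockRun s m v = foldl (λ v _ → blockStep s v) v (unary m)

blockRun-done : ∀ s m q → blockRun s m (0 , q) ≡ (0 , q)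
blockRun-done s zero    q = refl
blockRun-done s (suc m) q = blockRun-done s m q

-- `rest + s * q` is invariant while whole blocks are subtracted; only the last, partial block
-- overshoots, by at most `s`. As `s` is positive, `m` steps finish the division.
blockRun-bounds : ∀ s m rest q → 1 ≤ s → rest ≤ m → let q′ = proj₂ (blockRun s m (rest , q)) in
  q ≤ q′ × rest + s * q ≤ s * q′ × s * q′ ≤ rest + s * q + s
blockRun-bounds s m zero q 1≤s _ rewrite blockRun-done s m q = ≤-refl , ≤-refl , m≤m+n (s * q) s
blockRun-bounds s (suc m) (suc rest) q 1≤s (s≤s rest≤m) with s ≤? suc rest
... | yes s≤rest = let le₁ , le₂ , le₃ = blockRun-bounds s m (suc rest ∸ s) (suc q) 1≤s smaller in
    ≤-trans (n≤1+n q) le₁ , ≤-trans (≤-reflexive (sym same)) le₂ , ≤-trans le₃ (≤-reflexive (cong (_+ s) same))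
  where
  smaller : suc rest ∸ s ≤ m
  smaller = ≤-trans (∸-monoʳ-≤ (suc rest) 1≤s) rest≤m
  same : suc rest ∸ s + s * suc q ≡ suc rest + s * q
  same = trans (cong (suc rest ∸ s +_) (*-suc s q)) (trans (sym (+-assoc (suc rest ∸ s) s (s * q)))
    (cong (_+ s * q) (m∸n+n≡m s≤rest)))
... | no s≰rest rewrite m≤n⇒m∸n≡0 (<⇒≤ (≰⇒> s≰rest)) | blockRun-done s m (suc q) =
  n≤1+n q ,
  ≤-trans (+-monoˡ-≤ (s * q) (<⇒≤ (≰⇒> s≰rest))) (≤-reflexive (sym (*-suc s q))) ,
  ≤-trans (≤-reflexive (trans (*-suc s q) (+-comm s (s * q)))) (+-monoˡ-≤ s (m≤n+m (s * q) (suc rest)))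

module _ {s : ℕ} (1≤s : 1 ≤ s) (n : ℕ) where

  private
    bounds = blockRun-bounds s n n 3 1≤s ≤-refl

  3≤blocks : 3 ≤ blocks s n
  3≤blocks = proj₁ bounds

  n≤s*blocks : n ≤ s * blocks s n
  n≤s*blocks = ≤-trans (m≤m+n n (s * 3)) (proj₁ (proj₂ bounds))

  -- Three blocks come from the initial count and at most one from rounding up.
  s*blocks≤ : s * blocks s n ≤ n + s * 4
  s*blocks≤ = ≤-trans (proj₂ (proj₂ bounds)) (≤-reflexive (trans (+-assoc n (s * 3) s)
    (cong (n +_) (trans (+-comm (s * 3) s) (sym (*-suc s 3))))))

tightPath⇒cover : ∀ {s} → 1 ≤ s → ∀ n G t → let I = n , G , t in
  TightPath (hypergraph s I) (pathLength s I) → CoverBy n G t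
tightPath⇒cover {s} 1≤s n G t P = Chain.cover s I 1≤s (blocks s n) (3≤blocks 1≤s n) refl (n≤s*blocks 1≤s n)
    (tightPath⇒labelPath s I P)
  where I = n , G , t

cover⇒tightPath : ∀ {s} → 1 ≤ s → ∀ n G t → 1 ≤ n → (∀ {A} → A ∈ G → length A ≡ n) → let I = n , G , t in
  CoverBy n G t → TightPath (hypergraph s I) (pathLength s I)
cover⇒tightPath {s} 1≤s n G t 1≤n lengths C = labelPath⇒tightPath s I
    (Path.path s I 1≤s (blocks s n) (≤-trans (s≤s z≤n) (3≤blocks 1≤s n)) refl refl (slotOrder s n G t 1≤n lengths C))
  where I = n , G , t

-- Running a given program as a subroutine

shiftE : ℕ → Expr → Expr
shiftE b (var x)    = var (b + x)
shiftE b nil        = nil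
shiftE b (cons e f) = cons (shiftE b e) (shiftE b f)
shiftE b (hd e)     = hd (shiftE b e)
shiftE b (tl e)     = tl (shiftE b e)

shift : ℕ → Cmd → Cmd
shift b skip                   = skip
shift b (x := e)               = (b + x) := shiftE b e
shift b (c ⨟ d)                = shift b c ⨟ shift b d
shift b (if e then c else d)   = if shiftE b e then shift b c else shift b d
shift b (while e loop c)       = while shiftE b e loop shift b c

varsE : Expr → ℕ
varsE (var x)    = suc x
varsE nil        = 0
varsE (cons e f) = varsE e ⊔ varsE f
varsE (hd e)     = varsE e
varsE (tl e)     = varsE e

vars : Cmd → ℕ
vars skip                 = 0
vars (x := e)             = suc x ⊔ varsE e
vars (c ⨟ d)              = vars c ⊔ vars d
vars (if e then c else d) = varsE e ⊔ (vars c ⊔ vars d)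
vars (while e loop c)     = varsE e ⊔ vars c

cost-shift : ∀ b e → cost (shiftE b e) ≡ cost e
cost-shift b (var x)    = refl
cost-shift b nil        = refl
cost-shift b (cons e f) = cong suc (cong₂ _+_ (cost-shift b e) (cost-shift b f))
cost-shift b (hd e)     = cong suc (cost-shift b e)
cost-shift b (tl e)     = cong suc (cost-shift b e)

module _ (m b : ℕ) where

  Mirrors : Store → Store → Set
  Mirrors σ τ = ∀ x → x < m → σ (b + x) ≡ τ x

  eval-shift : ∀ {σ τ} e → varsE e ≤ m → Mirrors σ τ → eval (shiftE b e) σ ≡ eval e τ
  eval-shift (var x)    le M = M x le
  eval-shift nil        le M = refl
  eval-shift (cons e f) le M = cong₂ _∙_ (eval-shift e (m⊔n≤o⇒m≤o _ _ le) M) (eval-shift f (m⊔n≤o⇒n≤o _ _ le) M)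
  eval-shift (hd e)     le M = cong left (eval-shift e le M)
  eval-shift (tl e)     le M = cong right (eval-shift e le M)

  Simulates : Cmd → Store → ℕ → Store → Set
  Simulates c σ t τ′ = Exec (shift b c) σ t (λ σ′ → Mirrors σ′ τ′ × Unchanged< b σ σ′)

  simulate : ∀ {c τ t τ′} → ⟨ c , τ ⟩⇓[ t ] τ′ → vars c ≤ m → ∀ {σ} → Mirrors σ τ → Simulates c σ t τ′
  simulate ⇓-skip le M = mkExec ⇓-skip (M , λ _ → refl) ≤-refl
  simulate {x := e} {τ} ⇓-:= le {σ} M = weaken (≤-reflexive (cong suc (cost-shift b e)))
    (λ (eq , oth) → mirrors eq oth , λ z<b → oth (>⇒≢ (<-≤-trans z<b (m≤m+n b x))))
    (assign (b + x) (shiftE b e))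
    where
    mirrors : ∀ {σ′} → σ′ (b + x) ≡ eval (shiftE b e) σ → (∀ {y} → b + x ≢ y → σ′ y ≡ σ y) →
              Mirrors σ′ (τ [ x ↦ eval e τ ])
    mirrors eq oth y y<m with x ≟ y
    ... | yes refl = trans eq (eval-shift e (m⊔n≤o⇒n≤o (suc x) _ le) M)
    ... | no  x≢y  = trans (oth (λ eq′ → x≢y (+-cancelˡ-≡ b x y eq′))) (M y y<m)
  simulate {c ⨟ d} (⇓-⨟ p q) le M =
    simulate p (m⊔n≤o⇒m≤o _ _ le) M >>> λ (M₁ , u₁) →
    weaken ≤-refl (λ (M₂ , u₂) → M₂ , λ z<b → trans (u₂ z<b) (u₁ z<b)) (simulate q (m⊔n≤o⇒n≤o (vars c) _ le) M₁)
  simulate {if e then c else d} (⇓-then eq p) le M =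
    weaken (≤-reflexive (cong (λ x → suc x + _) (cost-shift b e))) id
      (exec-then (trans (eval-shift e (m⊔n≤o⇒m≤o _ _ le) M) eq)
        (simulate p (m⊔n≤o⇒m≤o _ _ (m⊔n≤o⇒n≤o (varsE e) _ le)) M))
  simulate {if e then c else d} (⇓-else eq p) le M =
    weaken (≤-reflexive (cong (λ x → suc x + _) (cost-shift b e))) id
      (exec-else (trans (eval-shift e (m⊔n≤o⇒m≤o _ _ le) M) eq)
        (simulate p (m⊔n≤o⇒n≤o (vars c) _ (m⊔n≤o⇒n≤o (varsE e) _ le)) M))
  simulate {while e loop c} (⇓-stop eq) le M =
    weaken (≤-reflexive (cong suc (cost-shift b e))) id
      (exec-stop _ (trans (eval-shift e (m⊔n≤o⇒m≤o _ _ le) M) eq) (M , λ _ → refl))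
  simulate {while e loop c} (⇓-loop eq p q) le M =
    weaken (≤-reflexive (cong (λ x → suc x + _ + _) (cost-shift b e))) id
      (exec-loop (trans (eval-shift e (m⊔n≤o⇒m≤o _ _ le) M) eq)
        (simulate p (m⊔n≤o⇒n≤o (varsE e) _ le) M) λ (M₁ , u₁) →
        weaken ≤-refl (λ (M₂ , u₂) → M₂ , λ z<b → trans (u₂ z<b) (u₁ z<b)) (simulate q le M₁))

-- A called program expects nil in every variable except the input, whereas a fragment may find
-- anything above its base.
clear : ℕ → Fragment
clear zero    b = skip
clear (suc m) b = clear m b ⨟ ((b + suc m) := nil)

exec-clear : ∀ m b σ → Exec (clear m b) σ (1 + 2 * m) (λ σ′ →
  σ′ b ≡ σ b × (∀ x → x < m → σ′ (b + suc x) ≡ nil) × Unchanged< b σ σ′)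
exec-clear zero    b σ = mkExec ⇓-skip (refl , (λ _ ()) , λ _ → refl) ≤-refl
exec-clear (suc m) b σ = weaken (≤-reflexive (trans (+-comm (1 + 2 * m) 2) (cong suc (sym (*-suc 2 m))))) id
  (exec-clear m b σ >>> λ {σ₁} (eq , cl , un) →
   weaken ≤-refl (λ {σ₂} (eq′ , oth) →
     trans (oth (>⇒≢ (m<m+n b (s≤s z≤n)))) eq ,
     (λ x x<m → cleared σ₁ σ₂ eq′ oth cl x (m≤n⇒m<n∨m≡n (≤-pred x<m))) ,
     λ z<b → trans (oth (>⇒≢ (<-≤-trans z<b (m≤m+n b (suc m))))) (un z<b))
   (assign (b + suc m) nil))
  where
  cleared : ∀ (σ₁ σ₂ : Store) → σ₂ (b + suc m) ≡ nil → (∀ {y} → b + suc m ≢ y → σ₂ y ≡ σ₁ y) →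
            (∀ x → x < m → σ₁ (b + suc x) ≡ nil) → ∀ x → x < m ⊎ x ≡ m → σ₂ (b + suc x) ≡ nil
  cleared σ₁ σ₂ eq′ oth cl x (inj₁ x<m)  =
    trans (oth (λ e → >⇒≢ x<m (suc-injective (+-cancelˡ-≡ b _ _ e)))) (cl x x<m)
  cleared σ₁ σ₂ eq′ oth cl x (inj₂ refl) = eq′

callF : Cmd → Fragment
callF prog b = clear (vars prog) b ⨟ shift b prog

computes-call : ∀ prog {x y T} → prog on x outputs y inTime T →
                Computes (callF prog) x y ((1 + 2 * vars prog) + T)
computes-call prog {x} (τ′ , p , eq) b σ σb =
  exec-clear (vars prog) b σ >>> λ {σ₁} (e , cl , un) →
  weaken ≤-refl (λ {σ₂} (M , un′) → trans (trans (cong σ₂ (sym (+-identityʳ b))) (M 0 (s≤s z≤n))) eq ,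
                               λ z<b → trans (un′ z<b) (un z<b))
    -- The `suc` keeps variable 0, which holds the output, mirrored even when the program mentions
    -- no variable.
    (simulate (suc (vars prog)) b p (n≤1+n _) (mirrors σ₁ e cl))
  where
  mirrors : ∀ (σ₁ : Store) → σ₁ b ≡ σ b → (∀ z → z < vars prog → σ₁ (b + suc z) ≡ nil) →
            Mirrors (suc (vars prog)) b σ₁ (initial x)
  mirrors σ₁ e cl zero    _         = trans (cong σ₁ (+-identityʳ b)) (trans e σb)
  mirrors σ₁ e cl (suc z) (s≤s z<) = cl z z<

-- Finding a minimum cover with an oracle for the existence of covers

inputTy : Ty
inputTy = nat ⊗ list setTy

without : List Bool → List (List Bool) → List (List Bool)
without A G = filterᵇ (λ X → not (eqb setTy X A)) G

size-filter : ∀ {τ} (p : El τ → Bool) xs → size (list τ) (filterᵇ p xs) ≤ size (list τ) xs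
size-filter p []       = z≤n
size-filter {τ} p (x ∷ xs) with p x
... | true  = s≤s (+-monoʳ-≤ (size τ x) (size-filter p xs))
... | false = ≤-trans (size-filter p xs) (m≤n+m _ (suc (size τ x)))

timeOf : ∀ {σ τ f T} → Comp σ τ f T → El σ → ℕ
timeOf {T = T} _ = T

-- Linear in the oracle time `τ`: polynomially many calls cost only a polynomial factor, whereas a
-- higher power of `τ` would change the exponent. `W` consists of the states in which a program is
-- run.
record Bounded {W : Set} (input : W → El inputTy) (τ : W → ℕ) (T : W → ℕ) : Set where
  constructor mkBounded
  field
    factor  : El inputTy → ℕ
    polyB   : PolyBounded factor
    factor≤ : ∀ w → T w ≤ factor (input w) * suc (τ w)

module _ {W : Set} {input : W → El inputTy} {τ : W → ℕ} where

  private
    B : (W → ℕ) → Set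
    B = Bounded input τ

  bounded-+ : ∀ {S T} → B S → B T → B (λ w → S w + T w)
  bounded-+ (mkBounded f p le) (mkBounded g q le′) = mkBounded (λ a → f a + g a) (pb-+ p q) λ w →
    ≤-trans (+-mono-≤ (le w) (le′ w)) (≤-reflexive (sym (*-distribʳ-+ (suc (τ w)) (f (input w)) (g (input w)))))

  bounded-≤ : ∀ {S T} → (∀ w → S w ≤ T w) → B T → B S
  bounded-≤ S≤T (mkBounded f p le) = mkBounded f p λ w → ≤-trans (S≤T w) (le w)

  bounded-input : ∀ {φ : El inputTy → ℕ} → PolyBounded φ → B (λ w → φ (input w))
  bounded-input {φ} p = mkBounded φ p λ w → m≤m*n (φ (input w)) (suc (τ w))

  bounded-const : ∀ c → B (λ _ → c)
  bounded-const c = bounded-input (pb-const c)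

  bounded-oracle : B τ
  bounded-oracle = mkBounded (λ _ → 1) (pb-const 1) λ w → ≤-trans (n≤1+n (τ w)) (≤-reflexive (sym (+-identityʳ _)))

  bounded-* : ∀ {φ : El inputTy → ℕ} {T} → PolyBounded φ → B T → B (λ w → φ (input w) * T w)
  bounded-* {φ} q (mkBounded f p le) = mkBounded (λ a → φ a * f a) (pb-* q p) λ w →
    ≤-trans (*-monoʳ-≤ (φ (input w)) (le w)) (≤-reflexive (sym (*-assoc (φ (input w)) (f (input w)) (suc (τ w)))))

  bounded-poly : ∀ {σ υ f} (P : Poly σ υ f) (x : W → El σ) → (∀ w → size σ (x w) ≤ 3 + 4 * size inputTy (input w)) →
                 B (λ w → P .time (x w))
  bounded-poly P x le = bounded-≤ (λ w → ≤-trans (P .timeBound .bounded (x w))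
      (^-monoˡ-≤ (P .timeBound .degree) (+-monoʳ-≤ 2 (le w))))
    (bounded-input (pb-^ (pb-+ (pb-const 5) (pb-* (pb-const 4) pb-size)) (P .timeBound .degree)))

  bounded-when : ∀ {c : W → Bool} {S T} → B S → B T → B (λ w → when c w then S w else T w)
  bounded-when {c} {S} {T} p q = bounded-≤ le (bounded-+ p q)
    where
    le : ∀ w → (when c w then S w else T w) ≤ S w + T w
    le w with c w
    ... | true  = m≤m+n (S w) (T w)
    ... | false = m≤n+m (T w) (S w)

  -- W′ indexes the iterations of all the loops.
  bounded-loop : ∀ {A C : Set} {h : W → A → C → C} {T : W → A → C → ℕ} {z : W → C} {l : W → List A}
    (W′ : Set) (world : W′ → W) {T′ : W′ → ℕ} → Bounded (input ∘ world) (τ ∘ world) T′ →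
    (∀ w → length (l w) ≤ size inputTy (input w)) →
    (∀ w ys x zs → l w ≡ ys ++ x ∷ zs → Σ W′ λ w′ → world w′ ≡ w × T w x (foldl (λ v x → h w x v) (z w) ys) ≤ T′ w′) →
    B (λ w → loopTime (h w) (T w) (z w) (l w))
  bounded-loop {h = h} {T} {z} {l} W′ world {T′} (mkBounded f p le) len step =
    bounded-≤ (λ w → ≤-trans (loopTime-≤ (h w) (T w) (f (input w) * suc (τ w)) (z w) (l w) (λ ys x zs eq →
          let w′ , weq , le′ = step w ys x zs eq in
          ≤-trans le′ (subst (λ v → T′ w′ ≤ f (input v) * suc (τ v)) weq (le w′))))
        (+-monoʳ-≤ 2 (*-monoˡ-≤ (14 + f (input w) * suc (τ w)) (len w))))
      (bounded-+ (bounded-const 2) (bounded-* pb-size (bounded-+ (bounded-const 14)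
        (mkBounded f p λ w → ≤-refl))))

module Search (D : El instanceTy → Bool) where

  shrink : El instanceTy → List Bool → List (List Bool) → List (List Bool)
  shrink (n , F , t) A G = when D (n , without A G , t) then without A G else G

  prune : El instanceTy → List (List Bool)
  prune I = foldl (λ G A → shrink I A G) (proj₁ (proj₂ I)) (proj₁ (proj₂ I))

  -- The head `[]` encodes to nil and is the tag that the answer format demands of a cover; a result
  -- `[]` without it means that no cover was found.
  improve : El inputTy → ℕ → List (List Bool) → List (List Bool)
  improve (n , F) t out = when D (n , F , t) then [] ∷ prune (n , F , t) else out

  -- The budgets descend from n to 1, so the last success has the smallest budget; n is enough
  -- because one set per element covers everything. For an empty ground set the tagged empty cover
  -- is returned at once.
  search : El inputTy → List (List Bool)
  search a = when isZero (proj₁ a) then [] ∷ []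
    else foldl (λ out t → improve a t out) [] (map suc (downFrom (proj₁ a)))

  size-shrink : ∀ I A G → size (list setTy) (shrink I A G) ≤ size (list setTy) G
  size-shrink (n , F , t) A G with D (n , without A G , t)
  ... | true  = size-filter (λ X → not (eqb setTy X A)) G
  ... | false = ≤-refl

  size-prune : ∀ I As G → size (list setTy) (foldl (λ G A → shrink I A G) G As) ≤ size (list setTy) G
  size-prune I []       G = ≤-refl
  size-prune I (A ∷ As) G = ≤-trans (size-prune I As (shrink I A G)) (size-shrink I A G)

  size-improve : ∀ a ts out → size (list setTy) out ≤ 1 + size (list setTy) (proj₂ a) →
    size (list setTy) (foldl (λ out t → improve a t out) out ts) ≤ 1 + size (list setTy) (proj₂ a)
  size-improve a       []       out le = le
  size-improve (n , F) (t ∷ ts) out le = size-improve (n , F) ts (improve (n , F) t out) step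
    where
    step : size (list setTy) (improve (n , F) t out) ≤ 1 + size (list setTy) F
    step with D (n , F , t)
    ... | true  = s≤s (size-prune (n , F , t) F F)
    ... | false = le

  module _ {T : El instanceTy → ℕ} (oracle : Comp instanceTy bool D T) where

    private
      opaque
        withoutₚ : Poly ((instanceTy ⊗ setTy) ⊗ list setTy) (list setTy) (λ ((I , A) , G) → without A G)
        withoutₚ = filterₚ sndₚ (notₚ (eqₚ setTy sndₚ (fstₚ ▸ fstₚ ▸ sndₚ)))

        queryₚ : Poly ((instanceTy ⊗ setTy) ⊗ list setTy) instanceTy
                   (λ ((I , A) , G) → proj₁ I , without A G , proj₂ (proj₂ I))
        queryₚ = (fstₚ ▸ fstₚ ▸ fstₚ) ,ₚ withoutₚ ,ₚ (fstₚ ▸ fstₚ ▸ sndₚ ▸ sndₚ)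

        familyₚ : Poly instanceTy (list setTy) (λ I → proj₁ (proj₂ I))
        familyₚ = sndₚ ▸ fstₚ

        instanceₚ : Poly ((inputTy ⊗ nat) ⊗ list setTy) instanceTy (λ ((a , t) , out) → proj₁ a , proj₂ a , t)
        instanceₚ = (fstₚ ▸ fstₚ ▸ fstₚ) ,ₚ (fstₚ ▸ fstₚ ▸ sndₚ) ,ₚ (fstₚ ▸ sndₚ)

        budgetsₚ : Poly inputTy (list nat) (λ a → map suc (downFrom (proj₁ a)))
        budgetsₚ = mapₚ (downFromₚ fstₚ) (sucₚ sndₚ)

        emptyₚ : Poly inputTy (list setTy) (λ _ → [])
        emptyₚ = constₚ []

        trivialₚ : Poly inputTy (list setTy) (λ _ → [] ∷ [])
        trivialₚ = constₚ ([] ∷ [])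

        zeroₚ : Poly inputTy bool (λ a → isZero (proj₁ a))
        zeroₚ = isZeroₚ fstₚ

      shrinkC = ifC (compC (queryₚ .comp) oracle) (withoutₚ .comp) (sndₚ .comp)

      pruneC = foldC (familyₚ .comp) (familyₚ .comp) shrinkC

      tagC : ∀ {Γ : Ty} {f : El Γ → List (List Bool)} {S} → Comp Γ (list setTy) f S →
             Comp Γ (list setTy) (λ γ → [] ∷ f γ) _
      tagC F = mkComp (G .code) (G .correct)
        where G = pairC (constₚ {τ = setTy} [] .comp) F

      improveC = ifC (compC (instanceₚ .comp) oracle) (tagC (compC (instanceₚ .comp) pruneC)) (sndₚ .comp)

    searchC = ifC (zeroₚ .comp) (trivialₚ .comp) (foldC (budgetsₚ .comp) (emptyₚ .comp) improveC)

    -- One time bound for all calls of a search: each queried family is at most as large as the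
    -- input family and each budget is at most n.
    record Query : Set where
      field
        input    : El inputTy
        callTime : ℕ
        oracle≤callTime : ∀ G t → size (list setTy) G ≤ size (list setTy) (proj₂ input) → t ≤ proj₁ input →
                   T (proj₁ input , G , t) ≤ callTime

    open Query

    private
      n : Query → ℕ
      n q = proj₁ (input q)

      F : Query → List (List Bool)
      F q = proj₂ (input q)

      -- A state of the loop over the budgets, as `Removal` is a state of the loop over the sets.
      -- The size conditions keep all intermediate data polynomial in the input.
      record Budget : Set where
        field
          query : Query
          t     : ℕ
          t≤n   : t ≤ n query
          out   : List (List Bool)
          out≤  : size (list setTy) out ≤ 1 + size (list setTy) (F query)

      record Removal : Set where
        field
          budget : Budget
          A      : List Bool
          A≤     : size setTy A ≤ size (list setTy) (F (Budget.query budget))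
          G      : List (List Bool)
          G≤     : size (list setTy) G ≤ size (list setTy) (F (Budget.query budget))
        open Budget budget public

      open Removal

      instanceOf : Budget → El instanceTy
      instanceOf b = n (Budget.query b) , F (Budget.query b) , Budget.t b

      budgetOf : Budget → El ((inputTy ⊗ nat) ⊗ list setTy)
      budgetOf b = (input (Budget.query b) , Budget.t b) , Budget.out b

      removalOf : Removal → El ((instanceTy ⊗ setTy) ⊗ list setTy)
      removalOf w = (instanceOf (budget w) , A w) , G w

      size-t≤ : ∀ {t n} → t ≤ n → size nat t ≤ size nat n
      size-t≤ {t} {n} t≤n = ≤-trans (≤-reflexive (size-nat t)) (≤-trans t≤n (≤-reflexive (sym (size-nat n))))

      sum₁ : ∀ n f {t a g} → t ≤ n → a ≤ f → g ≤ f →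
             1 + (1 + (1 + n + (1 + f + t)) + a) + g ≤ 3 + 4 * (1 + n + f)
      sum₁ n f t≤ a≤ g≤ = ≤-trans
        (s≤s (+-mono-≤ (s≤s (+-mono-≤ (s≤s (+-monoʳ-≤ n (s≤s (+-monoʳ-≤ f t≤)))) a≤)) g≤))
        (≤-trans (m≤m+n _ (3 + 2 * n + f)) (≤-reflexive (solve 2 (λ n f →
          (con 1 :+ (con 1 :+ (con 1 :+ n :+ (con 1 :+ f :+ n)) :+ f) :+ f) :+ (con 3 :+ con 2 :* n :+ f)
            ⊜ con 3 :+ con 4 :* (con 1 :+ n :+ f)) refl n f)))

      sum₂ : ∀ n f {t g} → t ≤ n → g ≤ 1 + f → 1 + (1 + (1 + n + f) + t) + g ≤ 3 + 4 * (1 + n + f)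
      sum₂ n f t≤ g≤ = ≤-trans (s≤s (+-mono-≤ (s≤s (+-monoʳ-≤ (1 + n + f) t≤)) g≤))
        (≤-trans (m≤m+n _ (3 + 2 * n + 2 * f)) (≤-reflexive (solve 2 (λ n f →
          (con 1 :+ (con 1 :+ (con 1 :+ n :+ f) :+ n) :+ (con 1 :+ f)) :+ (con 3 :+ con 2 :* n :+ con 2 :* f)
            ⊜ con 3 :+ con 4 :* (con 1 :+ n :+ f)) refl n f)))

      size-removal : ∀ w → size _ (removalOf w) ≤ 3 + 4 * size inputTy (input (query w))
      size-removal w = sum₁ (size nat (n (query w))) (size (list setTy) (F (query w))) (size-t≤ (t≤n w)) (A≤ w) (G≤ w)

      size-instance : ∀ b → size instanceTy (instanceOf b) ≤ 3 + 4 * size inputTy (input (Budget.query b))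
      size-instance b = ≤-trans (≤-trans (m≤m+n _ 0) (≤-trans (n≤1+n _) (≤-trans (m≤m+n _ 0) (n≤1+n _))))
        (sum₁ (size nat (n (Budget.query b))) (size (list setTy) (F (Budget.query b))) {a = 0} {g = 0} (size-t≤ (Budget.t≤n b)) z≤n z≤n)

      size-budget : ∀ b → size _ (budgetOf b) ≤ 3 + 4 * size inputTy (input (Budget.query b))
      size-budget b = sum₂ (size nat (n (Budget.query b))) (size (list setTy) (F (Budget.query b)))
        (size-t≤ (Budget.t≤n b)) (Budget.out≤ b)

      size-input : ∀ q → size inputTy (input q) ≤ 3 + 4 * size inputTy (input q)
      size-input q = ≤-trans (m≤n*m (size inputTy (input q)) 4) (m≤n+m _ 3)

      shrink-bounded : Bounded (input ∘ query) (callTime ∘ query) (timeOf shrinkC ∘ removalOf)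
      shrink-bounded = bounded-+
        (bounded-+ (bounded-const 2) (bounded-+ (bounded-poly queryₚ removalOf size-removal)
          (bounded-≤ (λ w → oracle≤callTime (query w) (without (A w) (G w)) (t w)
            (≤-trans (size-filter (λ X → not (eqb setTy X (A w))) (G w)) (G≤ w)) (t≤n w)) bounded-oracle)))
        (bounded-+ (bounded-const 2) (bounded-when (bounded-poly withoutₚ removalOf size-removal)
          (bounded-poly sndₚ removalOf size-removal)))

      prune-bounded : Bounded (input ∘ Budget.query) (callTime ∘ Budget.query) (timeOf pruneC ∘ instanceOf)
      prune-bounded = bounded-+ (bounded-+ (bounded-const 2) (bounded-poly familyₚ instanceOf size-instance))
        (bounded-+ (bounded-+ (bounded-const 2) (bounded-poly familyₚ instanceOf size-instance))
          (bounded-+ (bounded-loop {h = λ b A G → shrink (instanceOf b) A G} {T = λ b A G → timeOf shrinkC ((instanceOf b , A) , G)}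
              {z = F ∘ Budget.query} {l = F ∘ Budget.query} Removal budget shrink-bounded
              (λ b → ≤-trans (length≤size (F (Budget.query b))) (m≤n+m _ (suc (size nat (n (Budget.query b))))))
              (λ b ys x zs eq → record
                { budget = b ; A = x
                ; A≤ = ≤-trans (size-middle ys x zs) (≤-reflexive (cong (size (list setTy)) (sym eq)))
                ; G = foldl (λ G A → shrink (instanceOf b) A G) (F (Budget.query b)) ys
                ; G≤ = size-prune (instanceOf b) ys (F (Budget.query b))
                } , refl , ≤-refl))
            (bounded-const 2)))

      improve-bounded : Bounded (input ∘ Budget.query) (callTime ∘ Budget.query) (timeOf improveC ∘ budgetOf)
      improve-bounded = bounded-+
        (bounded-+ (bounded-const 2) (bounded-+ (bounded-poly instanceₚ budgetOf size-budget)
          (bounded-≤ (λ b → oracle≤callTime (Budget.query b) (F (Budget.query b)) (Budget.t b) ≤-refl (Budget.t≤n b)) bounded-oracle)))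
        (bounded-+ (bounded-const 2) (bounded-when
          (bounded-+ (bounded-const 4) (bounded-+ (bounded-+ (bounded-const 2)
            (bounded-+ (bounded-poly instanceₚ budgetOf size-budget) prune-bounded)) (bounded-const 4)))
          (bounded-poly sndₚ budgetOf size-budget)))

    opaque
      search-bounded : Bounded input callTime (timeOf searchC ∘ input)
      search-bounded = bounded-+ (bounded-+ (bounded-const 2) (bounded-poly zeroₚ input size-input))
        (bounded-+ (bounded-const 2) (bounded-when (bounded-poly trivialₚ input size-input)
          (bounded-+ (bounded-+ (bounded-const 2) (bounded-poly budgetsₚ input size-input))
            (bounded-+ (bounded-+ (bounded-const 2) (bounded-poly emptyₚ input size-input))
              (bounded-+ (bounded-loop {h = λ q t out → improve (input q) t out} {T = λ q t out → timeOf improveC ((input q , t) , out)}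
                  {z = λ _ → []} {l = λ q → map suc (downFrom (n q))} Budget Budget.query improve-bounded
                  (λ q → ≤-trans (≤-reflexive (trans (length-map suc (downFrom (n q))) (trans (length-downFrom (n q)) (sym (size-nat (n q))))))
                     (≤-trans (m≤m+n _ (size (list setTy) (F q))) (n≤1+n _)))
                  (λ q ys x zs eq → record
                    { query = q ; t = x
                    ; t≤n = budget≤ q (subst (x ∈_) (sym eq) (∈-++⁺ʳ ys (here refl)))
                    ; out = foldl (λ out t → improve (input q) t out) [] ys
                    ; out≤ = size-improve (input q) ys [] z≤n
                    } , refl , ≤-refl))
                (bounded-const 2))))))
        where
        budget≤ : ∀ q {x} → x ∈ map suc (downFrom (n q)) → x ≤ n q
        budget≤ q x∈ with ∈-map⁻ suc x∈
        ... | y , y∈ , refl = ∈-downFrom⁻ y∈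

    searchComp : Comp inputTy (list setTy) search (timeOf searchC)
    searchComp = searchC

cover-mono : ∀ {n G G′ t t′} → G ⊆ G′ → t ≤ t′ → CoverBy n G t → CoverBy n G′ t′
cover-mono G⊆ t≤ C = record
  { sets = sets ; length-sets = ≤-trans length-sets t≤ ; sets⊆G = G⊆ ∘ sets⊆G ; covered = covered }
  where open CoverBy C

without⊆ : ∀ A G → without A G ⊆ G
without⊆ A G X∈ = proj₁ (∈-filterᵇ⁻ (λ X → not (eqb setTy X A)) {xs = G} X∈)

∈-without⁺ : ∀ {A X G} → X ∈ G → X ≢ A → X ∈ without A G
∈-without⁺ {A} {X} X∈ X≢A = ∈-filterᵇ⁺ (λ X → not (eqb setTy X A)) X∈ (¬T-not λ e → X≢A (eqb⇒≡ setTy e))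

∉-without : ∀ A G → A ∉ without A G
∉-without A G A∈ = not-T (proj₂ (∈-filterᵇ⁻ (λ X → not (eqb setTy X A)) {xs = G} A∈)) (eqb-refl setTy A)

without-mono : ∀ {A G G′} → G ⊆ G′ → without A G ⊆ without A G′
without-mono {A} {G} G⊆ X∈ with ∈-filterᵇ⁻ (λ X → not (eqb setTy X A)) {xs = G} X∈
... | X∈G , ok = ∈-filterᵇ⁺ (λ X → not (eqb setTy X A)) (G⊆ X∈G) ok

module SearchCorrect (D : El instanceTy → Bool) (n : ℕ) (1≤n : 1 ≤ n) (F : List (List Bool))
  (F-unique : Unique F)
  (sound : ∀ G t → G ⊆ F → T (D (n , G , t)) → CoverBy n G t)
  (complete : ∀ G t → G ⊆ F → CoverBy n G t → T (D (n , G , t))) where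

  open Search D

  -- A set kept at its turn was indispensable in the family of that moment; later removals only
  -- shrink the family, so it stays critical.
  record Pruned (t : ℕ) (As G R : List (List Bool)) : Set where
    field
      R⊆G      : R ⊆ G
      unique   : Unique R
      coverR   : CoverBy n R t
      critical : ∀ {A} → A ∈ As → A ∈ R → ¬ CoverBy n (without A R) t

  pruned : ∀ t As G → G ⊆ F → Unique G → CoverBy n G t →
           Pruned t As G (foldl (λ G A → shrink (n , F , t) A G) G As)
  pruned t []       G G⊆F G! C = record { R⊆G = id ; unique = G! ; coverR = C ; critical = λ () }
  pruned t (A ∷ As) G G⊆F G! C with D (n , without A G , t) in eq
  ... | true = record
    { R⊆G      = λ X∈ → without⊆ A G (R⊆G X∈)
    ; unique   = unique
    ; coverR   = coverR
    ; critical = λ { (here refl) A∈ → contradiction (R⊆G A∈) (∉-without A G) ; (there B∈) B∈R → critical B∈ B∈R }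
    }
    where
    open Pruned (pruned t As (without A G) (G⊆F ∘ without⊆ A G)
      (Unique.filter⁺ (λ X → T? (not (eqb setTy X A))) G!)
      (sound _ t (G⊆F ∘ without⊆ A G) (subst T (sym eq) _)))
  ... | false = record
    { R⊆G      = R⊆G
    ; unique   = unique
    ; coverR   = coverR
    ; critical = λ { (here refl) _ C′ → subst T eq (complete _ t (G⊆F ∘ without⊆ A G)
                        (cover-mono (without-mono R⊆G) ≤-refl C′))
                   ; (there B∈) B∈R → critical B∈ B∈R }
    }
    where open Pruned (pruned t As G G⊆F G! C)

  prune-correct : ∀ t → CoverBy n F t → let R = prune (n , F , t) in
    R ⊆ F × Unique R × length R ≤ t × (∀ {u} → u < n → ∃[ A ] A ∈ R × T (member A u))
  prune-correct t C = R⊆G , unique , ≤-trans (unique-⊆⇒length≤ unique R⊆sets) length-sets ,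
    λ u<n → let A , A∈ , m = covered u<n in A , sets⊆G A∈ , m
    where
    open Pruned (pruned t F F id F-unique C)
    open CoverBy coverR
    -- A set not used by the cover of the pruned family could have been removed.
    R⊆sets : prune (n , F , t) ⊆ sets
    R⊆sets {A} A∈R with Any.any? (dec setTy A) sets
    ... | yes A∈ = A∈
    ... | no  A∉ = contradiction (record
      { sets = sets ; length-sets = length-sets
      ; sets⊆G = λ X∈ → ∈-without⁺ (sets⊆G X∈) (λ { refl → A∉ X∈ })
      ; covered = covered }) (critical (R⊆G A∈R) A∈R)

  no-empty-cover : ¬ CoverBy n F 0
  no-empty-cover C with CoverBy.sets C | CoverBy.length-sets C | CoverBy.covered C 1≤n
  ... | [] | _ | _ , () , _

  -- The invariant once all budgets above `m` have been tried: minimality is claimed only among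
  -- these, and becomes the full claim at `m = 0`.
  data Outcome (m : ℕ) (out : List (List Bool)) : Set where
    none : out ≡ [] → (∀ t → m < t → t ≤ n → ¬ CoverBy n F t) → Outcome m out
    some : ∀ t → CoverBy n F t → out ≡ [] ∷ prune (n , F , t) →
           (∀ t′ → m < t′ → t′ < t → ¬ CoverBy n F t′) → Outcome m out

  none-below : ∀ m t → D (n , F , suc m) ≡ false → m < t → (suc m < t → ¬ CoverBy n F t) → ¬ CoverBy n F t
  none-below m t eq m<t above C with m≤n⇒m<n∨m≡n m<t
  ... | inj₁ lt   = above lt C
  ... | inj₂ refl = subst T eq (complete F (suc m) id C)

  outcome-step : ∀ m out → Outcome (suc m) out → Outcome m (improve (n , F) (suc m) out)
  outcome-step m out o with D (n , F , suc m) in eq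
  ... | true = some (suc m) (sound F (suc m) id (subst T (sym eq) _)) refl
    λ t′ m<t′ t′<1+m → contradiction m<t′ (≤⇒≯ (≤-pred t′<1+m))
  ... | false with o
  ... | none eq′ no-cover     = none eq′ λ t m<t t≤n → none-below m t eq m<t (λ lt → no-cover t lt t≤n)
  ... | some t C eq′ no-cover = some t C eq′ λ t′ m<t′ t′<t → none-below m t′ eq m<t′ (λ lt → no-cover t′ lt t′<t)

  outcome : ∀ m out → Outcome m out → Outcome 0 (foldl (λ out t → improve (n , F) t out) out (map suc (downFrom m)))
  outcome zero    out o = o
  outcome (suc m) out o = outcome m _ (outcome-step m out o)

  search-outcome : Outcome 0 (search (n , F))
  search-outcome = subst (Outcome 0)
    (sym (cong (λ b → when b then [] ∷ [] else foldl (λ out t → improve (n , F) t out) [] (map suc (downFrom n)))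
               (positive 1≤n)))
    (outcome n [] (none refl λ t n<t t≤n → contradiction t≤n (<⇒≱ n<t)))
    where
    positive : ∀ {m} → 1 ≤ m → isZero m ≡ false
    positive (s≤s _) = refl

-- Covers as bit lists

module _ (S : SetSystem) where

  open SetSystem S

  bitFamily : List (List Bool)
  bitFamily = map toList family

  bitFamily-unique : Unique bitFamily
  bitFamily-unique = Unique.map⁺ toList-injective distinct

  bitFamily-length : ∀ {A} → A ∈ bitFamily → length A ≡ elements
  bitFamily-length A∈ with ∈-map⁻ toList A∈
  ... | A , _ , refl = length-toList A

  encode-input : Problem.encode SetCover S ≡ enc inputTy (elements , bitFamily)
  encode-input = cong (encodeℕ elements ∙_) (encodeSubsets family)

  member-lookup : ∀ {m} (p : Subset m) x → member (toList p) (toℕ x) ≡ Vec.lookup p x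
  member-lookup (b ∷ p) zero    = refl
  member-lookup (b ∷ p) (suc x) = member-lookup p x

  ∈⇒member : ∀ {p : Subset elements} {x} → x Sub.∈ p → T (member (toList p) (toℕ x))
  ∈⇒member {p} {x} x∈ = Equivalence.from T-≡ (trans (member-lookup p x) ([]=⇒lookup x∈))

  member⇒∈ : ∀ {p : Subset elements} {x} → T (member (toList p) (toℕ x)) → x Sub.∈ p
  member⇒∈ {p} {x} m = lookup⇒[]= x p (trans (sym (member-lookup p x)) (Equivalence.to T-≡ m))

  ∈-⋃⁻ : ∀ {x} (ps : List (Subset elements)) → x Sub.∈ ⋃ ps → ∃[ p ] p ∈ ps × x Sub.∈ p
  ∈-⋃⁻ []       x∈ = contradiction x∈ ∉⊥
  ∈-⋃⁻ (p ∷ ps) x∈ with x∈p∪q⁻ p (⋃ ps) x∈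
  ... | inj₁ x∈p  = p , here refl , x∈p
  ... | inj₂ x∈ps = let q , q∈ , x∈q = ∈-⋃⁻ ps x∈ps in q , there q∈ , x∈q

  ∈-⋃⁺ : ∀ {x p} {ps : List (Subset elements)} → p ∈ ps → x Sub.∈ p → x Sub.∈ ⋃ ps
  ∈-⋃⁺ (here refl) x∈ = x∈p∪q⁺ (inj₁ x∈)
  ∈-⋃⁺ (there p∈)  x∈ = x∈p∪q⁺ (inj₂ (∈-⋃⁺ p∈ x∈))

  module _ (𝒟 : Cover S) where

    open Cover 𝒟

    choice : ∀ x → ∃[ p ] p ∈ subfamily × x Sub.∈ p
    choice x = ∈-⋃⁻ subfamily (subst (x Sub.∈_) (sym covers) ∈⊤)

    member-choice : ∀ {u} (u<n : u < elements) → T (member (toList (proj₁ (choice (fromℕ< u<n)))) u)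
    member-choice u<n = subst (λ y → T (member (toList (proj₁ (choice (fromℕ< u<n)))) y)) (toℕ-fromℕ< u<n)
      (∈⇒member (proj₂ (proj₂ (choice (fromℕ< u<n)))))

    coverBy-length : CoverBy elements bitFamily (length subfamily)
    coverBy-length = record
      { sets        = map toList subfamily
      ; length-sets = ≤-reflexive (length-map toList subfamily)
      ; sets⊆G      = λ A∈ → let p , p∈ , eq = ∈-map⁻ toList A∈ in subst (_∈ bitFamily) (sym eq) (∈-map⁺ toList (included p∈))
      ; covered     = λ u<n → _ , ∈-map⁺ toList (proj₁ (proj₂ (choice (fromℕ< u<n)))) , member-choice u<n
      }

    -- One set for each element suffices.
    coverBy-elements : CoverBy elements bitFamily elements
    coverBy-elements = record
      { sets        = tabulate (λ x → toList (proj₁ (choice x)))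
      ; length-sets = ≤-reflexive (length-tabulate (λ x → toList (proj₁ (choice x))))
      ; sets⊆G      = λ A∈ → let x , eq = ∈-tabulate⁻ A∈ in
          subst (_∈ bitFamily) (sym eq) (∈-map⁺ toList (included (proj₁ (proj₂ (choice x)))))
      ; covered     = λ u<n → _ , ∈-tabulate⁺ {f = λ x → toList (proj₁ (choice x))} (fromℕ< u<n) , member-choice u<n
      }

  toCover : ∀ R → R ⊆ bitFamily → Unique R → (∀ {u} → u < elements → ∃[ A ] A ∈ R × T (member A u)) →
            Σ (Cover S) λ 𝒞 → map toList (Cover.subfamily 𝒞) ≡ R
  toCover R R⊆ R! cov = record
    { subfamily    = Rs
    ; distinctSets = Unique.map⁻ (subst Unique (sym eq) R!)
    ; included     = incl
    ; covers       = ⊆-antisym ⊆⊤ λ {x} _ → in-union x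
    } , eq
    where
    lists = fromLists elements R (All.tabulate λ A∈ → bitFamily-length (R⊆ A∈))
    Rs = proj₁ lists
    eq : map toList Rs ≡ R
    eq = proj₂ lists
    incl : Rs ⊆ family
    incl p∈ with ∈-map⁻ toList (R⊆ (subst (_ ∈_) eq (∈-map⁺ toList p∈)))
    ... | q , q∈ , same = subst (_∈ family) (sym (toList-injective same)) q∈
    in-union : ∀ x → x Sub.∈ ⋃ Rs
    in-union x with cov (toℕ<n x)
    ... | A , A∈ , m with ∈-map⁻ toList (subst (A ∈_) (sym eq) A∈)
    ... | p , p∈ , refl = ∈-⋃⁺ p∈ (member⇒∈ m)

search-answers : ∀ (S : SetSystem) (D : El instanceTy → Bool) → let open SetSystem S in
  (∀ G t → 1 ≤ elements → G ⊆ bitFamily S → T (D (elements , G , t)) → CoverBy elements G t) →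
  (∀ G t → 1 ≤ elements → G ⊆ bitFamily S → CoverBy elements G t → T (D (elements , G , t))) →
  Problem.Answer SetCover S (enc (list setTy) (Search.search D (elements , bitFamily S)))
search-answers S D sound complete = by-size (SetSystem.elements S ≟ 0)
  where
  open SetSystem S
  F = bitFamily S
  by-size : Dec (elements ≡ 0) → Problem.Answer SetCover S (enc (list setTy) (Search.search D (elements , F)))
  by-size (yes n≡0) = inj₁ (empty , (λ _ → z≤n) , encoded)
    where
    empty : Cover S
    empty = record
      { subfamily = [] ; distinctSets = [] ; included = λ ()
      ; covers = ⊆-antisym ⊆⊤ λ {x} _ → contradiction (subst Fin n≡0 x) λ () }
    encoded : enc (list setTy) (Search.search D (elements , F)) ≡ nil ∙ nil
    encoded = cong (λ b → enc (list setTy) (when b then [] ∷ [] else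
      foldl (λ out t → Search.improve D (elements , F) t out) [] (map suc (downFrom elements))))
      (cong isZero n≡0)
  by-size (no n≢0) = from-outcome search-outcome
    where
    1≤n : 1 ≤ elements
    1≤n = n≢0⇒n>0 n≢0
    open SearchCorrect D elements 1≤n F (bitFamily-unique S) (λ G t → sound G t 1≤n) (λ G t → complete G t 1≤n)
    from-outcome : ∀ {out} → Outcome 0 out → Problem.Answer SetCover S (enc (list setTy) out)
    from-outcome (none refl no-cover) =
      inj₂ ((λ 𝒟 → no-cover elements 1≤n ≤-refl (coverBy-elements S 𝒟)) , refl)
    from-outcome (some t C refl no-cover) with prune-correct t C
    ... | R⊆F , R! , R≤t , cov = inj₁ (𝒞 , minimal , cong (nil ∙_)
        (sym (trans (encodeSubsets (Cover.subfamily 𝒞)) (cong (enc (list setTy)) eq))))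
      where
      result = toCover S (Search.prune D (elements , F , t)) R⊆F R! cov
      𝒞 = proj₁ result
      eq = proj₂ result
      length-𝒞 : length (Cover.subfamily 𝒞) ≤ t
      length-𝒞 = ≤-trans (≤-reflexive (trans (sym (length-map toList (Cover.subfamily 𝒞))) (cong length eq))) R≤t
      minimal : IsMinimum 𝒞
      minimal 𝒟 with length (Cover.subfamily 𝒟) <? t
      ... | no  ≮t = ≤-trans length-𝒞 (≮⇒≥ ≮t)
      ... | yes <t = contradiction (coverBy-length S 𝒟) (nonempty (length (Cover.subfamily 𝒟)) <t)
        where
        nonempty : ∀ l → l < t → ¬ CoverBy elements F l
        -- Budget 0 is not among those tried, but no sets at all cannot cover a nonempty ground set.
        nonempty zero    _   = no-empty-cover
        nonempty (suc l) l<t = no-cover (suc l) (s≤s z≤n) l<t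

-- Exponents

module ExponentArithmetic where

  open ℤ using (+_)

  minus-homo : ∀ p q → ℚ.toℚᵘ (p ℚ.- q) ℚᵘ.≃ ℚ.toℚᵘ p ℚᵘ.- ℚ.toℚᵘ q
  minus-homo p q = ℚᵘₚ.≃-trans (ℚₚ.toℚᵘ-homo-+ p (ℚ.- q)) (ℚᵘₚ.+-congʳ (ℚ.toℚᵘ p) (ℚₚ.toℚᵘ-homo‿- q))

  cross-multiply : ∀ p q → ℚ.toℚᵘ p ℚᵘ.≃ q → ↥ p ℤ.* ℚᵘ.↧ q ≡ ℚᵘ.↥ q ℤ.* ↧ p
  cross-multiply record{} q (ℚᵘ.*≡* eq) = eq

  module _ (g e-1 : ℕ) .(c : Coprime g (suc e-1)) where

    private
      γ : ℚ
      γ = mkℚ (+ g) e-1 c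
      e = suc e-1

    -- (1 - γ) + γ = 1, cross-multiplied. The reduced numerator and denominator are not computed;
    -- only this relation between them is used.
    one-minus-γ : ↥ (1ℚ ℚ.- γ) ℤ.* + e ℤ.+ + g ℤ.* ↧ (1ℚ ℚ.- γ) ≡ + e ℤ.* ↧ (1ℚ ℚ.- γ)
    one-minus-γ = trans
      (cong (ℤ._+ + g ℤ.* D) (trans (cong (λ m → ↥ (1ℚ ℚ.- γ) ℤ.* + m) (sym (*-identityˡ e)))
        (cross-multiply (1ℚ ℚ.- γ) _ (minus-homo 1ℚ γ))))
      (ℤS.solve 3 (λ E G D → (ℤS.con (+ 1) ℤS.:* E ℤS.:+ (ℤS.:- G) ℤS.:* ℤS.con (+ 1)) ℤS.:* D ℤS.:+ G ℤS.:* D ℤS.:= E ℤS.:* D)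
        refl (+ e) (+ g) D)
      where D = ↧ (1ℚ ℚ.- γ)

    -- α + γ = s / (s + 1), cross-multiplied.
    hyperPath-exponent : ∀ s → let α = 1ℚ ℚ.- + 1 ℚ./ suc s ℚ.- γ in
      ↥ α ℤ.* (+ suc s ℤ.* + e) ℤ.+ + g ℤ.* + suc s ℤ.* ↧ α ≡ + s ℤ.* + e ℤ.* ↧ α
    hyperPath-exponent s = trans
      (cong (ℤ._+ + g ℤ.* + suc s ℤ.* D) (trans (cong (↥ α ℤ.*_) (trans (sym (ℤₚ.pos-* (suc s) e))
          (cong (λ m → + (m * e)) (sym (*-identityˡ (suc s))))))
        (trans (cross-multiply α _ (ℚᵘₚ.≃-trans (minus-homo (1ℚ ℚ.- + 1 ℚ./ suc s) γ)
            (ℚᵘₚ.+-congˡ (ℚᵘ.- ℚ.toℚᵘ γ) (ℚᵘₚ.≃-trans (minus-homo 1ℚ (+ 1 ℚ./ suc s))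
              (ℚᵘₚ.+-congʳ (ℚ.toℚᵘ 1ℚ) (ℚᵘₚ.-‿cong (ℚₚ.toℚᵘ-fromℚᵘ (ℚᵘ.mkℚᵘ (+ 1) s))))))))
          (cong (λ m → ((+ 1 ℤ.* + suc s ℤ.+ (ℤ.- + 1) ℤ.* + 1) ℤ.* + e ℤ.+ (ℤ.- + g) ℤ.* + m) ℤ.* D) (*-identityˡ (suc s))))))
      (ℤS.solve 4 (λ s E G D →
          ((ℤS.con (+ 1) ℤS.:* (ℤS.con (+ 1) ℤS.:+ s) ℤS.:+ ℤS.con (ℤ.- + 1) ℤS.:* ℤS.con (+ 1)) ℤS.:* E ℤS.:+ (ℤS.:- G) ℤS.:* (ℤS.con (+ 1) ℤS.:+ s)) ℤS.:* D
            ℤS.:+ G ℤS.:* (ℤS.con (+ 1) ℤS.:+ s) ℤS.:* D ℤS.:= s ℤS.:* E ℤS.:* D)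
        refl (+ s) (+ e) (+ g) D)
      where
      α = 1ℚ ℚ.- + 1 ℚ./ suc s ℚ.- γ
      D = ↧ α

  module _ {a s e g D : ℕ} where

    hyperPath-exponentℕ : + a ℤ.* (+ suc s ℤ.* + e) ℤ.+ + g ℤ.* + suc s ℤ.* + D ≡ + s ℤ.* + e ℤ.* + D →
      a * (suc s * e) + g * suc s * D ≡ s * e * D
    hyperPath-exponentℕ eq = ℤₚ.+-injective (begin
      + (a * (suc s * e) + g * suc s * D)                            ≡⟨ ℤₚ.pos-+ (a * (suc s * e)) (g * suc s * D) ⟩
      + (a * (suc s * e)) ℤ.+ + (g * suc s * D)                       ≡⟨ cong₂ ℤ._+_
        (trans (ℤₚ.pos-* a (suc s * e)) (cong (+ a ℤ.*_) (ℤₚ.pos-* (suc s) e)))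
        (trans (ℤₚ.pos-* (g * suc s) D) (cong (ℤ._* + D) (ℤₚ.pos-* g (suc s)))) ⟩
      + a ℤ.* (+ suc s ℤ.* + e) ℤ.+ + g ℤ.* + suc s ℤ.* + D           ≡⟨ eq ⟩
      + s ℤ.* + e ℤ.* + D                                             ≡⟨ trans (ℤₚ.pos-* (s * e) D) (cong (ℤ._* + D) (ℤₚ.pos-* s e)) ⟨
      + (s * e * D)                                                   ∎)
      where open ≡-Reasoning

    -- Follows from α ≥ 0 and α + γ = s / (s + 1).
    γ≤1 : a * (suc s * suc e) + g * suc s * suc D ≡ s * suc e * suc D → g ≤ suc e
    γ≤1 eq = *-cancelʳ-≤ g (suc e) (suc s) (*-cancelʳ-≤ (g * suc s) (suc e * suc s) (suc D) (begin
      g * suc s * suc D                               ≤⟨ m≤n+m _ (a * (suc s * suc e)) ⟩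
      a * (suc s * suc e) + g * suc s * suc D         ≡⟨ eq ⟩
      s * suc e * suc D                               ≤⟨ *-monoˡ-≤ (suc D) (≤-trans (*-monoˡ-≤ (suc e) (n≤1+n s)) (≤-reflexive (*-comm (suc s) (suc e)))) ⟩
      suc e * suc s * suc D                           ∎))
      where open ≤-Reasoning

  nonnegative-exponent : ∀ {x e g D} → g ≤ suc e → x ℤ.* + suc e ℤ.+ + g ℤ.* + D ≡ + suc e ℤ.* + D →
    ∃[ b ] x ≡ + b × b * suc e + g * D ≡ suc e * D
  nonnegative-exponent {+ b} {e} {g} {D} g≤e eq = b , refl , ℤₚ.+-injective (begin
    + (b * suc e + g * D)               ≡⟨ ℤₚ.pos-+ (b * suc e) (g * D) ⟩
    + (b * suc e) ℤ.+ + (g * D)         ≡⟨ cong₂ ℤ._+_ (ℤₚ.pos-* b (suc e)) (ℤₚ.pos-* g D) ⟩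
    + b ℤ.* + suc e ℤ.+ + g ℤ.* + D     ≡⟨ eq ⟩
    + suc e ℤ.* + D                     ≡⟨ ℤₚ.pos-* (suc e) D ⟨
    + (suc e * D)                       ∎)
    where open ≡-Reasoning
  nonnegative-exponent { -[1+ b ]} {e} {g} {D} g≤e eq = contradiction
    (≤-trans (≤-reflexive equation) (*-monoˡ-≤ D g≤e)) (<⇒≱ (m<m+n (suc e * D) (s≤s z≤n)))
    where
    open ≡-Reasoning
    equation : suc e * D + suc b * suc e ≡ g * D
    equation = ℤₚ.+-injective (begin
      + (suc e * D + suc b * suc e)                                     ≡⟨ trans (ℤₚ.pos-+ (suc e * D) (suc b * suc e))
        (cong₂ ℤ._+_ (ℤₚ.pos-* (suc e) D) (ℤₚ.pos-* (suc b) (suc e))) ⟩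
      + suc e ℤ.* + D ℤ.+ + suc b ℤ.* + suc e                           ≡⟨ cong (ℤ._+ + suc b ℤ.* + suc e) (sym eq) ⟩
      -[1+ b ] ℤ.* + suc e ℤ.+ + g ℤ.* + D ℤ.+ + suc b ℤ.* + suc e      ≡⟨ ℤS.solve 3 (λ B E H →
        (ℤS.:- B) ℤS.:* E ℤS.:+ H ℤS.:+ B ℤS.:* E ℤS.:= H) refl (+ suc b) (+ suc e) (+ g ℤ.* + D) ⟩
      + g ℤ.* + D                                                       ≡⟨ ℤₚ.pos-* g D ⟨
      + (g * D)                                                         ∎)

  -- In rationals, α (s + 1) (B + 1) = s (B + 1) - γ (s + 1) (B + 1), which is at most n + 5 s - γ
  -- n. The γ term is `excess`; it is added on both sides to avoid subtraction.
  exponent-≤ : ∀ {a s e g D b D′ n B} → a * (suc s * suc e) + g * suc s * D ≡ s * suc e * D →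
    b * suc e + g * D′ ≡ suc e * D′ → n ≤ s * B → s * B ≤ n + s * 4 →
    a * (suc s * suc B) * D′ ≤ b * n * D + s * 5 * D′ * D
  exponent-≤ {a} {s} {e} {g} {D} {b} {D′} {n} {B} eq₁ eq₂ n≤ ≤n = *-cancelʳ-≤ _ _ (suc e) (+-cancelʳ-≤ excess _ _ (begin
    a * (suc s * suc B) * D′ * suc e + excess
      ≡⟨ solve 7 (λ a s B D′ e g D → a :* ((con 1 :+ s) :* (con 1 :+ B)) :* D′ :* e :+ g :* (con 1 :+ s) :* D :* (D′ :* (con 1 :+ B))
            ⊜ (a :* ((con 1 :+ s) :* e) :+ g :* (con 1 :+ s) :* D) :* (D′ :* (con 1 :+ B))) refl a s B D′ (suc e) g D ⟩
    (a * (suc s * suc e) + g * suc s * D) * (D′ * suc B)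
      ≡⟨ cong (_* (D′ * suc B)) eq₁ ⟩
    s * suc e * D * (D′ * suc B)
      ≡⟨ solve 5 (λ s B D′ e D → s :* e :* D :* (D′ :* (con 1 :+ B)) ⊜ (s :* B :+ s) :* (e :* D′ :* D)) refl s B D′ (suc e) D ⟩
    (s * B + s) * (suc e * D′ * D)
      ≤⟨ *-monoˡ-≤ (suc e * D′ * D) (+-monoˡ-≤ s ≤n) ⟩
    (n + s * 4 + s) * (suc e * D′ * D)
      ≡⟨ solve 5 (λ n s D′ e D → (n :+ s :* con 4 :+ s) :* (e :* D′ :* D) ⊜ e :* D′ :* (n :* D) :+ s :* con 5 :* D′ :* D :* e) refl n s D′ (suc e) D ⟩
    suc e * D′ * (n * D) + s * 5 * D′ * D * suc e
      ≡⟨ cong (λ x → x * (n * D) + s * 5 * D′ * D * suc e) (sym eq₂) ⟩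
    (b * suc e + g * D′) * (n * D) + s * 5 * D′ * D * suc e
      ≡⟨ solve 7 (λ n s D′ e D b g → (b :* e :+ g :* D′) :* (n :* D) :+ s :* con 5 :* D′ :* D :* e
            ⊜ (b :* n :* D :+ s :* con 5 :* D′ :* D) :* e :+ g :* D :* D′ :* n) refl n s D′ (suc e) D b g ⟩
    (b * n * D + s * 5 * D′ * D) * suc e + g * D * D′ * n
      ≤⟨ +-monoʳ-≤ ((b * n * D + s * 5 * D′ * D) * suc e) (*-monoʳ-≤ (g * D * D′)
           (≤-trans n≤ (*-mono-≤ (n≤1+n s) (n≤1+n B)))) ⟩
    (b * n * D + s * 5 * D′ * D) * suc e + g * D * D′ * (suc s * suc B)
      ≡⟨ cong (λ x → (b * n * D + s * 5 * D′ * D) * suc e + x) (solve 5 (λ s B D′ g D → g :* D :* D′ :* ((con 1 :+ s) :* (con 1 :+ B)) ⊜ g :* (con 1 :+ s) :* D :* (D′ :* (con 1 :+ B))) refl s B D′ g D) ⟩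
    (b * n * D + s * 5 * D′ * D) * suc e + excess ∎))
    where
    open ≤-Reasoning
    excess = g * suc s * D * (D′ * suc B)

  root-mono : ∀ D {x y} → x ^ suc D ≤ y ^ suc D → x ≤ y
  root-mono D {x} {y} le = ≮⇒≥ λ y<x → <⇒≱ (^-monoˡ-< (suc D) y<x) le

  -- Oracle times are bounded only through their powers. The integer root turns such a bound into
  -- one number that dominates every call and still satisfies the power inequality.
  root : ∀ D M → ∃[ ρ ] ρ ^ suc D ≤ M × (∀ x → x ^ suc D ≤ M → x ≤ ρ)
  root D M = let ρ , le , max = greatest M in ρ , le , λ x x^D≤M → max x (≤-trans (base≤power x) x^D≤M) x^D≤M
    where
    base≤power : ∀ x → x ≤ x ^ suc D
    base≤power zero    = z≤n
    base≤power (suc x) = m≤m*n (suc x) (suc x ^ D) ⦃ m^n≢0 (suc x) D ⦄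
    greatest : ∀ u → ∃[ ρ ] ρ ^ suc D ≤ M × (∀ x → x ≤ u → x ^ suc D ≤ M → x ≤ ρ)
    greatest zero    = 0 , z≤n , λ x x≤0 _ → x≤0
    greatest (suc u) with suc u ^ suc D ≤? M
    ... | yes le = suc u , le , λ x x≤ _ → x≤
    ... | no ¬le = let ρ , le , max = greatest u in ρ , le , λ x x≤ x^D≤M → max x (smaller x x≤ x^D≤M) x^D≤M
      where
      smaller : ∀ x → x ≤ suc u → x ^ suc D ≤ M → x ≤ u
      smaller x x≤ le with m≤n⇒m<n∨m≡n x≤
      ... | inj₁ x<   = ≤-pred x<
      ... | inj₂ refl = contradiction le ¬le

  ^-distribʳ-* : ∀ n x y → (x * y) ^ n ≡ x ^ n * y ^ n
  ^-distribʳ-* zero    x y = refl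
  ^-distribʳ-* (suc n) x y = trans (cong (x * y *_) (^-distribʳ-* n x y))
    (solve 4 (λ x y a b → x :* y :* (a :* b) ⊜ x :* a :* (y :* b)) refl x y (x ^ n) (y ^ n))

  -- Exchanges the denominator `suc D` of one exponent for the `D′` of the other by comparing
  -- `suc D`-th powers of both sides. The additive error `c` in the exponent becomes the constant
  -- factor `2 ^ c`.
  power-≤ : ∀ {ρ P D D′ A c A′} → ρ ^ suc D ≤ P ^ suc D * 2 ^ A → A * D′ ≤ A′ * suc D + c * D′ * suc D →
            ρ ^ D′ ≤ (P * 2 ^ c) ^ D′ * 2 ^ A′
  power-≤ {ρ} {P} {D} {D′} {A} {c} {A′} le ≤A = root-mono D (begin
    (ρ ^ D′) ^ suc D                                ≡⟨ swap-powers ρ D′ (suc D) ⟩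
    (ρ ^ suc D) ^ D′                                ≤⟨ ^-monoˡ-≤ D′ le ⟩
    (P ^ suc D * 2 ^ A) ^ D′                        ≡⟨ ^-distribʳ-* D′ (P ^ suc D) (2 ^ A) ⟩
    (P ^ suc D) ^ D′ * (2 ^ A) ^ D′                 ≡⟨ cong₂ _*_ (swap-powers P (suc D) D′) (^-*-assoc 2 A D′) ⟩
    (P ^ D′) ^ suc D * 2 ^ (A * D′)                 ≤⟨ *-monoʳ-≤ ((P ^ D′) ^ suc D) (^-monoʳ-≤ 2 ≤A) ⟩
    (P ^ D′) ^ suc D * 2 ^ (A′ * suc D + c * D′ * suc D)
      ≡⟨ cong ((P ^ D′) ^ suc D *_) (trans (^-distribˡ-+-* 2 (A′ * suc D) (c * D′ * suc D))
          (cong₂ _*_ (sym (^-*-assoc 2 A′ (suc D))) (trans (sym (^-*-assoc 2 (c * D′) (suc D))) (cong (_^ suc D) (sym (^-*-assoc 2 c D′)))))) ⟩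
    (P ^ D′) ^ suc D * ((2 ^ A′) ^ suc D * ((2 ^ c) ^ D′) ^ suc D)
      ≡⟨ solve 3 (λ x y z → x :* (y :* z) ⊜ x :* z :* y) refl ((P ^ D′) ^ suc D) ((2 ^ A′) ^ suc D) (((2 ^ c) ^ D′) ^ suc D) ⟩
    (P ^ D′) ^ suc D * ((2 ^ c) ^ D′) ^ suc D * (2 ^ A′) ^ suc D
      ≡⟨ cong (_* (2 ^ A′) ^ suc D) (trans (sym (^-distribʳ-* (suc D) (P ^ D′) ((2 ^ c) ^ D′))) (cong (_^ suc D) (sym (^-distribʳ-* D′ P (2 ^ c))))) ⟩
    ((P * 2 ^ c) ^ D′) ^ suc D * (2 ^ A′) ^ suc D   ≡⟨ sym (^-distribʳ-* (suc D) ((P * 2 ^ c) ^ D′) (2 ^ A′)) ⟩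
    ((P * 2 ^ c) ^ D′ * 2 ^ A′) ^ suc D             ∎)
    where
    open ≤-Reasoning
    swap-powers : ∀ x m n → (x ^ m) ^ n ≡ (x ^ n) ^ m
    swap-powers x m n = trans (^-*-assoc x m n) (trans (cong (x ^_) (*-comm m n)) (sym (^-*-assoc x n m)))

  unfold-nonnegative : ∀ {α a} → ↥ α ≡ + a → ∀ {T P x} → T ≤ P ·2^[ α · x ] → T ^ ↧ₙ α ≤ P ^ ↧ₙ α * 2 ^ (a * x)
  unfold-nonnegative {α} eq le with ↥ α | eq
  ... | _ | refl = le

  fold-nonnegative : ∀ {α a} → ↥ α ≡ + a → ∀ {T P x} → T ^ ↧ₙ α ≤ P ^ ↧ₙ α * 2 ^ (a * x) → T ≤ P ·2^[ α · x ]
  fold-nonnegative {α} eq le with ↥ α | eq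
  ... | _ | refl = le

  unfold-negative : ∀ {α a} → ↥ α ≡ -[1+ a ] → ∀ {T P x} → T ≤ P ·2^[ α · x ] → T ^ ↧ₙ α * 2 ^ (suc a * x) ≤ P ^ ↧ₙ α
  unfold-negative {α} eq le with ↥ α | eq
  ... | _ | refl = le

  -- All that the algorithm has to know about the two rationals. The exponent α is negative exactly
  -- when γ exceeds s / (s + 1); then no oracle exists.
  data Exponents (α β : ℚ) (s : ℕ) : Set where
    negative : ∀ D a → (∀ {T P x} → T ≤ P ·2^[ α · x ] → T ^ D * 2 ^ (suc a * x) ≤ P ^ D) → Exponents α β s
    nonnegative : ∀ D a D′ b →
      (∀ {T P x} → T ≤ P ·2^[ α · x ] → T ^ suc D ≤ P ^ suc D * 2 ^ (a * x)) →
      (∀ {T P x} → T ^ D′ ≤ P ^ D′ * 2 ^ (b * x) → T ≤ P ·2^[ β · x ]) →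
      (∀ n B → n ≤ s * B → s * B ≤ n + s * 4 → a * (suc s * suc B) * D′ ≤ b * n * suc D + s * 5 * D′ * suc D) →
      Exponents α β s

  exponents : ∀ γ → 0ℚ ℚ.< γ → ∀ s → Exponents (1ℚ ℚ.- + 1 ℚ./ suc s ℚ.- γ) (1ℚ ℚ.- γ) s
  exponents (mkℚ -[1+ g ] e c) (ℚ.*<* ()) s
  exponents (mkℚ (+ g) e c) _ s = by-sign (↥ α) refl
    where
    α = 1ℚ ℚ.- + 1 ℚ./ suc s ℚ.- mkℚ (+ g) e c
    β = 1ℚ ℚ.- mkℚ (+ g) e c
    D = ℚ.ℚ.denominator-1 α
    by-sign : ∀ x → ↥ α ≡ x → Exponents α β s
    by-sign -[1+ a ] eq = negative (suc D) a (λ {T} {P} {x} → unfold-negative {α} eq {T} {P} {x})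
    by-sign (+ a)    eq =
      let eq₁ = hyperPath-exponentℕ {a} {s} {suc e} {g} {suc D}
                  (subst (λ x → x ℤ.* (+ suc s ℤ.* + suc e) ℤ.+ + g ℤ.* + suc s ℤ.* ↧ α ≡ + s ℤ.* + suc e ℤ.* ↧ α) eq
                    (hyperPath-exponent g e c s))
          b , eq′ , eq₂ = nonnegative-exponent {↥ β} {e} {g} {↧ₙ β} (γ≤1 {a} {s} {e} {g} {D} eq₁) (one-minus-γ g e c)
      in nonnegative D a (↧ₙ β) b (λ {T} {P} {x} → unfold-nonnegative {α} eq {T} {P} {x})
           (λ {T} {P} {x} → fold-nonnegative {β} eq′ {T} {P} {x})
           (λ n B n≤ ≤n → exponent-≤ {a} {s} {e} {g} {suc D} {b} {↧ₙ β} {n} {B} eq₁ eq₂ n≤ ≤n)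

open ExponentArithmetic

-- Assembling the algorithm

time-positive : ∀ {c σ t σ′} → ⟨ c , σ ⟩⇓[ t ] σ′ → 1 ≤ t
time-positive ⇓-skip         = s≤s z≤n
time-positive ⇓-:=           = s≤s z≤n
time-positive (⇓-⨟ p _)      = ≤-trans (time-positive p) (m≤m+n _ _)
time-positive (⇓-then _ _)   = s≤s z≤n
time-positive (⇓-else _ _)   = s≤s z≤n
time-positive (⇓-stop _)     = s≤s z≤n
time-positive (⇓-loop _ _ _) = s≤s z≤n

-- A negative exponent would force the running time below 1 for long paths.
no-negative-exponent : ∀ {r α D a} → (∀ {T P x} → T ≤ P ·2^[ α · x ] → T ^ D * 2 ^ (suc a * x) ≤ P ^ D) →
  ¬ HyperPath r SolvableInTimeO*2^[ α ]
no-negative-exponent {r} {α} {D} {a} unfold (prog , C , d , solves) = fast (solves (empty , k))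
  where
  empty : UniformHypergraph r
  empty = record { nodes = 0 ; edges = [] ; distinct = [] ; uniform = [] }
  -- The size counts nodes and hyperedges but not the path length, so `P` is a constant and `k` can
  -- be chosen after it; with `k = P ^ D` the number `2 ^ k` exceeds `P ^ D`.
  P = C * 1 ^ d
  k = P ^ D
  fast : ¬ (∃[ out ] ∃[ T ] prog on Problem.encode (HyperPath r) (empty , k) outputs out inTime T
            × Problem.Answer (HyperPath r) (empty , k) out × T ≤ P ·2^[ α · k ])
  fast (_ , T , (_ , run , _) , _ , le) = <⇒≱ (n<2^n k) (begin
    2 ^ k                      ≤⟨ ^-monoʳ-≤ 2 (m≤m+n k (a * k)) ⟩
    2 ^ (suc a * k)            ≤⟨ m≤n*m (2 ^ (suc a * k)) (T ^ D) ⦃ >-nonZero (m^n>0 T ⦃ >-nonZero (time-positive run) ⦄ D) ⦄ ⟩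
    T ^ D * 2 ^ (suc a * k)    ≤⟨ unfold le ⟩
    k                          ∎)
    where open ≤-Reasoning

size-bitFamily : ∀ {n} (ps : List (Subset n)) → size (list setTy) (map toList ps) ≤ length ps * (1 + 2 * n)
size-bitFamily []       = z≤n
size-bitFamily {n} (p ∷ ps) = s≤s (+-mono-≤ (size-bits p) (size-bitFamily ps))
  where
  size-bits : ∀ {n} (p : Subset n) → size setTy (toList p) ≤ 2 * n
  size-bits []      = z≤n
  size-bits {suc n} (b ∷ p) = ≤-trans (s≤s (+-mono-≤ (size-bool b) (size-bits p))) (≤-reflexive (sym (*-suc 2 n)))

-- The square is due to the encoding: m subsets of n elements take about n m bits, while the size of
-- the instance counts only n + m.
size-setSystem : ∀ S → let open SetSystem S in
  2 + size inputTy (elements , bitFamily S) ≤ 3 * suc (elements + length family) ^ 2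
size-setSystem S = begin
  3 + (size nat n + size (list setTy) (bitFamily S)) ≤⟨ +-monoʳ-≤ 3 (+-mono-≤ (≤-reflexive (size-nat n)) (size-bitFamily family)) ⟩
  3 + (n + m * (1 + 2 * n))                          ≤⟨ m≤m+n _ (5 * n + 5 * m + 3 * n * n + 4 * n * m + 3 * m * m) ⟩
  3 + (n + m * (1 + 2 * n)) + (5 * n + 5 * m + 3 * n * n + 4 * n * m + 3 * m * m)
    ≡⟨ solve 2 (λ n m → con 3 :+ (n :+ m :* (con 1 :+ con 2 :* n)) :+ (con 5 :* n :+ con 5 :* m :+ con 3 :* n :* n :+ con 4 :* n :* m :+ con 3 :* m :* m)
         ⊜ con 3 :* ((con 1 :+ (n :+ m)) :* ((con 1 :+ (n :+ m)) :* con 1))) refl n m ⟩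
  3 * suc (n + m) ^ 2                                ∎
  where
  open ≤-Reasoning
  open SetSystem S
  n = elements
  m = length family

module Algorithm (s : ℕ) (1≤s : 1 ≤ s) {α : ℚ} (prog : Cmd) (C d : ℕ)
  (solves : (J : UniformHypergraph (2 + s) × ℕ) → ∃[ out ] ∃[ T ]
     prog on Problem.encode (HyperPath (2 + s)) J outputs out inTime T
     × Problem.Answer (HyperPath (2 + s)) J out
     × T ≤ C * suc (Problem.size (HyperPath (2 + s)) J) ^ d ·2^[ α · proj₂ J ]) where

  private
    query : El instanceTy → UniformHypergraph (2 + s) × ℕ
    query I = hypergraph s I , pathLength s I

    Decides : UniformHypergraph (2 + s) × ℕ → Bool → Set
    Decides (H , k) true  = TightPath H k
    Decides (H , k) false = ¬ TightPath H k

    decision : ∀ J {out} → Problem.Answer (HyperPath (2 + s)) J out → ∃[ b ] out ≡ encodeBool b × Decides J b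
    decision J (inj₁ (path , eq)) = true , eq , path
    decision J (inj₂ (none , eq)) = false , eq , none

    answer : ∀ J → ∃[ b ] _ ≡ encodeBool b × Decides J b
    answer J = decision J (proj₁ (proj₂ (proj₂ (proj₂ (solves J)))))

    answerTime : UniformHypergraph (2 + s) × ℕ → ℕ
    answerTime J = proj₁ (proj₂ (solves J))

    run : ∀ J → prog on Problem.encode (HyperPath (2 + s)) J outputs encodeBool (proj₁ (answer J)) inTime answerTime J
    run J = subst (λ out → prog on _ outputs out inTime answerTime J) (proj₁ (proj₂ (answer J)))
      (proj₁ (proj₂ (proj₂ (solves J))))

    decide : El instanceTy → Bool
    decide I = proj₁ (answer (query I))

    opaque
      reduceₚ : Poly instanceTy (nat ⊗ list setTy ⊗ nat) (reduction s)
      reduceₚ = reductionₚ s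

    oracleTime : El instanceTy → ℕ
    oracleTime I = reduceₚ .time I + ((1 + 2 * vars prog) + answerTime (query I))

    oracle : Comp instanceTy bool decide oracleTime
    oracle .code = compF (reduceₚ .comp .code) (callF prog)
    oracle .correct I = computes-comp {f = reduceₚ .comp .code} {g = callF prog} (reduceₚ .comp .correct I)
      (subst (λ x → Computes (callF prog) x (encodeBool (decide I))
          ((1 + 2 * vars prog) + answerTime (query I))) (encode-hypergraph s I (pathLength s I))
        (computes-call prog (run (query I))))

    sound : ∀ n G t → T (decide (n , G , t)) → CoverBy n G t
    sound n G t yes! with answer (query (n , G , t))
    ... | true , _ , path = tightPath⇒cover 1≤s n G t path

    complete : ∀ n G t → 1 ≤ n → (∀ {A} → A ∈ G → length A ≡ n) → CoverBy n G t → T (decide (n , G , t))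
    complete n G t 1≤n lengths cov with answer (query (n , G , t))
    ... | true  , _ , _       = _
    ... | false , _ , no-path = no-path (cover⇒tightPath 1≤s n G t 1≤n lengths cov)

    open Search decide

    algorithm : Comp inputTy (list setTy) search (timeOf (searchC oracle))
    algorithm = searchComp oracle

    open Bounded (search-bounded oracle)

    -- `z` bounds the size of every queried instance, `R` and `Z` the time and output size of the
    -- reduction on it, and `P` the polynomial factor in the time of the oracle. `Q` is the overhead
    -- of the search, and `W` collects everything polynomial; `2 ^ (s * 5)` pays for padding and the
    -- extra row of the path.
    z R Z P Q W : El inputTy → ℕ
    z a = 5 + 4 * size inputTy a
    R a = z a ^ reduceₚ .timeBound .degree
    Z a = z a ^ reduceₚ .sizeBound .degree
    P a = C * suc (Z a) ^ d
    Q a = factor a * (3 + (R a + 2 * vars prog))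
    W a = Q a * (P a * 2 ^ (s * 5))

    z-poly : PolyBounded {inputTy} z
    z-poly = pb-+ (pb-const 5) (pb-* (pb-const 4) pb-size)

    Q-poly : PolyBounded {inputTy} Q
    Q-poly = pb-* polyB (pb-+ (pb-const 3)
      (pb-+ (pb-^ z-poly (reduceₚ .timeBound .degree)) (pb-const (2 * vars prog))))

    P-poly : PolyBounded {inputTy} P
    P-poly = pb-* (pb-const C) (pb-^ (pb-+ (pb-const 1) (pb-^ z-poly (reduceₚ .sizeBound .degree))) d)

    W-poly : PolyBounded {inputTy} W
    W-poly = pb-* Q-poly (pb-* P-poly (pb-const (2 ^ (s * 5))))

    w = W-poly .degree

    size-instance : ∀ {n F G t} → size (list setTy) G ≤ size (list setTy) F → t ≤ n →
      2 + size instanceTy (n , G , t) ≤ z (n , F)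
    size-instance {n} {F} {G} {t} G≤F t≤n = begin
      2 + (1 + size nat n + (1 + size (list setTy) G + size nat t))
        ≤⟨ +-monoʳ-≤ 2 (s≤s (+-monoʳ-≤ (size nat n) (s≤s (+-mono-≤ G≤F t≤)))) ⟩
      2 + (1 + x + (1 + f + x))      ≤⟨ m≤m+n _ (5 + (2 * x + 3 * f)) ⟩
      2 + (1 + x + (1 + f + x)) + (5 + (2 * x + 3 * f))
        ≡⟨ solve 2 (λ x f → con 2 :+ (con 1 :+ x :+ (con 1 :+ f :+ x)) :+ (con 5 :+ (con 2 :* x :+ con 3 :* f))
             ⊜ con 5 :+ con 4 :* (con 1 :+ x :+ f)) refl x f ⟩
      5 + 4 * (1 + x + f)            ∎
      where
      open ≤-Reasoning
      x = size nat n
      f = size (list setTy) F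
      t≤ : size nat t ≤ x
      t≤ = ≤-trans (≤-reflexive (size-nat t)) (≤-trans t≤n (≤-reflexive (sym (size-nat n))))

    size-query : ∀ I → Problem.size (HyperPath (2 + s)) (query I) ≤ size (nat ⊗ list setTy ⊗ nat) (reduction s I)
    size-query I = ≤-trans (+-mono-≤ (≤-reflexive (sym (size-nat (length (labels s I))))) edges≤)
      (≤-trans (+-monoʳ-≤ (size nat (length (labels s I))) (≤-trans (m≤m+n _ _) (n≤1+n _))) (n≤1+n _))
      where
      edges≤ : length (UniformHypergraph.edges (hypergraph s I)) ≤ size (list setTy) (hyperedges s I)
      edges≤ = ≤-trans (≤-reflexive (length-edges s I)) (length≤size (hyperedges s I))

  module _ {β : ℚ} (D a D′ b : ℕ)
    (unfold : ∀ {T P x} → T ≤ P ·2^[ α · x ] → T ^ suc D ≤ P ^ suc D * 2 ^ (a * x))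
    (fold : ∀ {T P x} → T ^ D′ ≤ P ^ D′ * 2 ^ (b * x) → T ≤ P ·2^[ β · x ])
    (exponent : ∀ n B → n ≤ s * B → s * B ≤ n + s * 4 →
      a * (suc s * suc B) * D′ ≤ b * n * suc D + s * 5 * D′ * suc D) where

    private module _ (S : SetSystem) where

      open SetSystem S

      n = elements
      F = bitFamily S
      input : El inputTy
      input = n , F
      k = suc s * suc (blocks s n)

      roots = root D (P input ^ suc D * 2 ^ (a * k))
      ρ = proj₁ roots

      answer≤ρ : ∀ G t → size (list setTy) G ≤ size (list setTy) F → t ≤ n → answerTime (query (n , G , t)) ≤ ρ
      answer≤ρ G t G≤F t≤n = proj₂ (proj₂ roots) _ (≤-trans (unfold (proj₂ (proj₂ (proj₂ (proj₂ (solves (query I)))))))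
        (*-monoˡ-≤ (2 ^ (a * k)) (^-monoˡ-≤ (suc D) (*-monoʳ-≤ C (^-monoˡ-≤ d (s≤s
          (≤-trans (size-query I) (≤-trans (reduceₚ .sizeBound .bounded I)
            (^-monoˡ-≤ (reduceₚ .sizeBound .degree) (size-instance {n} {F} {G} {t} G≤F t≤n))))))))))
        where I = n , G , t

      -- Allows additive terms to be absorbed into a multiple of `ρ`.
      1≤ρ : 1 ≤ ρ
      1≤ρ = ≤-trans (time-positive (proj₁ (proj₂ (run (query (n , F , 0)))))) (answer≤ρ F 0 ≤-refl z≤n)

      callBound : ℕ
      callBound = R input + ((1 + 2 * vars prog) + ρ)

      world : Query oracle
      world = record { input = input ; callTime = callBound ; oracle≤callTime = λ G t G≤F t≤n → +-mono-≤
        (≤-trans (reduceₚ .timeBound .bounded (n , G , t))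
          (^-monoˡ-≤ (reduceₚ .timeBound .degree) (size-instance {n} {F} {G} {t} G≤F t≤n)))
        (+-monoʳ-≤ (1 + 2 * vars prog) (answer≤ρ G t G≤F t≤n)) }

      total≤ : timeOf (searchC oracle) input ≤ Q input * ρ
      total≤ = begin
        timeOf (searchC oracle) input                       ≤⟨ factor≤ world ⟩
        factor input * suc callBound                                ≤⟨ *-monoʳ-≤ (factor input) suc-callBound≤ ⟩
        factor input * ((3 + (R input + 2 * vars prog)) * ρ) ≡⟨ *-assoc (factor input) _ ρ ⟨
        Q input * ρ                                         ∎
        where
        open ≤-Reasoning
        c = R input + 2 * vars prog
        suc-callBound≤ : suc callBound ≤ (3 + c) * ρ
        suc-callBound≤ = begin
          suc callBound              ≡⟨ solve 3 (λ x y z → con 1 :+ (x :+ (con 1 :+ y :+ z)) ⊜ z :+ (con 2 :+ (x :+ y))) refl (R input) (2 * vars prog) ρ ⟩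
          ρ + (2 + c)        ≤⟨ +-monoʳ-≤ ρ (m≤m*n (2 + c) ρ ⦃ >-nonZero 1≤ρ ⦄) ⟩
          (3 + c) * ρ        ∎

      ρ-power : ρ ^ D′ ≤ (P input * 2 ^ (s * 5)) ^ D′ * 2 ^ (b * n)
      ρ-power = power-≤ {ρ} {P input} {D} {D′} {a * k} {s * 5} {b * n} (proj₁ (proj₂ roots))
        (exponent n (blocks s n) (n≤s*blocks 1≤s n) (s*blocks≤ 1≤s n))

      W≤ : W input ≤ 3 ^ w * suc (n + length family) ^ (2 * w)
      W≤ = begin
        W input                                     ≤⟨ W-poly .bounded input ⟩
        (2 + size inputTy input) ^ w                ≤⟨ ^-monoˡ-≤ w (size-setSystem S) ⟩
        (3 * suc (n + length family) ^ 2) ^ w       ≡⟨ ^-distribʳ-* w 3 _ ⟩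
        3 ^ w * (suc (n + length family) ^ 2) ^ w   ≡⟨ cong (3 ^ w *_) (^-*-assoc (suc (n + length family)) 2 w) ⟩
        3 ^ w * suc (n + length family) ^ (2 * w)   ∎
        where open ≤-Reasoning

      within : ∀ {T} → T ≤ timeOf (searchC oracle) input →
               T ^ D′ ≤ (3 ^ w * suc (n + length family) ^ (2 * w)) ^ D′ * 2 ^ (b * n)
      within {T} T≤ = begin
        T ^ D′                                                         ≤⟨ ^-monoˡ-≤ D′ (≤-trans T≤ total≤) ⟩
        (Q input * ρ) ^ D′                                             ≡⟨ ^-distribʳ-* D′ (Q input) ρ ⟩
        Q input ^ D′ * ρ ^ D′                                          ≤⟨ *-monoʳ-≤ (Q input ^ D′) ρ-power ⟩
        Q input ^ D′ * ((P input * 2 ^ (s * 5)) ^ D′ * 2 ^ (b * n))    ≡⟨ *-assoc (Q input ^ D′) _ (2 ^ (b * n)) ⟨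
        Q input ^ D′ * (P input * 2 ^ (s * 5)) ^ D′ * 2 ^ (b * n)      ≡⟨ cong (_* 2 ^ (b * n)) (sym (^-distribʳ-* D′ (Q input) _)) ⟩
        W input ^ D′ * 2 ^ (b * n)                                     ≤⟨ *-monoˡ-≤ (2 ^ (b * n)) (^-monoˡ-≤ D′ W≤) ⟩
        (3 ^ w * suc (n + length family) ^ (2 * w)) ^ D′ * 2 ^ (b * n) ∎
        where open ≤-Reasoning

    solved : SetCover SolvableInTimeO*2^[ β ]
    solved = algorithm .code 0 , 3 ^ w , 2 * w , λ S →
      let mkExec {final} {t} run′ (eq , _) t≤ = algorithm .correct (SetSystem.elements S , bitFamily S) 0
            (initial (Problem.encode SetCover S)) (encode-input S)
      in _ , t , (final , run′ , eq) ,
         search-answers S decide (λ G t _ _ → sound (SetSystem.elements S) G t)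
           (λ G t 1≤n G⊆ → complete (SetSystem.elements S) G t 1≤n (λ A∈ → bitFamily-length S (G⊆ A∈))) ,
         fold (within S t≤)

setCover-solvable : ∀ s → 1 ≤ s → ∀ {α β} → Exponents α β s →
  HyperPath (2 + s) SolvableInTimeO*2^[ α ] → SetCover SolvableInTimeO*2^[ β ]
setCover-solvable s 1≤s {α} (negative D a unfold) solvable =
  ⊥-elim (no-negative-exponent {2 + s} {α} {D} {a} (λ {T} {P} {x} → unfold {T} {P} {x}) solvable)
setCover-solvable s 1≤s {α} {β} (nonnegative D a D′ b unfold fold exponent) (prog , C , d , solves) =
  Algorithm.solved s 1≤s {α} prog C d solves {β} D a D′ b (λ {T} {P} {x} → unfold {T} {P} {x})
    (λ {T} {P} {x} → fold {T} {P} {x}) exponent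

theorem1 : (γ : ℚ) → 0ℚ ℚ.< γ →
    ∃[ δ ] 0ℚ ℚ.< δ ×
    ((r : ℕ) (3≤r : 3 ≤ r) →
    HyperPath r SolvableInTimeO*2^[ hyperPathExponent r 3≤r γ ] →
    SetCover SolvableInTimeO*2^[ 1ℚ ℚ.- δ ])
theorem1 γ 0<γ = γ , 0<γ , solvable
  where
  solvable : (r : ℕ) (3≤r : 3 ≤ r) → HyperPath r SolvableInTimeO*2^[ hyperPathExponent r 3≤r γ ] →
             SetCover SolvableInTimeO*2^[ 1ℚ ℚ.- γ ]
  solvable (suc (suc (suc s))) _ = setCover-solvable (suc s) (s≤s z≤n) (exponents γ 0<γ (suc s))
  solvable (suc (suc zero)) (s≤s (s≤s ()))
  solvable (suc zero)       (s≤s ())
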